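{- There is a deterministic algorithm which, given independence-oracle access to two matroids $\mathcal{M}_1=(V,\mathcal{I}_1)$ and $\mathcal{M}_2=(V,\mathcal{I}_2)$ on a common ground set $V$ with $|V|=n$, uses $O(nr^{5/6}\log r + n^{6/5}r^{3/5}\log^{4/5} r)$ independence queries and solves the matroid intersection problem, i.e. outputs a maximum-cardinality set $S\in\mathcal{I}_1\cap\mathcal{I}_2$, where $r$ denotes the size of such a set. In particular, when $r=\Theta(n)$, the number of queries is $\tilde O(n^{11/6})$.
   Context: A matroid $\mathcal{M}=(V,\mathcal{I})$ consists of a finite ground set $V$ and a nonempty family $\mathcal{I}\subseteq 2^V$ of independent sets that is downward closed and satisfies the exchange property (if $A,B\in\mathcal{I}$ with $|A|<|B|$, then there is $v\in B\setminus A$ with $A\cup\{v\}\in\mathcal{I}$). In the matroid intersection problem, we are given two matroids on the same ground set $V$ of size $n$ and must find a largest common independent set $S\in\mathcal{I}_1\cap\mathcal{I}_2$; $r$ denotes its size. Access to the matroids is only through independence oracles: given $X\subseteq V$ and $i\in\{1,2\}$, the oracle answers whether $X\in\mathcal{I}_i$. The cost of an algorithm is the number of such independence queries it makes. $\tilde O$ hides polylogarithmic factors in $n$. -}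

module Defs where

open import Data.Nat using (ℕ; zero; suc; _+_; _*_; _^_; _≤_; _<_; _⊔_)
open import Data.Nat.Logarithm using (⌊log₂_⌋)
open import Data.Bool using (Bool; true; false)
open import Data.Fin using (Fin)
open import Data.Fin.Subset using (Subset; _⊆_; ∣_∣; ⊥; _∈_; _∉_; _∪_; ⁅_⁆)
open import Data.Product using (Σ; _×_; _,_; proj₁; proj₂; ∃-syntax)
open import Data.Sum using (_⊎_)
open import Relation.Binary.PropositionalEquality using (_≡_)

record Matroid (n : ℕ) : Set where
  field
    indep      : Subset n → Bool
    indep-∅    : indep ⊥ ≡ true
    downward   : ∀ {A B} → A ⊆ B → indep B ≡ true → indep A ≡ true
    exchange   : ∀ {A B} → indep A ≡ true → indep B ≡ true → ∣ A ∣ < ∣ B ∣ →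
                 ∃[ v ] (v ∈ B × v ∉ A × indep (A ∪ ⁅ v ⁆) ≡ true)
open Matroid public

data Which : Set where
  one two : Which

-- A deterministic independence-oracle algorithm on ground set Fin n:
-- a (finite, well-founded) decision tree which at each node either
-- returns an output set, or asks the oracle of matroid i whether X is
-- independent and continues depending on the Boolean answer.
data Alg (n : ℕ) : Set where
  ret : Subset n → Alg n
  ask : Subset n → Which → (Bool → Alg n) → Alg n

oracle : ∀ {n} → Matroid n → Matroid n → Which → Subset n → Bool
oracle M₁ M₂ one X = indep M₁ X
oracle M₁ M₂ two X = indep M₂ X

run : ∀ {n} → Alg n → Matroid n → Matroid n → Subset n × ℕ
run (ret S)       M₁ M₂ = S , 0
run (ask X i k)   M₁ M₂ with run (k (oracle M₁ M₂ i X)) M₁ M₂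
... | S , q = S , suc q

CommonIndep : ∀ {n} → Matroid n → Matroid n → Subset n → Set
CommonIndep M₁ M₂ S = indep M₁ S ≡ true × indep M₂ S ≡ true

MaxCommonIndep : ∀ {n} → Matroid n → Matroid n → Subset n → Set
MaxCommonIndep M₁ M₂ S =
  CommonIndep M₁ M₂ S × (∀ T → CommonIndep M₁ M₂ T → ∣ T ∣ ≤ ∣ S ∣)

-- Query bound  q ≤ C·(n r^{5/6} log r + n^{6/5} r^{3/5} log^{4/5} r)
-- (up to the constant hidden in O), written without real numbers:
-- since A + B ≤ 2 max(A,B), it suffices (and is equivalent up to
-- constants) that q ≤ C·A or q ≤ C·B, and raising to the 6th resp.
-- 5th power clears fractional exponents.  r is guarded as max(r,1) and
-- log r as 1 + ⌊log₂ r⌋.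
QueryBound : ℕ → ℕ → ℕ → ℕ → Set
QueryBound C n r q =
  q ^ 6 ≤ C * (n ^ 6 * R ^ 5 * L ^ 6) ⊎ q ^ 5 ≤ C * (n ^ 6 * R ^ 3 * L ^ 4)
  where
    R = r ⊔ 1
    L = suc ⌊log₂ r ⌋

{-# OPTIONS --safe #-}
-- A maximal common independent set has some size s with s ≤ r ≤ 2 s.  Three phases follow.
-- (1) An auction with O(s / y) levels: M₂ proposes a basis preferring low levels, M₁ accepts greedily
-- preferring high levels, rejected elements move up; it stops when fewer than y proposals are pending,
-- and the levels then certify |S| + 3 y ≥ r.
-- (2) Cunningham's shortest augmenting paths up to s^{5/6} levels.  Labels only increase, so all
-- searches together pay O(n) per level, plus O(n + s log s) per augmentation; afterwards the labels
-- certify |S| + O(s^{1/6}) ≥ r.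
-- (3) Each remaining augmentation is found by a reachability search with O(n s^{2/3} log s) queries.
-- Throughout, one query decides whether the circuit of u in S + u meets a given set, and a binary
-- search then produces an element of the intersection.
-- With y ≈ s^{5/6} if n ≤ s^{3/2}, and y ≈ (n s³ log⁴ s)^{1/5} otherwise, the sum is within the bound.
module Submission where

open import Defs
open import Data.Bool using (Bool; true; false; if_then_else_)
open import Data.Empty using (⊥-elim) renaming (⊥ to Absurd)
open import Data.Fin using (Fin; zero; suc)
open import Data.Fin.Properties using (any?)
import Data.Fin.Properties as Fin
open import Data.Fin.Subset using (Subset; _⊆_; ∣_∣; ⊥; _∈_; _∉_; _∪_; _∩_; ∁; ⁅_⁆; inside; outside)
open import Data.Fin.Subset.Properties hiding (⊆-refl; ⊆-trans; ⊆-reflexive)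
open import Data.List using (List; []; _∷_; map; filter; _++_; _ʳ++_; reverse; length; take; drop; allFin)
open import Data.List.Membership.Propositional using () renaming (_∈_ to _∈ₗ_; _∉_ to _∉ₗ_)
open import Data.List.Membership.Propositional.Properties using (∈-map⁺; ∈-map⁻; ∈-filter⁺; ∈-filter⁻; ∈-allFin; ∈-++⁺ʳ)
import Data.List.Membership.DecPropositional as DecMem
import Data.List.Properties as List
open import Data.List.Relation.Binary.Permutation.Propositional using (_↭_; ↭-sym)
open import Data.List.Relation.Binary.Permutation.Propositional.Properties using (↭-reverse; ∈-resp-↭; ↭-length; map⁺)
open import Data.List.Relation.Unary.All as All using (All; []; _∷_)
import Data.List.Relation.Unary.All.Properties as Allₚ
open import Data.List.Relation.Unary.AllPairs using (AllPairs; []; _∷_)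
open import Data.List.Relation.Unary.Any using (here; there)
open import Data.List.Relation.Unary.Linked.Properties using (Linked⇒AllPairs)
open import Data.List.Sort using (sort; sort-↭; sort-↗)
open import Data.Nat
open import Data.Nat.DivMod using (_/_; m/n*n≤m; m≡m%n+[m/n]*n; m%n<n)
open import Data.Nat.Logarithm using (⌊log₂_⌋; ⌊log₂⌋-mono-≤; ⌊log₂[2^n]⌋≡n)
open import Data.Nat.Properties
open import Data.Nat.Tactic.RingSolver using (solve-∀)
open import Data.Product using (Σ; _×_; _,_; proj₁; proj₂; ∃-syntax)
open import Data.Sum using (_⊎_; inj₁; inj₂; [_,_]′)
open import Data.Unit using (⊤; tt)
open import Data.Vec using ([]; _∷_; tabulate)
import Data.Vec.Properties as Vec
open import Function using (_∘_; id; case_of_)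
import Relation.Binary.Construct.On as On
open import Relation.Binary.PropositionalEquality
open import Relation.Nullary using (¬_; Dec; yes; no; does; _×-dec_; _⊎-dec_; ¬?)
open import Relation.Nullary.Decidable using (dec-true; decidable-stable)

-- Matroid closure

-- The exchange graph is never written down: a single edge costs a binary search, and an
-- augmentation may change many edges. Everything is phrased through spans instead, which one query
-- tests. The first two phases keep the same pair of label conditions. Each threshold between two
-- levels gives a cut bound that errs only by the elements of `S` on that level and the pending
-- proposals, so averaging over D thresholds leaves |S| / D. In the third phase the danger is that
-- visiting one v spoils many neighbour lists at once. With at most c lists containing any v, a
-- visited v costs at most c entries, so no more than n h + |S| c entries are ever made. At most n h
-- / c unvisited elements are saturated at a time, and a u without other neighbours queries those
-- one by one. The auction costs about n² s / y² queries, which is O(n y), like the gap of 3 y left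
-- for the second phase, once y³ is of order n s. Both choices of y ensure this when y < s;
-- otherwise the maximal set is already good enough. Stopping at s^{5/6} levels leaves O(s^{1/6})
-- searches of cost n s^{2/3}, matching the n s^{5/6} label increases up to the logarithm.

abstract
  ⟦_⟧ : ∀ {n} {P : Fin n → Set} → (∀ x → Dec (P x)) → Subset n
  ⟦ P? ⟧ = tabulate (λ x → does (P? x))

  ∈⟦⟧⁺ : ∀ {n} {P : Fin n → Set} (P? : ∀ x → Dec (P x)) {x} → P x → x ∈ ⟦ P? ⟧
  ∈⟦⟧⁺ P? {x} p =
    Vec.lookup⇒[]= x _ (trans (Vec.lookup∘tabulate (λ y → does (P? y)) x) (dec-true (P? x) p))

  ∈⟦⟧⁻ : ∀ {n} {P : Fin n → Set} (P? : ∀ x → Dec (P x)) {x} → x ∈ ⟦ P? ⟧ → P x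
  ∈⟦⟧⁻ P? {x} x∈ with P? x | trans (sym (Vec.lookup∘tabulate (λ y → does (P? y)) x)) (Vec.[]=⇒lookup x∈)
  ... | yes p | _ = p

  infixl 6 _⊕_
  _⊕_ : ∀ {n} → Subset n → Fin n → Subset n
  X ⊕ y = X ∪ ⁅ y ⁆

  ⊕-def : ∀ {n} (X : Subset n) y → X ⊕ y ≡ X ∪ ⁅ y ⁆
  ⊕-def X y = refl

  ∪-∈ˡ : ∀ {n} {X : Subset n} {x} y → x ∈ X → x ∈ X ⊕ y
  ∪-∈ˡ y x∈ = x∈p∪q⁺ (inj₁ x∈)

  ∪-∈ʳ : ∀ {n} (X : Subset n) y → y ∈ X ⊕ y
  ∪-∈ʳ X y = x∈p∪q⁺ (inj₂ (x∈⁅x⁆ y))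

  ∪-∈⁻ : ∀ {n} (X : Subset n) {x} y → x ∈ X ⊕ y → x ∈ X ⊎ x ≡ y
  ∪-∈⁻ X y x∈ with x∈p∪q⁻ X ⁅ y ⁆ x∈
  ... | inj₁ p = inj₁ p
  ... | inj₂ p = inj₂ (x∈⁅y⁆⇒x≡y y p)

  del : ∀ {n} → Subset n → Fin n → Subset n
  del T v = ⟦ (λ x → x ∈? T ×-dec ¬? (x Fin.≟ v)) ⟧

  del⁺ : ∀ {n} {T : Subset n} {x v} → x ∈ T → x ≢ v → x ∈ del T v
  del⁺ p q = ∈⟦⟧⁺ (λ x → x ∈? _ ×-dec ¬? (x Fin.≟ _)) (p , q)

  del⁻ : ∀ {n} {T : Subset n} {x v} → x ∈ del T v → x ∈ T × x ≢ v
  del⁻ {n} {T} {x} {v} = ∈⟦⟧⁻ (λ x → x ∈? T ×-dec ¬? (x Fin.≟ v))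

⊕-⊆ : ∀ {n} {X Y : Subset n} {y} → X ⊆ Y → y ∈ Y → X ⊕ y ⊆ Y
⊕-⊆ {X = X} {y = y} s y∈ x∈ with ∪-∈⁻ X y x∈
... | inj₁ p = s p
... | inj₂ refl = y∈

∣∪∣≤ : ∀ {n} (X Y : Subset n) → ∣ X ∪ Y ∣ ≤ ∣ X ∣ + ∣ Y ∣
∣∪∣≤ [] [] = z≤n
∣∪∣≤ (outside ∷ X) (outside ∷ Y) = ∣∪∣≤ X Y
∣∪∣≤ (outside ∷ X) (inside ∷ Y) rewrite +-suc ∣ X ∣ ∣ Y ∣ = s≤s (∣∪∣≤ X Y)
∣∪∣≤ (inside ∷ X) (outside ∷ Y) = s≤s (∣∪∣≤ X Y)
∣∪∣≤ (inside ∷ X) (inside ∷ Y) = s≤s (≤-trans (∣∪∣≤ X Y) (+-monoʳ-≤ ∣ X ∣ (n≤1+n _)))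

∣∪⁅⁆∣> : ∀ {n} {X : Subset n} {y} → y ∉ X → ∣ X ∣ < ∣ X ⊕ y ∣
∣∪⁅⁆∣> {X = X} {y} y∉ = p⊂q⇒∣p∣<∣q∣ (∪-∈ˡ y , y , ∪-∈ʳ X y , y∉)

module _ {n : ℕ} where

  del-∪ : ∀ {T : Subset n} {v} → T ⊆ del T v ⊕ v
  del-∪ {T} {v} {x} x∈ with x Fin.≟ v
  ... | yes refl = ∪-∈ʳ _ x
  ... | no x≢ = ∪-∈ˡ v (del⁺ x∈ x≢)

  del-⊆ : ∀ {T : Subset n} {v} → del T v ⊆ T
  del-⊆ x∈ = proj₁ (del⁻ x∈)

  del-mono : ∀ {T U : Subset n} {v} → T ⊆ U → del T v ⊆ del U v
  del-mono T⊆U x∈ = let p , q = del⁻ x∈ in del⁺ (T⊆U p) q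

  del-∪-∈ : ∀ {T : Subset n} {v} → v ∈ T → del T v ⊕ v ⊆ T
  del-∪-∈ {T} {v} v∈ x∈ with ∪-∈⁻ (del T v) v x∈
  ... | inj₁ p = del-⊆ p
  ... | inj₂ refl = v∈

  _∖_ : Subset n → List (Fin n) → Subset n
  X ∖ [] = X
  X ∖ (v ∷ vs) = del (X ∖ vs) v

  ∖-⊆ : ∀ (X : Subset n) vs → X ∖ vs ⊆ X
  ∖-⊆ X [] x∈ = x∈
  ∖-⊆ X (v ∷ vs) x∈ = ∖-⊆ X vs (del-⊆ x∈)

  ∖-∈⁻ : ∀ {X : Subset n} {x} vs → x ∈ X ∖ vs → x ∈ X × x ∉ₗ vs
  ∖-∈⁻ [] x∈ = x∈ , λ ()
  ∖-∈⁻ (v ∷ vs) x∈ = let p , q = del⁻ x∈ ; a , b = ∖-∈⁻ vs p in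
    a , λ { (here e) → q e ; (there i) → b i }

  ∖-∈⁺ : ∀ {X : Subset n} {x} vs → x ∈ X → x ∉ₗ vs → x ∈ X ∖ vs
  ∖-∈⁺ [] x∈ _ = x∈
  ∖-∈⁺ (v ∷ vs) x∈ x∉ = del⁺ (∖-∈⁺ vs x∈ (x∉ ∘ there)) (x∉ ∘ here)

module Closure {n : ℕ} (M : Matroid n) where

  Ind : Subset n → Set
  Ind X = indep M X ≡ true

  -- At most one oracle answer decides this. It is matroid closure when `X` is independent; a
  -- dependent `X` spans everything here, which is why the lemmas composing spans carry independence
  -- hypotheses.
  Cl : Subset n → Fin n → Set
  Cl X e = e ∈ X ⊎ indep M (X ⊕ e) ≡ false

  Spans : Subset n → Subset n → Set
  Spans X Y = ∀ {e} → e ∈ Y → Cl X e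

  cl? : ∀ X e → Dec (Cl X e)
  cl? X e with e ∈? X
  ... | yes p = yes (inj₁ p)
  ... | no e∉ with indep M (X ⊕ e) in eq
  ... | false = yes (inj₂ refl)
  ... | true = no λ where
          (inj₁ p) → e∉ p
          (inj₂ ())

  ¬Cl⇒∉ : ∀ {X e} → ¬ Cl X e → e ∉ X
  ¬Cl⇒∉ ¬c e∈ = ¬c (inj₁ e∈)

  ¬Cl⇒Ind : ∀ {X e} → ¬ Cl X e → Ind (X ⊕ e)
  ¬Cl⇒Ind {X} {e} ¬c with indep M (X ⊕ e) in eq
  ... | true = refl
  ... | false = ⊥-elim (¬c (inj₂ refl))

  Ind⇒¬Cl : ∀ {X e} → e ∉ X → Ind (X ⊕ e) → ¬ Cl X e
  Ind⇒¬Cl e∉ i (inj₁ p) = e∉ p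
  Ind⇒¬Cl e∉ i (inj₂ q) = case trans (sym i) q of λ ()

  cl-mono : ∀ {X Y e} → X ⊆ Y → Cl X e → Cl Y e
  cl-mono X⊆Y (inj₁ p) = inj₁ (X⊆Y p)
  cl-mono {X} {Y} {e} X⊆Y (inj₂ d) with indep M (Y ⊕ e) in eq
  ... | false = inj₂ refl
  ... | true = case trans (sym d) (downward M (⊕-⊆ (∪-∈ˡ e ∘ X⊆Y) (∪-∈ʳ Y e)) eq) of λ ()

  exchange′ : ∀ {A B} → Ind A → Ind B → ∣ A ∣ < ∣ B ∣ → ∃[ v ] (v ∈ B × v ∉ A × Ind (A ⊕ v))
  exchange′ {A} iA iB lt with exchange M iA iB lt
  ... | v , p , q , i = v , p , q , trans (cong (indep M) (⊕-def A v)) i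

  span-bound : ∀ {X T} → Ind X → Ind T → Spans X T → ∣ T ∣ ≤ ∣ X ∣
  span-bound {X} {T} iX iT sp with ∣ T ∣ ≤? ∣ X ∣
  ... | yes p = p
  ... | no ¬p with exchange′ iX iT (≰⇒> ¬p)
  ... | v , v∈ , v∉ , i = ⊥-elim (Ind⇒¬Cl v∉ i (sp v∈))

  extend-to : ∀ d {A B} → Ind A → Ind B → ∣ B ∣ ≤ ∣ A ∣ + d →
              ∃[ A′ ] (A ⊆ A′ × (∀ {x} → x ∈ A′ → x ∈ A ⊎ x ∈ B) × Ind A′ × ∣ B ∣ ≤ ∣ A′ ∣)
  extend-to zero {A} iA iB le = A , id , inj₁ , iA , subst (_ ≤_) (+-identityʳ _) le
  extend-to (suc d) {A} {B} iA iB le with ∣ B ∣ ≤? ∣ A ∣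
  ... | yes p = A , id , inj₁ , iA , p
  ... | no ¬p with exchange′ iA iB (≰⇒> ¬p)
  ... | v , v∈ , v∉ , i with extend-to d i iB
            (≤-trans (≤-trans le (≤-reflexive (+-suc ∣ A ∣ d))) (+-monoˡ-≤ d (∣∪⁅⁆∣> v∉)))
  ... | A′ , sub , sup , i′ , le′ = A′ , sub ∘ ∪-∈ˡ v , sup′ , i′ , le′
          where
          sup′ : ∀ {x} → x ∈ A′ → x ∈ A ⊎ x ∈ B
          sup′ x∈ with sup x∈
          ... | inj₂ q = inj₂ q
          ... | inj₁ q with ∪-∈⁻ A v q
          ... | inj₁ r = inj₁ r
          ... | inj₂ refl = inj₂ v∈

  -- If X ∪ e were independent, Y could be enlarged inside Y ∪ X ∪ e beyond the size of X
  -- without using e, although X spans it.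
  cl-trans : ∀ {X Y e} → Ind X → Ind Y → Spans X Y → Cl Y e → Cl X e
  cl-trans {X} {Y} {e} iX iY sp c with cl? X e
  ... | yes p = p
  ... | no ¬c with extend-to ∣ X ⊕ e ∣ iY (¬Cl⇒Ind ¬c) (m≤n+m _ ∣ Y ∣)
  ... | Z , Y⊆Z , Z⊆ , iZ , le =
    ⊥-elim (<⇒≱ (∣∪⁅⁆∣> (¬Cl⇒∉ ¬c)) (≤-trans le (span-bound iX iZ spZ)))
    where
    spZ : Spans X Z
    spZ {z} z∈ with Z⊆ z∈
    ... | inj₁ q = sp q
    ... | inj₂ q with ∪-∈⁻ X e q
    ... | inj₁ r = inj₁ r
    ... | inj₂ refl with e ∈? Y
    ... | yes e∈Y = ⊥-elim (¬c (sp e∈Y))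
    ... | no e∉Y = ⊥-elim (Ind⇒¬Cl e∉Y (downward M below iZ) c)
      where
      below : Y ⊕ e ⊆ Z
      below x∈ with ∪-∈⁻ Y e x∈
      ... | inj₁ a = Y⊆Z a
      ... | inj₂ refl = z∈

  -- The dependent set consists of `X`, `e` and `f`, whatever the order of insertion. Only
  -- `e ∈ X ⊕ f` is separate, and there `e` must be `f`.
  steinitz : ∀ {X e f} → ¬ Cl X e → Cl (X ⊕ f) e → Cl (X ⊕ e) f
  steinitz {X} {e} {f} ¬c (inj₁ p) with ∪-∈⁻ X f p
  ... | inj₁ q = ⊥-elim (¬c (inj₁ q))
  ... | inj₂ refl = inj₁ (∪-∈ʳ X f)
  steinitz {X} {e} {f} ¬c (inj₂ d) = inj₂ (subst (λ Z → indep M Z ≡ false) (⊆-antisym (sw e f) (sw f e)) d)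
    where
    sw : ∀ e f → X ⊕ f ⊕ e ⊆ X ⊕ e ⊕ f
    sw e f x∈ with ∪-∈⁻ (X ⊕ f) e x∈
    ... | inj₂ refl = ∪-∈ˡ f (∪-∈ʳ X e)
    ... | inj₁ q with ∪-∈⁻ X f q
    ... | inj₁ r = ∪-∈ˡ f (∪-∈ˡ e r)
    ... | inj₂ refl = ∪-∈ʳ _ f

  ind⇒¬cl-del : ∀ {T v} → Ind T → v ∈ T → ¬ Cl (del T v) v
  ind⇒¬cl-del iT v∈ = Ind⇒¬Cl (λ p → proj₂ (del⁻ p) refl) (downward M (del-∪-∈ v∈) iT)

  -- Uniqueness of the circuit of `u` in `X + u`, without naming it. If `Y − v` did not span `u`,
  -- exchange would put `v` into the span of `Y − v + u`, hence of `X − v`, against the independence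
  -- of `X`.
  cl-∩ : ∀ {X Y u v} → Ind X → Y ⊆ X → v ∈ X → Cl Y u → Cl (del X v) u → Cl (del Y v) u
  cl-∩ {X} {Y} {u} {v} iX Y⊆X v∈X cY cX with cl? (del Y v) u
  ... | yes p = p
  ... | no ¬c = ⊥-elim (ind⇒¬cl-del iX v∈X (cl-trans (downward M del-⊆ iX) (¬Cl⇒Ind ¬c) sp
                          (steinitz ¬c (cl-mono del-∪ cY))))
    where
    sp : Spans (del X v) (del Y v ⊕ u)
    sp e∈ with ∪-∈⁻ (del Y v) u e∈
    ... | inj₁ p = inj₁ (del-mono Y⊆X p)
    ... | inj₂ refl = cX

  -- The arc of the exchange graph: `v` lies on the circuit of `u` in `S + u`. An element not
  -- spanned by `S` has no edges; in `M₁` these are the sources, in `M₂` the sinks.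
  Edge : Subset n → Fin n → Fin n → Set
  Edge S u v = v ∈ S × u ∉ S × Cl S u × ¬ Cl (del S v) u

  -- By repeated `cl-∩`, elements off the circuit of `u` may be deleted jointly. The contrapositive
  -- turns a failed joint test into the existence of a single circuit element.
  cl-∖ : ∀ {X u} vs → Ind X → Cl X u → All (λ v → v ∈ X × Cl (del X v) u) vs → Cl (X ∖ vs) u
  cl-∖ [] iX c [] = c
  cl-∖ {X} (v ∷ vs) iX c ((v∈ , d) ∷ ds) = cl-∩ iX (∖-⊆ X vs) v∈ (cl-∖ vs iX c ds) d

-- A common independent set splits into a part spanned in M₁ by Y₁ and a part spanned in M₂ by Y₂.
cut-bound : ∀ {n} (M₁ M₂ : Matroid n) {X : Fin n → Set} (X? : ∀ e → Dec (X e)) {Y₁ Y₂ T : Subset n} →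
            indep M₁ Y₁ ≡ true → indep M₂ Y₂ ≡ true → CommonIndep M₁ M₂ T →
            (∀ e → X e → Closure.Cl M₁ Y₁ e) → (∀ e → ¬ X e → Closure.Cl M₂ Y₂ e) →
            ∣ T ∣ ≤ ∣ Y₁ ∣ + ∣ Y₂ ∣
cut-bound M₁ M₂ {X} X? {Y₁} {Y₂} {T} i₁ i₂ (t₁ , t₂) c₁ c₂ =
  ≤-trans (p⊆q⇒∣p∣≤∣q∣ split) (≤-trans (∣∪∣≤ TX TX′) (+-mono-≤
    (Closure.span-bound M₁ i₁ (downward M₁ (λ x∈ → proj₁ (∈⟦⟧⁻ P? x∈)) t₁) (λ x∈ → c₁ _ (proj₂ (∈⟦⟧⁻ P? x∈))))
    (Closure.span-bound M₂ i₂ (downward M₂ (λ x∈ → proj₁ (∈⟦⟧⁻ Q? x∈)) t₂) (λ x∈ → c₂ _ (proj₂ (∈⟦⟧⁻ Q? x∈))))))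
  where
  P? : ∀ x → Dec (x ∈ T × X x)
  P? x = x ∈? T ×-dec X? x
  Q? : ∀ x → Dec (x ∈ T × ¬ X x)
  Q? x = x ∈? T ×-dec ¬? (X? x)
  TX TX′ : Subset _
  TX = ⟦ P? ⟧
  TX′ = ⟦ Q? ⟧
  split : T ⊆ TX ∪ TX′
  split {x} x∈ with X? x
  ... | yes p = x∈p∪q⁺ (inj₁ (∈⟦⟧⁺ P? (x∈ , p)))
  ... | no ¬p = x∈p∪q⁺ (inj₂ (∈⟦⟧⁺ Q? (x∈ , ¬p)))

-- Exchanges

module Exchange {n : ℕ} (M : Matroid n) where
  open Closure M

  swap : Subset n → List (Fin n × Fin n) → Subset n
  swap T [] = T
  swap T ((v , u) ∷ ps) = swap (del T v ⊕ u) ps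

  -- A triangular exchange matrix: `u` may be adjacent to its own `v` and to those of earlier pairs,
  -- but to none of the later ones. This lets the swaps be made one after another.
  data Tri (T : Subset n) : List (Fin n × Fin n) → Set where
    [] : Tri T []
    _∷_ : ∀ {v u ps} → Edge T u v × All (λ p → Cl (del T (proj₁ p)) u) ps →
          Tri T ps → Tri T ((v , u) ∷ ps)

  module Step {T u v} (iT : Ind T) (e : Edge T u v) where
    private
      v∈ = proj₁ e
      u∉ = proj₁ (proj₂ e)
      cu = proj₁ (proj₂ (proj₂ e))
      ¬cu = proj₂ (proj₂ (proj₂ e))

    T₁ : Subset n
    T₁ = del T v ⊕ u

    iT₁ : Ind T₁
    iT₁ = ¬Cl⇒Ind ¬cu

    spans : Spans T T₁
    spans x∈ with ∪-∈⁻ (del T v) u x∈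
    ... | inj₁ p = inj₁ (del-⊆ p)
    ... | inj₂ refl = cu

    spans⁻ : Spans T₁ T
    spans⁻ {x} x∈ with x Fin.≟ v
    ... | no x≢ = inj₁ (∪-∈ˡ u (del⁺ x∈ x≢))
    ... | yes refl = steinitz ¬cu (cl-mono del-∪ cu)

    module _ {w} (w∈ : w ∈ T) (c : Cl (del T w) u) where

      spans-del : Spans (del T w) (del T₁ w)
      spans-del x∈ with del⁻ x∈
      ... | x∈T₁ , x≢ with ∪-∈⁻ (del T v) u x∈T₁
      ... | inj₁ p = inj₁ (del⁺ (del-⊆ p) x≢)
      ... | inj₂ refl = c

      -- Only `v` has to be recovered: it is exchanged against `u` over `T − v − w`.
      spans-del⁻ : Spans (del T₁ w) (del T w)
      spans-del⁻ {x} x∈ with del⁻ x∈ | x Fin.≟ v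
      ... | x∈T , x≢ | no x≢v = inj₁ (del⁺ (∪-∈ˡ u (del⁺ x∈T x≢v)) x≢)
      ... | x∈T , x≢ | yes refl =
        cl-mono (⊕-⊆ (λ y∈ → let p , q = del⁻ y∈ in del⁺ (∪-∈ˡ u p) q) (del⁺ (∪-∈ʳ _ u) λ { refl → u∉ w∈ }))
          (steinitz (¬cu ∘ cl-mono del-⊆) (cl-mono sub c))
        where
        sub : del T w ⊆ del (del T v) w ⊕ v
        sub {y} y∈ with del⁻ y∈ | y Fin.≟ v
        ... | p , q | yes refl = ∪-∈ʳ _ y
        ... | p , q | no r = ∪-∈ˡ v (del⁺ (del⁺ p r) q)

    -- The swap preserves the span of `T` and, because `u` avoids every later `v′`, also the span of
    -- `T − v′`. The remaining pairs therefore see `T₁` exactly as they saw `T`.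
    tri : ∀ {ps} → All (λ p → Cl (del T (proj₁ p)) u) ps → Tri T ps → Tri T₁ ps
    tri [] [] = []
    tri {(v′ , u′) ∷ ps} (c ∷ cs) (((v′∈ , u′∉ , cu′ , ¬cu′) , as) ∷ t) =
      ((∪-∈ˡ u (del⁺ v′∈ λ { refl → ¬cu c })
       , (λ u′∈ → case ∪-∈⁻ (del T v) u u′∈ of λ { (inj₁ p) → u′∉ (del-⊆ p) ; (inj₂ refl) → ¬cu′ c })
       , cl-trans iT₁ iT spans⁻ cu′
       , λ d → ¬cu′ (cl-trans (downward M del-⊆ iT) (downward M del-⊆ iT₁) (spans-del v′∈ c) d))
      , others cs t as) ∷ tri cs t
      where
      others : ∀ {qs} → All (λ p → Cl (del T (proj₁ p)) u) qs → Tri T qs →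
               All (λ p → Cl (del T (proj₁ p)) u′) qs → All (λ p → Cl (del T₁ (proj₁ p)) u′) qs
      others [] [] [] = []
      others (c ∷ cs) ((e , _) ∷ t) (a ∷ as) =
        cl-trans (downward M del-⊆ iT₁) (downward M del-⊆ iT) (spans-del⁻ (proj₁ e) c) a ∷ others cs t as

  swap-ind : ∀ {T ps} → Ind T → Tri T ps → Ind (swap T ps)
  swap-ind iT [] = iT
  swap-ind iT ((e , as) ∷ t) = swap-ind (Step.iT₁ iT e) (Step.tri iT e as t)

  swap-spans : ∀ {T ps} → Ind T → Tri T ps → Spans (swap T ps) T
  swap-spans iT [] = inj₁
  swap-spans iT ((e , as) ∷ t) x∈ =
    let t′ = Step.tri iT e as t ; i = Step.iT₁ iT e in
    cl-trans (swap-ind i t′) i (swap-spans i t′) (Step.spans⁻ iT e x∈)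

  swap-spanned : ∀ {T ps} → Ind T → Tri T ps → Spans T (swap T ps)
  swap-spanned iT [] = inj₁
  swap-spanned iT ((e , as) ∷ t) x∈ =
    let t′ = Step.tri iT e as t ; i = Step.iT₁ iT e in
    cl-trans iT i (Step.spans iT e) (swap-spanned i t′ x∈)

  tri-∈ : ∀ {T ps} → Tri T ps → All (λ p → proj₁ p ∈ T) ps
  tri-∈ [] = []
  tri-∈ ((e , _) ∷ t) = proj₁ e ∷ tri-∈ t

  swap-∈⁻ : ∀ {T x} ps → x ∈ swap T ps → (x ∈ T × x ∉ₗ map proj₁ ps) ⊎ x ∈ₗ map proj₂ ps
  swap-∈⁻ [] x∈ = inj₁ (x∈ , λ ())
  swap-∈⁻ ((v , u) ∷ ps) x∈ with swap-∈⁻ ps x∈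
  ... | inj₂ q = inj₂ (there q)
  ... | inj₁ (p , ∉) with ∪-∈⁻ _ u p
  ... | inj₂ refl = inj₂ (here refl)
  ... | inj₁ d = let a , b = del⁻ d in inj₁ (a , λ { (here e) → b e ; (there i) → ∉ i })

  swap-∈⁺ : ∀ {T x} ps → x ∈ T → x ∉ₗ map proj₁ ps → x ∈ swap T ps
  swap-∈⁺ [] x∈ _ = x∈
  swap-∈⁺ ((v , u) ∷ ps) x∈ x∉ = swap-∈⁺ ps (∪-∈ˡ u (del⁺ x∈ (x∉ ∘ here))) (x∉ ∘ there)

  swap-∈⁺′ : ∀ {T x ps} → Ind T → Tri T ps → x ∈ₗ map proj₂ ps → x ∈ swap T ps
  swap-∈⁺′ {ps = (v , u) ∷ ps} iT ((e , as) ∷ t) (here refl) =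
    swap-∈⁺ ps (∪-∈ʳ _ u) λ i → case ∈-map⁻ proj₁ i of λ { (p , p∈ , refl) →
      proj₁ (proj₂ e) (All.lookup (tri-∈ t) p∈) }
  swap-∈⁺′ iT ((e , as) ∷ t) (there i) = swap-∈⁺′ (Step.iT₁ iT e) (Step.tri iT e as t) i

  -- Once `T` spans `u`, the circuit of `u` in `S + u` lies inside `T + u`, so adjacency and
  -- non-adjacency both pass from `S` to `T`.
  tri-filter : ∀ {S T ps} → Ind S → T ⊆ S → Tri S ps →
               (∀ {v u} → (v , u) ∈ₗ ps → v ∈ T → Cl T u) →
               Tri T (filter (λ p → proj₁ p ∈? T) ps)
  tri-filter iS T⊆S [] h = []
  tri-filter {S} {T} {(v , u) ∷ ps} iS T⊆S (((v∈ , u∉ , cu , ¬cu) , as) ∷ t) h with v ∈? T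
  ... | no _ = tri-filter iS T⊆S t (h ∘ there)
  ... | yes v∈T = ((v∈T , u∉ ∘ T⊆S , cT , ¬cu ∘ cl-mono (del-mono T⊆S))
                  , Allₚ.filter⁺ (λ p → proj₁ p ∈? T) (others (tri-∈ t) as)) ∷ tri-filter iS T⊆S t (h ∘ there)
    where
    cT : Cl T u
    cT = h (here refl) v∈T
    others : ∀ {qs} → All (λ p → proj₁ p ∈ S) qs → All (λ p → Cl (del S (proj₁ p)) u) qs →
             All (λ p → Cl (del T (proj₁ p)) u) qs
    others [] [] = []
    others (m ∷ ms) (a ∷ as) = cl-∩ iS T⊆S m cT a ∷ others ms as

  -- This is why labels survive an augmentation. `T` is to be a level set of the old `S` and `Y`
  -- that of the new one; the pairs with `v` in `T` can be swapped within `T`, and the result still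
  -- spans `T` and lies in `Y`.
  threshold-spans : ∀ {S T Y ps} → Ind S → T ⊆ S → Tri S ps →
    (∀ {v u} → (v , u) ∈ₗ ps → v ∈ T → Cl T u × u ∈ Y) →
    (∀ {x} → x ∈ T → x ∉ₗ map proj₁ ps → x ∈ Y) → Spans Y T
  threshold-spans {S} {T} {Y} {ps} iS T⊆S t h g x∈ =
    cl-mono sub (swap-spans iT (tri-filter iS T⊆S t (λ p q → proj₁ (h p q))) x∈)
    where
    P? : ∀ (p : Fin n × Fin n) → Dec (proj₁ p ∈ T)
    P? p = proj₁ p ∈? T
    iT = downward M T⊆S iS
    sub : swap T (filter P? ps) ⊆ Y
    sub y∈ with swap-∈⁻ (filter P? ps) y∈
    ... | inj₂ i with ∈-map⁻ proj₂ i
    ... | p , p∈ , refl = let a , b = ∈-filter⁻ P? p∈ in proj₂ (h a b)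
    sub y∈ | inj₁ (y∈T , y∉) = g y∈T λ i → case ∈-map⁻ proj₁ i of λ { (p , p∈ , refl) →
      y∉ (∈-map⁺ proj₁ (∈-filter⁺ P? p∈ y∈T)) }

  -- In `M₁` an outside element of a path avoids the earlier `v`s, whereas `Tri` forbids edges to
  -- later pairs; the path has to be listed backwards.
  tri-ʳ++ : ∀ {S} qs {acc} → Tri S acc →
            All (λ q → All (λ p → Cl (del S (proj₁ p)) (proj₂ q)) acc) qs →
            All (λ q → Edge S (proj₂ q) (proj₁ q)) qs →
            AllPairs (λ p q → Cl (del S (proj₁ p)) (proj₂ q)) qs → Tri S (qs ʳ++ acc)
  tri-ʳ++ [] t _ _ _ = t
  tri-ʳ++ ((v , u) ∷ qs) t (c ∷ cs) (e ∷ es) (a ∷ as) =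
    tri-ʳ++ qs ((e , c) ∷ t) (All.zipWith (λ (x , y) → x ∷ y) (a , cs)) es as

-- Level labels and augmentation along paths without shortcuts

module _ {n : ℕ} where

  abstract
    above below : Subset n → (Fin n → ℕ) → ℕ → Subset n
    above S c t = ⟦ (λ x → x ∈? S ×-dec t ≤? c x) ⟧
    below S c t = ⟦ (λ x → x ∈? S ×-dec c x ≤? t) ⟧

    above⁺ : ∀ {S c t x} → x ∈ S → t ≤ c x → x ∈ above S c t
    above⁺ {S} {c} {t} p q = ∈⟦⟧⁺ (λ x → x ∈? S ×-dec t ≤? c x) (p , q)

    above⁻ : ∀ {S c t x} → x ∈ above S c t → x ∈ S × t ≤ c x
    above⁻ {S} {c} {t} = ∈⟦⟧⁻ (λ x → x ∈? S ×-dec t ≤? c x)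

    below⁺ : ∀ {S c t x} → x ∈ S → c x ≤ t → x ∈ below S c t
    below⁺ {S} {c} {t} p q = ∈⟦⟧⁺ (λ x → x ∈? S ×-dec c x ≤? t) (p , q)

    below⁻ : ∀ {S c t x} → x ∈ below S c t → x ∈ S × c x ≤ t
    below⁻ {S} {c} {t} = ∈⟦⟧⁻ (λ x → x ∈? S ×-dec c x ≤? t)

  -- Distance labels without edges. The first says that an `M₁` edge from `v ∈ S` to an outside `u`
  -- raises the level by at most one, and that sources have level 0. With `P = S`, the second says
  -- that below level `D` an `M₂` edge from `u` to `v` never raises the level and there is no sink.
  -- So `D` is a lower bound for the distance from sources to sinks, counted in `M₁` edges.
  LabelsAbove LabelsBelow : Matroid n → Subset n → (Fin n → ℕ) → ℕ → Set
  LabelsAbove M S c t = ∀ {e} → e ∉ S → c e ≡ suc t → Closure.Cl M (above S c t) e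
  LabelsBelow M P c D = ∀ {e} → c e < D → Closure.Cl M (below P c (c e)) e

  module _ where
    open DecMem (Fin._≟_ {n}) using () renaming (_∈?_ to _∈ₗ?_)

    -- The symmetric difference of `S` with the path, described without an order, since the two
    -- matroids pair its elements differently.
    augment : Subset n → Fin n → List (Fin n × Fin n) → Subset n
    augment S u qs = ⟦ (λ x → (x ∈? S ×-dec ¬? (x ∈ₗ? map proj₁ qs)) ⊎-dec x ∈ₗ? (u ∷ map proj₂ qs)) ⟧

    augment⁺ : ∀ {S u qs x} → (x ∈ S × x ∉ₗ map proj₁ qs) ⊎ x ∈ₗ (u ∷ map proj₂ qs) → x ∈ augment S u qs
    augment⁺ = ∈⟦⟧⁺ _

    augment⁻ : ∀ {S u qs x} → x ∈ augment S u qs → (x ∈ S × x ∉ₗ map proj₁ qs) ⊎ x ∈ₗ (u ∷ map proj₂ qs)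
    augment⁻ = ∈⟦⟧⁻ _

  -- The pairing for `M₂`: each `v` goes with the outside element before it instead of the one after
  -- it, which leaves `pathEnd` unpaired in place of `u`.
  tailPairs : Fin n → List (Fin n × Fin n) → List (Fin n × Fin n)
  tailPairs u [] = []
  tailPairs u ((v , w) ∷ qs) = (v , u) ∷ tailPairs w qs

  tailPairs-proj₁ : ∀ u qs → map proj₁ (tailPairs u qs) ≡ map proj₁ qs
  tailPairs-proj₁ u [] = refl
  tailPairs-proj₁ u ((v , w) ∷ qs) = cong (v ∷_) (tailPairs-proj₁ w qs)

  pathEnd : Fin n → List (Fin n × Fin n) → Fin n
  pathEnd u [] = u
  pathEnd u ((v , w) ∷ qs) = pathEnd w qs

  tailPairs-proj₂ : ∀ u qs {x} → x ∈ₗ (u ∷ map proj₂ qs) → x ≡ pathEnd u qs ⊎ x ∈ₗ map proj₂ (tailPairs u qs)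
  tailPairs-proj₂ u [] (here refl) = inj₁ refl
  tailPairs-proj₂ u ((v , w) ∷ qs) (here refl) = inj₂ (here refl)
  tailPairs-proj₂ u ((v , w) ∷ qs) (there i) with tailPairs-proj₂ w qs i
  ... | inj₁ e = inj₁ e
  ... | inj₂ j = inj₂ (there j)

  tailPairs-proj₂⁻ : ∀ u qs {x} → x ∈ₗ map proj₂ (tailPairs u qs) → x ∈ₗ (u ∷ map proj₂ qs)
  tailPairs-proj₂⁻ u ((v , w) ∷ qs) (here refl) = here refl
  tailPairs-proj₂⁻ u ((v , w) ∷ qs) (there i) = there (tailPairs-proj₂⁻ w qs i)

-- An alternating path u, v₁, w₁, v₂, w₂, … from u to a sink of the exchange graph of S, without
-- shortcuts: no element outside S is adjacent in M₂ to a later v, or in M₁ to an earlier v,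
-- other than its neighbours on the path.
module Path {n : ℕ} (M₁ M₂ : Matroid n) (S : Subset n) where
  private
    module A = Closure M₁
    module B = Closure M₂
    module XA = Exchange M₁
    module XB = Exchange M₂

  data Path : Fin n → List (Fin n × Fin n) → Set where
    sink : ∀ {u} → u ∉ S → ¬ B.Cl S u → Path u []
    step : ∀ {u v w qs} → B.Edge S u v → All (λ q → B.Cl (del S (proj₁ q)) u) qs →
           A.Edge S w v → All (λ q → A.Cl (del S v) (proj₂ q)) qs → Path w qs → Path u ((v , w) ∷ qs)

  tri₂ : ∀ {u qs} → Path u qs → XB.Tri S (tailPairs u qs)
  tri₂ (sink _ _) = XB.[]
  tri₂ {u} (step {w = w} {qs = qs} e as _ _ p) = (e , Allₚ.map⁻ (subst (All _) (sym (tailPairs-proj₁ w qs)) (Allₚ.map⁺ as))) XB.∷ tri₂ p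

  edges₁ : ∀ {u qs} → Path u qs → All (λ q → A.Edge S (proj₂ q) (proj₁ q)) qs
  edges₁ (sink _ _) = []
  edges₁ (step _ _ e _ p) = e ∷ edges₁ p

  avoid₁ : ∀ {u qs} → Path u qs → AllPairs (λ p q → A.Cl (del S (proj₁ p)) (proj₂ q)) qs
  avoid₁ (sink _ _) = []
  avoid₁ (step _ _ _ a p) = a ∷ avoid₁ p

  tri₁ : ∀ {u qs} → Path u qs → XA.Tri S (reverse qs)
  tri₁ {qs = qs} p = XA.tri-ʳ++ qs XA.[] (All.universal (λ _ → []) qs) (edges₁ p) (avoid₁ p)

  end-sink : ∀ {u qs} → Path u qs → ¬ B.Cl S (pathEnd u qs)
  end-sink (sink _ c) = c
  end-sink (step _ _ _ _ p) = end-sink p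

  module Augment {u qs} (p : Path u qs) (i₁ : A.Ind S) (i₂ : B.Ind S) (¬c : ¬ A.Cl S u) where
    S′ : Subset n
    S′ = augment S u qs

    private
      rev∈ : ∀ {X : Set} (f : Fin n × Fin n → X) {x} → x ∈ₗ map f qs → x ∈ₗ map f (reverse qs)
      rev∈ f = ∈-resp-↭ (map⁺ f (↭-sym (↭-reverse qs)))
      rev∈⁻ : ∀ {X : Set} (f : Fin n × Fin n → X) {x} → x ∈ₗ map f (reverse qs) → x ∈ₗ map f qs
      rev∈⁻ f = ∈-resp-↭ (map⁺ f (↭-reverse qs))

    -- The swaps do not enlarge the `M₁` span of `S`, so the source `u` can still be added; `ind₂`
    -- is the same at the sink.
    ind₁ : A.Ind S′
    ind₁ = downward M₁ sub (A.¬Cl⇒Ind {XA.swap S (reverse qs)} (¬c ∘ A.cl-trans i₁ (XA.swap-ind i₁ (tri₁ p)) (XA.swap-spanned i₁ (tri₁ p))))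
      where
      sub : S′ ⊆ XA.swap S (reverse qs) ⊕ u
      sub x∈ with augment⁻ {qs = qs} x∈
      ... | inj₁ (x∈S , x∉) = ∪-∈ˡ u (XA.swap-∈⁺ (reverse qs) x∈S (x∉ ∘ rev∈⁻ proj₁))
      ... | inj₂ (here refl) = ∪-∈ʳ _ u
      ... | inj₂ (there i) = ∪-∈ˡ u (XA.swap-∈⁺′ i₁ (tri₁ p) (rev∈ proj₂ i))

    ind₂ : B.Ind S′
    ind₂ = downward M₂ sub (B.¬Cl⇒Ind {XB.swap S (tailPairs u qs)} (end-sink p ∘ B.cl-trans i₂ (XB.swap-ind i₂ (tri₂ p)) (XB.swap-spanned i₂ (tri₂ p))))
      where
      sub : S′ ⊆ XB.swap S (tailPairs u qs) ⊕ pathEnd u qs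
      sub x∈ with augment⁻ {qs = qs} x∈
      ... | inj₁ (x∈S , x∉) = ∪-∈ˡ _ (XB.swap-∈⁺ (tailPairs u qs) x∈S (x∉ ∘ subst (_ ∈ₗ_) (tailPairs-proj₁ u qs)))
      ... | inj₂ i with tailPairs-proj₂ u qs i
      ... | inj₁ refl = ∪-∈ʳ _ _
      ... | inj₂ j = ∪-∈ˡ _ (XB.swap-∈⁺′ i₂ (tri₂ p) j)

    -- Sizes are compared through spans rather than by counting path vertices: the swapped set spans
    -- `S`, and `u` lies outside it.
    card : ∣ S ∣ < ∣ S′ ∣
    card = ≤-trans (s≤s (A.span-bound iW i₁ (XA.swap-spans i₁ (tri₁ p))))
             (≤-trans (∣∪⁅⁆∣> u∉) (p⊆q⇒∣p∣≤∣q∣ sub))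
      where
      W = XA.swap S (reverse qs)
      iW = XA.swap-ind i₁ (tri₁ p)
      u∉ : u ∉ W
      u∉ u∈ = ¬c (XA.swap-spanned i₁ (tri₁ p) u∈)
      sub : W ⊕ u ⊆ S′
      sub = ⊕-⊆ (λ x∈ → augment⁺ {qs = qs} ([ (λ (a , b) → inj₁ (a , b ∘ rev∈ proj₁)) , inj₂ ∘ there ∘ rev∈⁻ proj₂ ]′ (XA.swap-∈⁻ (reverse qs) x∈)))
              (augment⁺ {qs = qs} (inj₂ (here refl)))

    -- Along the path every `M₁` edge goes up one level, so an upper level set that loses `v`
    -- receives the matching `w`.
    labels-above : ∀ {c} → All (λ q → c (proj₂ q) ≡ suc (c (proj₁ q))) qs →
                   (∀ {t} → LabelsAbove M₁ S c t) → ∀ {t} → LabelsAbove M₁ S′ c t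
    labels-above {c} lv la {t} {e} e∉ ce≡ = go (e ∈? S)
      where
      T = above S c t
      Y = above S′ c t
      T⊆S : T ⊆ S
      T⊆S x∈ = proj₁ (above⁻ x∈)
      sp : A.Spans Y T
      sp = XA.threshold-spans i₁ T⊆S (tri₁ p)
        (λ {v} {w} i v∈ → let j = ∈-resp-↭ (↭-reverse qs) i ; eq = All.lookup lv j ; t≤ = proj₂ (above⁻ v∈) in
           A.cl-mono (λ x∈ → let a , b = above⁻ x∈ in above⁺ a (≤-trans t≤ b))
             (la (proj₁ (proj₂ (All.lookup (edges₁ p) j))) eq)
           , above⁺ (augment⁺ {qs = qs} (inj₂ (there (∈-map⁺ proj₂ j)))) (≤-trans t≤ (≤-trans (n≤1+n _) (≤-reflexive (sym eq)))))
        (λ x∈ x∉ → let a , b = above⁻ x∈ in above⁺ (augment⁺ {qs = qs} (inj₁ (a , x∉ ∘ rev∈ proj₁))) b)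
      go : Dec (e ∈ S) → A.Cl Y e
      go (yes e∈) = sp (above⁺ e∈ (≤-trans (n≤1+n t) (≤-reflexive (sym ce≡))))
      go (no e∉S) = A.cl-trans (downward M₁ (λ x∈ → proj₁ (above⁻ x∈)) ind₁) (downward M₁ T⊆S i₁) sp (la e∉S ce≡)

    -- The `M₂` edges of the path stay on one level, so a lower level set exchanges `v` for an
    -- element of the same level.
    labels-below : ∀ {c D} → All (λ q → c (proj₁ q) ≡ c (proj₂ q)) (tailPairs u qs) →
                   LabelsBelow M₂ S c D → LabelsBelow M₂ S′ c D
    labels-below {c} {D} lv lb {e} ce< = go (e ∈? S)
      where
      T = below S c (c e)
      Y = below S′ c (c e)
      T⊆S : T ⊆ S
      T⊆S x∈ = proj₁ (below⁻ x∈)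
      sp : B.Spans Y T
      sp = XB.threshold-spans i₂ T⊆S (tri₂ p)
        (λ {v} {w} j v∈ → let eq = All.lookup lv j ; ≤t = ≤-trans (≤-reflexive (sym eq)) (proj₂ (below⁻ v∈)) in
           B.cl-mono (λ x∈ → let a , b = below⁻ x∈ in below⁺ a (≤-trans b ≤t)) (lb (≤-<-trans ≤t ce<))
           , below⁺ (augment⁺ {qs = qs} (inj₂ (tailPairs-proj₂⁻ u qs (∈-map⁺ proj₂ j)))) ≤t)
        (λ x∈ x∉ → let a , b = below⁻ x∈ in
           below⁺ (augment⁺ {qs = qs} (inj₁ (a , x∉ ∘ subst (_ ∈ₗ_) (sym (tailPairs-proj₁ u qs))))) b)
      go : Dec (e ∈ S) → B.Cl Y e
      go (yes e∈) = sp (below⁺ e∈ ≤-refl)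
      go (no e∉S) = B.cl-trans (downward M₂ (λ x∈ → proj₁ (below⁻ x∈)) ind₂) (downward M₂ T⊆S i₂) sp (lb ce<)

-- Labels as certificates for the distance from a maximum

∣∪∣+∣∩∣ : ∀ {n} (X Y : Subset n) → ∣ X ∣ + ∣ Y ∣ ≤ ∣ X ∪ Y ∣ + ∣ X ∩ Y ∣
∣∪∣+∣∩∣ [] [] = z≤n
∣∪∣+∣∩∣ (outside ∷ X) (outside ∷ Y) = ∣∪∣+∣∩∣ X Y
∣∪∣+∣∩∣ (outside ∷ X) (inside ∷ Y) rewrite +-suc ∣ X ∣ ∣ Y ∣ = s≤s (∣∪∣+∣∩∣ X Y)
∣∪∣+∣∩∣ (inside ∷ X) (outside ∷ Y) = s≤s (∣∪∣+∣∩∣ X Y)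
∣∪∣+∣∩∣ (inside ∷ X) (inside ∷ Y) rewrite +-suc ∣ X ∣ ∣ Y ∣ | +-suc ∣ X ∪ Y ∣ ∣ X ∩ Y ∣ = s≤s (s≤s (∣∪∣+∣∩∣ X Y))

card-+ : ∀ {n} {X Y Z W : Subset n} → X ⊆ Z → Y ⊆ Z → (∀ {x} → x ∈ X → x ∈ Y → x ∈ W) →
         ∣ X ∣ + ∣ Y ∣ ≤ ∣ Z ∣ + ∣ W ∣
card-+ {X = X} {Y} p q r = ≤-trans (∣∪∣+∣∩∣ X Y) (+-mono-≤
  (p⊆q⇒∣p∣≤∣q∣ (λ x∈ → [ p , q ]′ (x∈p∪q⁻ X Y x∈)))
  (p⊆q⇒∣p∣≤∣q∣ (λ x∈ → let a , b = x∈p∩q⁻ X Y x∈ in r a b)))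

card-⊎ : ∀ {n} {X Y Z : Subset n} → (∀ {x} → x ∈ X → x ∈ Y ⊎ x ∈ Z) → ∣ X ∣ ≤ ∣ Y ∣ + ∣ Z ∣
card-⊎ {Y = Y} {Z} f = ≤-trans (p⊆q⇒∣p∣≤∣q∣ (x∈p∪q⁺ ∘ f)) (∣∪∣≤ Y Z)

module LabelBound {n : ℕ} (M₁ M₂ : Matroid n) {S P : Subset n} {c : Fin n → ℕ} {D : ℕ}
  (S⊆P : S ⊆ P) (i₁ : indep M₁ S ≡ true) (i₂ : indep M₂ P ≡ true)
  (la : ∀ {t} → LabelsAbove M₁ S c t) (lb : LabelsBelow M₂ P c D) where

  private
    excess? : ∀ x → Dec (x ∈ P × x ∉ S × c x < D)
    excess? x = x ∈? P ×-dec ¬? (x ∈? S) ×-dec c x <? D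

  excess : Subset n
  excess = ⟦ excess? ⟧

  module _ {T : Subset n} (ci : CommonIndep M₁ M₂ T) where

    level : ℕ → Subset n
    level t = ⟦ (λ x → x ∈? S ×-dec c x ≟ t) ⟧

    -- The cut just above level `t`: `M₁` spans the higher elements by `above S c t`, `M₂` the
    -- others by `below P c t`. Elements of `S` on level `t` are counted on both sides, and `P` adds
    -- its excess.
    level-bound : ∀ {t} → t < D → ∣ T ∣ ≤ (∣ S ∣ + ∣ excess ∣) + ∣ level t ∣
    level-bound {t} t<D = begin
      ∣ T ∣ ≤⟨ cut-bound M₁ M₂ (λ e → suc t ≤? c e) {above S c t} {below P c t} (downward M₁ (λ x∈ → proj₁ (above⁻ x∈)) i₁) (downward M₂ (λ x∈ → proj₁ (below⁻ x∈)) i₂) ci c₁ c₂ ⟩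
      ∣ above S c t ∣ + ∣ below P c t ∣ ≤⟨ +-monoʳ-≤ ∣ above S c t ∣ (card-⊎ split) ⟩
      ∣ above S c t ∣ + (∣ below S c t ∣ + ∣ excess ∣) ≡⟨ +-assoc ∣ above S c t ∣ _ _ ⟨
      ∣ above S c t ∣ + ∣ below S c t ∣ + ∣ excess ∣ ≤⟨ +-monoˡ-≤ ∣ excess ∣ (card-+ {Z = S} {level t} (λ x∈ → proj₁ (above⁻ x∈)) (λ x∈ → proj₁ (below⁻ x∈)) both) ⟩
      (∣ S ∣ + ∣ level t ∣) + ∣ excess ∣ ≡⟨ +-assoc ∣ S ∣ _ _ ⟩
      ∣ S ∣ + (∣ level t ∣ + ∣ excess ∣) ≡⟨ cong (∣ S ∣ +_) (+-comm ∣ level t ∣ _) ⟩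
      ∣ S ∣ + (∣ excess ∣ + ∣ level t ∣) ≡⟨ +-assoc ∣ S ∣ _ _ ⟨
      (∣ S ∣ + ∣ excess ∣) + ∣ level t ∣ ∎
      where
      open ≤-Reasoning
      c₁ : ∀ e → suc t ≤ c e → Closure.Cl M₁ (above S c t) e
      c₁ e t< with e ∈? S
      ... | yes e∈ = inj₁ (above⁺ e∈ (<⇒≤ t<))
      ... | no e∉ with c e in eq
      c₁ e (s≤s t≤) | no e∉ | suc t′ = Closure.cl-mono M₁ (λ x∈ → let a , b = above⁻ x∈ in above⁺ a (≤-trans t≤ b)) (la e∉ eq)
      c₂ : ∀ e → ¬ suc t ≤ c e → Closure.Cl M₂ (below P c t) e
      c₂ e ¬t< = Closure.cl-mono M₂ (λ x∈ → let a , b = below⁻ x∈ in below⁺ a (≤-trans b (≮⇒≥ ¬t<))) (lb (≤-<-trans (≮⇒≥ ¬t<) t<D))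
      split : ∀ {x} → x ∈ below P c t → x ∈ below S c t ⊎ x ∈ excess
      split {x} x∈ with below⁻ x∈ | x ∈? S
      ... | a , b | yes x∈S = inj₁ (below⁺ x∈S b)
      ... | a , b | no x∉S = inj₂ (∈⟦⟧⁺ excess? (a , x∉S , ≤-<-trans b t<D))
      both : ∀ {x} → x ∈ above S c t → x ∈ below S c t → x ∈ level t
      both x∈ y∈ = let a , b = above⁻ x∈ ; _ , d = below⁻ y∈ in ∈⟦⟧⁺ (λ x → x ∈? S ×-dec c x ≟ t) (a , ≤-antisym d b)

    -- Sum the `D` cut bounds. The sets `level t` are disjoint parts of `S`, so all double counting
    -- together costs at most one `∣ S ∣`.
    labels-bound : D * ∣ T ∣ ≤ D * (∣ S ∣ + ∣ excess ∣) + ∣ S ∣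
    labels-bound = ≤-trans (go D ≤-refl) (+-monoʳ-≤ (D * _) (p⊆q⇒∣p∣≤∣q∣ (λ x∈ → proj₁ (∈⟦⟧⁻ (lt? D) x∈))))
      where
      lt? : ∀ d x → Dec (x ∈ S × c x < d)
      lt? d x = x ∈? S ×-dec c x <? d
      go : ∀ d → d ≤ D → d * ∣ T ∣ ≤ d * (∣ S ∣ + ∣ excess ∣) + ∣ ⟦ lt? d ⟧ ∣
      go zero _ = z≤n
      go (suc d) d< = begin
        ∣ T ∣ + d * ∣ T ∣ ≤⟨ +-mono-≤ (level-bound d<) (go d (<⇒≤ d<)) ⟩
        (a + ∣ level d ∣) + (d * a + ∣ ⟦ lt? d ⟧ ∣) ≡⟨ +-assoc a _ _ ⟩
        a + (∣ level d ∣ + (d * a + ∣ ⟦ lt? d ⟧ ∣)) ≡⟨ cong (a +_) (+-comm ∣ level d ∣ _) ⟩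
        a + ((d * a + ∣ ⟦ lt? d ⟧ ∣) + ∣ level d ∣) ≡⟨ cong (a +_) (+-assoc (d * a) _ _) ⟩
        a + (d * a + (∣ ⟦ lt? d ⟧ ∣ + ∣ level d ∣)) ≡⟨ +-assoc a _ _ ⟨
        a + d * a + (∣ ⟦ lt? d ⟧ ∣ + ∣ level d ∣) ≤⟨ +-monoʳ-≤ (a + d * a) (card-+ {Z = ⟦ lt? (suc d) ⟧} {⊥} s₁ s₂ s₃) ⟩
        a + d * a + (∣ ⟦ lt? (suc d) ⟧ ∣ + ∣ ⊥ {n} ∣) ≡⟨ cong (a + d * a +_) (trans (cong (∣ ⟦ lt? (suc d) ⟧ ∣ +_) (∣⊥∣≡0 n)) (+-identityʳ _)) ⟩
        a + d * a + ∣ ⟦ lt? (suc d) ⟧ ∣ ∎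
        where
        open ≤-Reasoning
        a = ∣ S ∣ + ∣ excess ∣
        lv? : ∀ x → Dec (x ∈ S × c x ≡ d)
        lv? x = x ∈? S ×-dec c x ≟ d
        s₁ : ⟦ lt? d ⟧ ⊆ ⟦ lt? (suc d) ⟧
        s₁ x∈ = let p , q = ∈⟦⟧⁻ (lt? d) x∈ in ∈⟦⟧⁺ (lt? (suc d)) (p , m≤n⇒m≤1+n q)
        s₂ : level d ⊆ ⟦ lt? (suc d) ⟧
        s₂ x∈ = let p , q = ∈⟦⟧⁻ lv? x∈ in ∈⟦⟧⁺ (lt? (suc d)) (p , s≤s (≤-reflexive q))
        s₃ : ∀ {x} → x ∈ ⟦ lt? d ⟧ → x ∈ level d → x ∈ ⊥
        s₃ x∈ y∈ = ⊥-elim (<-irrefl (proj₂ (∈⟦⟧⁻ lv? y∈)) (proj₂ (∈⟦⟧⁻ (lt? d) x∈)))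

-- Query programs

Inst : ℕ → Set
Inst n = Matroid n × Matroid n

mat : ∀ {n} → Which → Inst n → Matroid n
mat one = proj₁
mat two = proj₂

Common : ∀ {n} → Subset n → Inst n → Set
Common S M = CommonIndep (proj₁ M) (proj₂ M) S

data Tree (n : ℕ) (A : Set) : Set where
  ret : A → Tree n A
  ask : Subset n → Which → (Bool → Tree n A) → Tree n A

module _ {n : ℕ} where

  result : ∀ {A} → Tree n A → Inst n → A
  result (ret a) M = a
  result (ask X i k) M = result (k (indep (mat i M) X)) M

  queries : ∀ {A} → Tree n A → Inst n → ℕ
  queries (ret a) M = 0
  queries (ask X i k) M = suc (queries (k (indep (mat i M) X)) M)

  _>>=_ : ∀ {A B} → Tree n A → (A → Tree n B) → Tree n B
  ret a >>= f = f a
  ask X i k >>= f = ask X i (λ b → k b >>= f)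

  result->>= : ∀ {A B} (t : Tree n A) (f : A → Tree n B) M → result (t >>= f) M ≡ result (f (result t M)) M
  result->>= (ret a) f M = refl
  result->>= (ask X i k) f M = result->>= (k _) f M

  queries->>= : ∀ {A B} (t : Tree n A) (f : A → Tree n B) M →
                queries (t >>= f) M ≡ queries t M + queries (f (result t M)) M
  queries->>= (ret a) f M = refl
  queries->>= (ask X i k) f M = cong suc (queries->>= (k _) f M)

  -- A program which on every instance satisfying K returns some a with Q a,
  -- such that its number of queries plus the remaining potential pot a is at most b.
  record Spec {A : Set} (K : Inst n → Set) (Q : A → Inst n → Set) (pot : A → ℕ) (b : ℕ) : Set where
    field
      tree : Tree n A
      ok : ∀ M → K M → Q (result tree M) M × queries tree M + pot (result tree M) ≤ b
  open Spec public

  Call : {A : Set} (K : Inst n → Set) (Q : A → Inst n → Set) (b : ℕ) → Set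
  Call K Q b = Spec K Q (λ _ → 0) b

  module _ {A : Set} {K : Inst n → Set} {Q : A → Inst n → Set} {pot : A → ℕ} where

    return : ∀ {b} a → (∀ M → K M → Q a M × pot a ≤ b) → Spec K Q pot b
    return a f = record { tree = ret a ; ok = f }

    -- The comparison of budgets may use the precondition, so bounds that follow only from an
    -- invariant can still pay for a call.
    weaken : ∀ {K′ b b′} → Spec K Q pot b → (∀ M → K′ M → K M × b ≤ b′) → Spec K′ Q pot b′
    weaken s f = record { tree = tree s ; ok = λ M k →
      let k′ , le = f M k ; q , c = ok s M k′ in q , ≤-trans c le }

    strengthen : ∀ {Q′ b} → Spec K Q pot b → (∀ a M → K M → Q a M → Q′ a M) → Spec K Q′ pot b
    strengthen s f = record { tree = tree s ; ok = λ M k → let q , c = ok s M k in f _ M k q , c }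

    -- The potential left by the first program becomes the budget of the second; this is the whole
    -- amortisation scheme.
    bind : ∀ {B : Set} {R : B → Inst n → Set} {pot′ b} → Spec K Q pot b →
           (∀ a → Spec (λ M → K M × Q a M) R pot′ (pot a)) → Spec K R pot′ b
    bind {R = R} {pot′} {b} s f = record { tree = tree s >>= (λ a → tree (f a)) ; ok = λ M k → go M k }
      where
      go : ∀ M → K M → R (result (tree s >>= (λ a → tree (f a))) M) M
             × queries (tree s >>= (λ a → tree (f a))) M + pot′ (result (tree s >>= (λ a → tree (f a))) M) ≤ b
      go M k with ok s M k
      ... | q , c with ok (f (result (tree s) M)) M (k , q)
      ... | r , c′ rewrite result->>= (tree s) (λ a → tree (f a)) M | queries->>= (tree s) (λ a → tree (f a)) M =
        r , ≤-trans (≤-reflexive (+-assoc (queries (tree s) M) _ _)) (≤-trans (+-monoʳ-≤ (queries (tree s) M) c′) c)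

  frame : ∀ {A : Set} {K : Inst n → Set} {Q : A → Inst n → Set} {pot : A → ℕ} {b} r →
          Spec K Q pot b → Spec K Q (λ a → pot a + r) (b + r)
  frame {pot = pot} r s = record { tree = tree s ; ok = λ M k → let q , c = ok s M k in
    q , ≤-trans (≤-reflexive (sym (+-assoc (queries (tree s) M) _ r))) (+-monoˡ-≤ r c) }

  call : ∀ {A B : Set} {K : Inst n → Set} {Q : A → Inst n → Set} {R : B → Inst n → Set} {pot′ c b} →
         Call K Q c → (∀ a → Spec (λ M → K M × Q a M) R pot′ b) → Spec K R pot′ (c + b)
  call {b = b} s f = bind (frame b s) f

  branch : ∀ {A : Set} {K : Inst n → Set} {Q : A → Inst n → Set} {pot : A → ℕ} {b} i X →
           Spec (λ M → K M × indep (mat i M) X ≡ true) Q pot b →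
           Spec (λ M → K M × indep (mat i M) X ≡ false) Q pot b → Spec K Q pot (suc b)
  branch {A} {K} {Q} {pot} {b} i X s₁ s₂ = record { tree = ask X i t ; ok = go }
    where
    t : Bool → Tree n A
    t true = tree s₁
    t false = tree s₂
    go : ∀ M → K M → Q (result (ask X i t) M) M × queries (ask X i t) M + pot (result (ask X i t) M) ≤ suc b
    go M k with indep (mat i M) X in eq
    ... | true = let q , c = ok s₁ M (k , eq) in q , s≤s c
    ... | false = let q , c = ok s₂ M (k , eq) in q , s≤s c

  ⟪_⟫ : Which → Inst n → Subset n → Set
  ⟪ i ⟫ M = Closure.Ind (mat i M)

  Span : Which → Inst n → Subset n → Fin n → Set
  Span i M = Closure.Cl (mat i M)

  branch-span : ∀ {A : Set} {K : Inst n → Set} {Q : A → Inst n → Set} {pot : A → ℕ} {b} i X u → u ∉ X →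
    Spec (λ M → K M × ¬ Span i M X u) Q pot b → Spec (λ M → K M × Span i M X u) Q pot b →
    Spec K Q pot (suc b)
  branch-span i X u u∉ s₁ s₂ = branch i (X ⊕ u)
    (weaken s₁ λ M (k , e) → (k , Closure.Ind⇒¬Cl (mat i M) u∉ e) , ≤-refl)
    (weaken s₂ λ M (k , e) → (k , inj₂ e) , ≤-refl)

  module BinarySearch {A : Set} (key : A → Fin n) (i : Which) (X : Subset n) (u : Fin n) (u∉X : u ∉ X)
    (K : Inst n → Set) (K⇒ : ∀ {M} → K M → ⟪ i ⟫ M X × Span i M X u) where

    -- The answer is the suffix of `fs` headed by its last element on the circuit of `u`. That
    -- nothing after it is on the circuit is what later removes shortcuts from paths.
    Found : List A → List A → Inst n → Set
    Found fs [] M = Absurd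
    Found fs (a ∷ post) M = (∃[ pre ] fs ≡ pre ++ a ∷ post) × ¬ Span i M (del X (key a)) u
                            × All (λ b → Span i M (del X (key b)) u) post

    private
      K₁ : List A → Inst n → Set
      K₁ fs M = K M × ¬ Span i M (X ∖ map key fs) u

    -- Since u is spanned by X, it leaves the span of X ∖ fs iff some single element of fs is in its circuit.
    avoided : ∀ {M} fs → Span i M (X ∖ map key fs) u → All (λ a → Span i M (del X (key a)) u) fs
    avoided {M} fs c = All.tabulate λ a∈ → Closure.cl-mono (mat i M)
      (λ x∈ → let p , q = ∖-∈⁻ (map key fs) x∈ in del⁺ p λ { refl → q (∈-map⁺ key a∈) }) c

    not-avoided : ∀ {M} fs → K M → All (λ a → key a ∈ X) fs → ¬ Span i M (X ∖ map key fs) u →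
                  ¬ All (λ a → Span i M (del X (key a)) u) fs
    not-avoided {M} fs k m ¬c as = ¬c (Closure.cl-∖ (mat i M) (map key fs) (proj₁ (K⇒ k)) (proj₂ (K⇒ k))
      (Allₚ.map⁺ (All.zipWith id (m , as))))

    search : ∀ f fs → length fs ≤ 2 ^ f → All (λ a → key a ∈ X) fs → Call (K₁ fs) (Found fs) f
    search zero [] le m = return [] λ M (k , ¬c) → ⊥-elim (¬c (proj₂ (K⇒ k))) , z≤n
    search zero (a ∷ []) le m = return (a ∷ []) λ M (k , ¬c) → (([] , refl) , ¬c , []) , z≤n
    search zero (a ∷ b ∷ fs) (s≤s ()) m
    search (suc f) fs le m =
      branch-span i (X ∖ map key back) u (u∉X ∘ ∖-⊆ X (map key back))
        (strengthen (weaken (search f back back≤ (Allₚ.drop⁺ (2 ^ f) m)) λ M ((k , _) , ¬c) → (k , ¬c) , ≤-refl)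
          λ s M _ q → inBack s q)
        -- No query is made for the front half: if it avoided the circuit too, all of `fs` would,
        -- against the precondition.
        (bind (weaken (search f front (≤-trans (≤-reflexive (List.length-take (2 ^ f) fs)) (m⊓n≤m _ _)) (Allₚ.take⁺ (2 ^ f) m))
                λ M ((k , ¬c) , c) → (k , λ d → not-avoided fs k m ¬c
                  (subst (All _) split (Allₚ.++⁺ (avoided front d) (avoided back c)))) , ≤-refl)
          λ s → return (s ++ back) λ M (((k , _) , c) , q) → inFront s q (avoided back c) , z≤n)
      where
      front = take (2 ^ f) fs
      back = drop (2 ^ f) fs
      split : front ++ back ≡ fs
      split = List.take++drop≡id (2 ^ f) fs
      back≤ : length back ≤ 2 ^ f
      back≤ = ≤-trans (≤-reflexive (List.length-drop (2 ^ f) fs))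
                (≤-trans (∸-monoˡ-≤ (2 ^ f) le) (≤-reflexive (trans (m+n∸m≡n (2 ^ f) _) (+-identityʳ _))))
      inBack : ∀ s {M} → Found back s M → Found fs s M
      inBack (a ∷ s) ((pre , eq) , q , r) =
        (front ++ pre , trans (sym split) (trans (cong (front ++_) eq) (sym (List.++-assoc front pre _)))) , q , r
      inFront : ∀ s {M} → Found front s M → All (λ b → Span i M (del X (key b)) u) back → Found fs (s ++ back) M
      inFront (a ∷ s) ((pre , eq) , q , r) bs =
        (pre , trans (sym split) (trans (cong (_++ back) eq) (List.++-assoc pre (a ∷ s) back))) , q , Allₚ.++⁺ r bs

  module _ (κ : Fin n → ℕ) where

    Sorted : List (Fin n) → Set
    Sorted = AllPairs (λ x y → κ x ≤ κ y)

    private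
      order = On.decTotalOrder ≤-decTotalOrder κ

    sortBy : List (Fin n) → List (Fin n)
    sortBy = sort order

    sortBy-↭ : ∀ xs → sortBy xs ↭ xs
    sortBy-↭ = sort-↭ order

    sortBy-sorted : ∀ xs → Sorted (sortBy xs)
    sortBy-sorted xs = Linked⇒AllPairs ≤-trans (sort-↗ order xs)

    private
      Passed : List Which → Subset n → Bool → Inst n → Set
      Passed is X true M = All (λ i → ⟪ i ⟫ M X) is
      Passed is X false M = ∃[ i ] i ∈ₗ is × indep (mat i M) X ≡ false

      test : ∀ {K : Inst n → Set} is X → Call K (Passed is X) (length is)
      test [] X = return true λ M k → [] , z≤n
      test (i ∷ is) X = branch i X
        (strengthen (test is X) λ where
          true M (_ , e) q → e ∷ q
          false M _ (j , j∈ , e) → j , there j∈ , e)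
        (return false λ M (_ , e) → (i , here refl , e) , z≤n)

    -- The last clause is greedy optimality in local form: every candidate is spanned by chosen
    -- elements of no larger key, in at least one of the tested matroids.
    GreedyPost : List Which → Subset n → List (Fin n) → Subset n → Inst n → Set
    GreedyPost is acc xs X M = acc ⊆ X × (∀ {x} → x ∈ X → x ∈ acc ⊎ x ∈ₗ xs) × All (λ i → ⟪ i ⟫ M X) is
      × (∀ {x} → x ∈ₗ xs → ∃[ i ] i ∈ₗ is × Span i M (below X κ (κ x)) x)

    greedyFrom : ∀ {K : Inst n → Set} i₀ is′ (let is = i₀ ∷ is′) xs acc → Sorted xs → (∀ {y} → y ∈ acc → All (λ x → κ y ≤ κ x) xs) →
      (∀ {M} → K M → All (λ i → ⟪ i ⟫ M acc) is) → Call K (GreedyPost is acc xs) (length xs * length is)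
    greedyFrom i₀ is′ [] acc srt low k⇒ = return acc λ M k → (id , inj₁ , k⇒ k , λ ()) , z≤n
    greedyFrom {K} i₀ is′ (x ∷ xs) acc (x≤ ∷ srt) low k⇒ = call (test is (acc ⊕ x)) next
      where
      is = i₀ ∷ is′
      next : ∀ b → Call (λ M → K M × Passed is (acc ⊕ x) b M) (GreedyPost is acc (x ∷ xs)) (length xs * length is)
      next true = strengthen (greedyFrom i₀ is′ xs (acc ⊕ x) srt low′ proj₂) post
        where
        low′ : ∀ {y} → y ∈ acc ⊕ x → All (λ z → κ y ≤ κ z) xs
        low′ y∈ with ∪-∈⁻ acc x y∈
        ... | inj₁ p = All.tail (low p)
        ... | inj₂ refl = x≤
        post : ∀ X M → K M × All (λ i → ⟪ i ⟫ M (acc ⊕ x)) is → GreedyPost is (acc ⊕ x) xs X M → GreedyPost is acc (x ∷ xs) X M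
        post X M (k , ps) (sub , sup , ind , sp) = sub ∘ ∪-∈ˡ x , sup′ , ind , sp′
          where
          sup′ : ∀ {y} → y ∈ X → y ∈ acc ⊎ y ∈ₗ (x ∷ xs)
          sup′ y∈ with sup y∈
          ... | inj₂ q = inj₂ (there q)
          ... | inj₁ q with ∪-∈⁻ acc x q
          ... | inj₁ r = inj₁ r
          ... | inj₂ refl = inj₂ (here refl)
          sp′ : ∀ {y} → y ∈ₗ (x ∷ xs) → ∃[ i ] i ∈ₗ is × Span i M (below X κ (κ y)) y
          sp′ (there y∈) = sp y∈
          -- An accepted element spans itself in every matroid; the head of the list is the witness,
          -- hence a nonempty list.
          sp′ (here refl) = i₀ , here refl , inj₁ (below⁺ (sub (∪-∈ʳ acc x)) ≤-refl)
      next false = strengthen (weaken (greedyFrom i₀ is′ xs acc srt (All.tail ∘ low) k⇒) λ M (k , _) → k , ≤-refl) post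
        where
        post : ∀ X M → K M × (∃[ i ] i ∈ₗ is × indep (mat i M) (acc ⊕ x) ≡ false) → GreedyPost is acc xs X M → GreedyPost is acc (x ∷ xs) X M
        post X M (k , i , i∈ , e) (sub , sup , ind , sp) = sub , (λ y∈ → [ inj₁ , inj₂ ∘ there ]′ (sup y∈)) , ind , sp′
          where
          sp′ : ∀ {y} → y ∈ₗ (x ∷ xs) → ∃[ j ] j ∈ₗ is × Span j M (below X κ (κ y)) y
          sp′ (there y∈) = sp y∈
          sp′ (here refl) = i , i∈ , Closure.cl-mono (mat i M) (λ y∈ → below⁺ (sub y∈) (All.head (low y∈))) (inj₂ e)

    greedy : ∀ {K : Inst n → Set} i is xs →
      Call K (GreedyPost (i ∷ is) ⊥ (sortBy xs)) (length xs * suc (length is))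
    greedy i is xs = weaken (greedyFrom i is (sortBy xs) ⊥ (sortBy-sorted xs) (λ y∈ → ⊥-elim (∉⊥ y∈))
                              (λ {M} _ → All.universal (λ j → indep-∅ (mat j M)) _))
      λ M k → k , ≤-reflexive (cong (_* suc (length is)) (↭-length (sortBy-↭ xs)))

-- The auction

∑ : ∀ {n} → (Fin n → ℕ) → ℕ
∑ {zero} f = 0
∑ {suc n} f = f zero + ∑ (f ∘ suc)

∑-mono : ∀ {n} {f g : Fin n → ℕ} → (∀ i → f i ≤ g i) → ∑ f ≤ ∑ g
∑-mono {zero} h = z≤n
∑-mono {suc n} h = +-mono-≤ (h zero) (∑-mono (h ∘ suc))

∑-+ : ∀ {n} (f g : Fin n → ℕ) → ∑ (λ i → f i + g i) ≡ ∑ f + ∑ g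
∑-+ {zero} f g = refl
∑-+ {suc n} f g rewrite ∑-+ (f ∘ suc) (g ∘ suc) = lem (f zero) (g zero) (∑ (f ∘ suc)) (∑ (g ∘ suc))
  where
  lem : ∀ a b c d → a + b + (c + d) ≡ a + c + (b + d)
  lem = solve-∀

∑-const : ∀ n k → ∑ {n} (λ _ → k) ≡ n * k
∑-const zero k = refl
∑-const (suc n) k = cong (k +_) (∑-const n k)

∑-*ˡ : ∀ {n} k (f : Fin n → ℕ) → ∑ (λ i → k * f i) ≡ k * ∑ f
∑-*ˡ {zero} k f = sym (*-zeroʳ k)
∑-*ˡ {suc n} k f rewrite ∑-*ˡ k (f ∘ suc) = sym (*-distribˡ-+ k (f zero) _)

𝟙 : ∀ {n} → Subset n → Fin n → ℕ
𝟙 X e = if does (e ∈? X) then 1 else 0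

𝟙-∈ : ∀ {n} {X : Subset n} {e} → e ∈ X → 𝟙 X e ≡ 1
𝟙-∈ {X = X} {e} e∈ with e ∈? X
... | yes _ = refl
... | no e∉ = ⊥-elim (e∉ e∈)

𝟙-∉ : ∀ {n} {X : Subset n} {e} → e ∉ X → 𝟙 X e ≡ 0
𝟙-∉ {X = X} {e} e∉ with e ∈? X
... | yes e∈ = ⊥-elim (e∉ e∈)
... | no _ = refl

𝟙≤1 : ∀ {n} (X : Subset n) e → 𝟙 X e ≤ 1
𝟙≤1 X e with e ∈? X
... | yes _ = s≤s z≤n
... | no _ = z≤n

∑𝟙 : ∀ {n} (X : Subset n) → ∑ (𝟙 X) ≡ ∣ X ∣
∑𝟙 [] = refl
∑𝟙 (inside ∷ X) = cong suc (∑𝟙 X)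
∑𝟙 (outside ∷ X) = ∑𝟙 X

module _ {n : ℕ} where

  elems : Subset n → List (Fin n)
  elems X = filter (_∈? X) (allFin n)

  elems⁺ : ∀ {X e} → e ∈ X → e ∈ₗ elems X
  elems⁺ {X} e∈ = ∈-filter⁺ (_∈? X) (∈-allFin _) e∈

  elems⁻ : ∀ {X e} → e ∈ₗ elems X → e ∈ X
  elems⁻ {X} i = proj₂ (∈-filter⁻ (_∈? X) {xs = allFin n} i)

  length-elems≤n : ∀ X → length (elems X) ≤ n
  length-elems≤n X = ≤-trans (List.length-filter (_∈? X) (allFin n)) (≤-reflexive (List.length-tabulate id))

2*≤⇒≤ : ∀ {a b i j} → 2 * a + i ≤ 2 * b + j → j ≤ 1 → a ≤ b
2*≤⇒≤ {a} {b} {i} {j} le j≤ = ≮⇒≥ λ b<a → <⇒≱ (begin-strict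
  2 * b + j ≤⟨ +-monoʳ-≤ (2 * b) j≤ ⟩
  2 * b + 1 <⟨ +-monoʳ-< (2 * b) (s≤s (s≤s z≤n)) ⟩
  2 * b + 2 ≡⟨ trans (+-comm (2 * b) 2) (sym (*-suc 2 b)) ⟩
  2 * suc b ≤⟨ *-monoʳ-≤ 2 b<a ⟩
  2 * a ≤⟨ m≤m+n (2 * a) i ⟩
  2 * a + i ∎) le
  where open ≤-Reasoning

2*<⇒< : ∀ {a b} → 2 * a + 1 ≤ 2 * b + 0 → a < b
2*<⇒< {a} {b} le = *-cancelˡ-< 2 a b (subst₂ _≤_ (+-comm (2 * a) 1) (+-identityʳ (2 * b)) le)

-- Deferred acceptance: the elements of the M₂-basis P at a level below D propose to M₁, which keeps
-- the highest levels; a rejected element moves up one level, and P is recomputed preferring low levels.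
module Auction {n : ℕ} (D y : ℕ) where

  record State : Set where
    constructor state
    field
      c : Fin n → ℕ
      S P : Subset n
  open State

  proposing? : ∀ st x → Dec (x ∈ P st × x ∉ S st × c st x < D)
  proposing? st x = x ∈? P st ×-dec ¬? (x ∈? S st) ×-dec c st x <? D

  proposing : State → Subset n
  proposing st = ⟦ proposing? st ⟧

  -- The potential of the auction. A proposal gains one whether it is accepted or moved up, and an
  -- element thrown out of `S` trades its membership for a level, losing nothing.
  weight : State → Fin n → ℕ
  weight st e = c st e + 𝟙 (S st) e

  record Inv (m : ℕ) (st : State) (M : Inst n) : Set where
    field
      c≤D : ∀ e → c st e ≤ D
      S<D : ∀ {e} → e ∈ S st → c st e < D
      S⊆P : S st ⊆ P st
      ind₁ : ⟪ one ⟫ M (S st)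
      ind₂ : ⟪ two ⟫ M (P st)
      la : ∀ {t} → LabelsAbove (proj₁ M) (S st) (c st) t
      lb : LabelsBelow (proj₂ M) (P st) (c st) D
      -- `m` is the number of rounds left: a round with at least `y` proposals adds `y` to the total
      -- weight, which cannot pass `n * D`.
      bound : n * D ≤ ∑ (weight st) + m * y

  weight≤ : ∀ {m st M} → Inv m st M → ∑ (weight st) + ∣ proposing st ∣ ≤ n * D
  weight≤ {st = st} I = begin
    ∑ (weight st) + ∣ proposing st ∣ ≡⟨ cong (∑ (weight st) +_) (∑𝟙 (proposing st)) ⟨
    ∑ (weight st) + ∑ (𝟙 (proposing st)) ≡⟨ ∑-+ (weight st) (𝟙 (proposing st)) ⟨
    ∑ (λ e → weight st e + 𝟙 (proposing st) e) ≤⟨ ∑-mono le ⟩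
    ∑ {n} (λ _ → D) ≡⟨ ∑-const n D ⟩
    n * D ∎
    where
    open ≤-Reasoning
    open Inv I
    le : ∀ e → weight st e + 𝟙 (proposing st) e ≤ D
    le e with e ∈? S st | e ∈? proposing st
    ... | yes p | yes q = ⊥-elim (proj₁ (proj₂ (∈⟦⟧⁻ (proposing? st) q)) p)
    ... | yes p | no _ = ≤-trans (≤-reflexive (trans (+-identityʳ _) (+-comm _ 1))) (S<D p)
    ... | no _ | yes q = ≤-trans (≤-reflexive (trans (cong (_+ 1) (+-identityʳ _)) (+-comm _ 1))) (proj₂ (proj₂ (∈⟦⟧⁻ (proposing? st) q)))
    ... | no _ | no _ = ≤-trans (≤-reflexive (trans (+-identityʳ _) (+-identityʳ _))) (c≤D e)

  module Round (st : State) where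

    U? : ∀ x → Dec (x ∈ S st ⊎ x ∈ proposing st)
    U? x = x ∈? S st ⊎-dec x ∈? proposing st

    U : Subset n
    U = ⟦ U? ⟧

    κ₁ : Fin n → ℕ
    κ₁ e = D ∸ c st e

    module Next (S′ : Subset n) where

      c′ : Fin n → ℕ
      c′ e = if does (e ∈? U ×-dec ¬? (e ∈? S′)) then suc (c st e) else c st e

      c′-rejected : ∀ {e} → e ∈ U → e ∉ S′ → c′ e ≡ suc (c st e)
      c′-rejected {e} p q with e ∈? U | e ∈? S′
      ... | yes _ | no _ = refl
      ... | no r | _ = ⊥-elim (r p)
      ... | yes _ | yes r = ⊥-elim (q r)

      c′-S : ∀ {e} → e ∈ S′ → c′ e ≡ c st e
      c′-S {e} q with e ∈? U | e ∈? S′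
      ... | yes _ | no r = ⊥-elim (r q)
      ... | no _ | _ = refl
      ... | yes _ | yes _ = refl

      c′-out : ∀ {e} → e ∉ U → c′ e ≡ c st e
      c′-out {e} p with e ∈? U | e ∈? S′
      ... | yes r | _ = ⊥-elim (p r)
      ... | no _ | _ = refl

      c≤c′ : ∀ e → c st e ≤ c′ e
      c≤c′ e with e ∈? U | e ∈? S′
      ... | yes _ | no _ = n≤1+n _
      ... | no _ | _ = ≤-refl
      ... | yes _ | yes _ = ≤-refl

      -- Levels are doubled so that the added bit only breaks ties, in favour of `S′`; this keeps
      -- `S′` inside the new `M₂` basis.
      κ₂ : Fin n → ℕ
      κ₂ e = 2 * c′ e + (if does (e ∈? S′) then 0 else 1)

      κ₂-S : ∀ {e} → e ∈ S′ → κ₂ e ≡ 2 * c′ e + 0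
      κ₂-S {e} e∈ with e ∈? S′
      ... | yes _ = refl
      ... | no e∉ = ⊥-elim (e∉ e∈)

      κ₂-out : ∀ {e} → e ∉ S′ → κ₂ e ≡ 2 * c′ e + 1
      κ₂-out {e} e∉ with e ∈? S′
      ... | no _ = refl
      ... | yes e∈ = ⊥-elim (e∉ e∈)

      flag≤1 : ∀ e → (if does (e ∈? S′) then 0 else 1) ≤ 1
      flag≤1 e with e ∈? S′
      ... | yes _ = z≤n
      ... | no _ = ≤-refl

      module Correct {m P′ M} (I : Inv (suc m) st M) (many : y ≤ ∣ proposing st ∣)
        (g₁ : GreedyPost κ₁ (one ∷ []) ⊥ (sortBy κ₁ (elems U)) S′ M)
        (g₂ : GreedyPost κ₂ (two ∷ []) ⊥ (sortBy κ₂ (allFin n)) P′ M) where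
        open Inv I
        private
          module A = Closure (proj₁ M)
          module B = Closure (proj₂ M)

        S′⊆U : S′ ⊆ U
        S′⊆U x∈ with proj₁ (proj₂ g₁) x∈
        ... | inj₁ p = ⊥-elim (∉⊥ p)
        ... | inj₂ p = elems⁻ (∈-resp-↭ (sortBy-↭ κ₁ _) p)

        U⊆P : U ⊆ P st
        U⊆P x∈ with ∈⟦⟧⁻ U? x∈
        ... | inj₁ p = S⊆P p
        ... | inj₂ p = proj₁ (∈⟦⟧⁻ (proposing? st) p)

        U<D : ∀ {e} → e ∈ U → c st e < D
        U<D e∈ with ∈⟦⟧⁻ U? e∈
        ... | inj₁ p = S<D p
        ... | inj₂ p = proj₂ (proj₂ (∈⟦⟧⁻ (proposing? st) p))

        ind₁′ : A.Ind S′
        ind₁′ = All.head (proj₁ (proj₂ (proj₂ g₁)))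

        ind₂′ : B.Ind P′
        ind₂′ = All.head (proj₁ (proj₂ (proj₂ g₂)))

        spanU : ∀ {e} → e ∈ U → A.Cl (above S′ c′ (c st e)) e
        spanU {e} e∈ with proj₂ (proj₂ (proj₂ g₁)) (∈-resp-↭ (↭-sym (sortBy-↭ κ₁ _)) (elems⁺ e∈))
        ... | .one , here refl , s = A.cl-mono sub s
          where
          sub : below S′ κ₁ (κ₁ e) ⊆ above S′ c′ (c st e)
          sub {x} x∈ = let a , b = below⁻ x∈ in above⁺ a (≤-trans (≮⇒≥ λ lt → <⇒≱ (∸-monoʳ-< lt (c≤D e)) b) (c≤c′ x))

        -- A rejected element of `U` was refused by elements of at least its old level `t`. For the
        -- others the old certificate is transported, as each element of the old `S` is spanned by
        -- elements of `S′` no lower than itself.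
        la′ : ∀ {t} → LabelsAbove (proj₁ M) S′ c′ t
        la′ {t} {e} e∉ eq = go (e ∈? U)
          where
          go : Dec (e ∈ U) → A.Cl (above S′ c′ t) e
          go (yes e∈) = subst (λ k → A.Cl (above S′ c′ k) e) (suc-injective (trans (sym (c′-rejected e∈ e∉)) eq)) (spanU e∈)
          go (no e∉U) = A.cl-trans (downward (proj₁ M) (λ x∈ → proj₁ (above⁻ x∈)) ind₁′) (downward (proj₁ M) (λ x∈ → proj₁ (above⁻ x∈)) ind₁)
            (λ x∈ → let a , b = above⁻ x∈ in A.cl-mono (λ z∈ → let p , q = above⁻ z∈ in above⁺ p (≤-trans b q)) (spanU (∈⟦⟧⁺ U? (inj₁ a))))
            (la (λ e∈ → e∉U (∈⟦⟧⁺ U? (inj₁ e∈))) (trans (sym (c′-out e∉U)) eq))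

        spanP : ∀ e → B.Cl (below P′ κ₂ (κ₂ e)) e
        spanP e with proj₂ (proj₂ (proj₂ g₂)) (∈-resp-↭ (↭-sym (sortBy-↭ κ₂ _)) (∈-allFin e))
        ... | .two , here refl , s = s

        lb′ : LabelsBelow (proj₂ M) P′ c′ D
        lb′ {e} _ = B.cl-mono (λ x∈ → let a , b = below⁻ x∈ in below⁺ a (2*≤⇒≤ b (flag≤1 e))) (spanP e)

        -- If `P′` missed `s`, elements preceding `s` would span it. Those in `S′` lie in the old
        -- `P`; the others had a strictly smaller old level, so the old labels span them by elements
        -- of `P` below `s`. Then `P − s` would span `s`.
        S′⊆P′ : S′ ⊆ P′
        S′⊆P′ {s} s∈ with s ∈? P′
        ... | yes p = p
        ... | no s∉ = ⊥-elim (B.ind⇒¬cl-del ind₂ s∈P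
            (B.cl-trans (downward (proj₂ M) del-⊆ ind₂) (downward (proj₂ M) (λ x∈ → proj₁ (below⁻ x∈)) ind₂′) sp (spanP s)))
          where
          s∈P : s ∈ P st
          s∈P = U⊆P (S′⊆U s∈)
          sp : B.Spans (del (P st) s) (below P′ κ₂ (κ₂ s))
          sp {x} x∈ with below⁻ x∈ | x ∈? S′
          ... | x∈P′ , κ≤ | yes x∈S′ = inj₁ (del⁺ (U⊆P (S′⊆U x∈S′)) λ { refl → s∉ x∈P′ })
          ... | x∈P′ , κ≤ | no x∉S′ = B.cl-mono (λ z∈ → let a , b = below⁻ z∈ in del⁺ a λ { refl → <⇒≱ lt b }) (lb (<-trans lt (U<D (S′⊆U s∈))))
            where
            lt : c st x < c st s
            lt = ≤-<-trans (c≤c′ x) (<-≤-trans (2*<⇒< (subst₂ _≤_ (κ₂-out x∉S′) (κ₂-S s∈) κ≤)) (≤-reflexive (c′-S s∈)))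

        next : State
        next = state c′ S′ P′

        grows : ∀ e → weight st e + 𝟙 (proposing st) e ≤ weight next e
        grows e with e ∈? proposing st | e ∈? S st
        ... | yes p | yes q = ⊥-elim (proj₁ (proj₂ (∈⟦⟧⁻ (proposing? st) p)) q)
        ... | yes p | no _ = ≤-trans (≤-reflexive (trans (cong (_+ 1) (+-identityʳ _)) (+-comm _ 1))) (go (e ∈? S′))
          where
          go : Dec (e ∈ S′) → suc (c st e) ≤ c′ e + 𝟙 S′ e
          go (yes r) = ≤-reflexive (trans (+-comm 1 _) (sym (cong₂ _+_ (c′-S r) (𝟙-∈ r))))
          go (no r) = ≤-trans (≤-reflexive (sym (c′-rejected (∈⟦⟧⁺ U? (inj₂ p)) r))) (m≤m+n _ _)
        ... | no _ | no _ = ≤-trans (≤-reflexive (trans (+-identityʳ _) (+-identityʳ _))) (≤-trans (c≤c′ e) (m≤m+n _ _))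
        ... | no _ | yes q = ≤-trans (≤-reflexive (+-identityʳ _)) (go (e ∈? S′))
          where
          go : Dec (e ∈ S′) → c st e + 1 ≤ c′ e + 𝟙 S′ e
          go (yes r) = ≤-reflexive (sym (cong₂ _+_ (c′-S r) (𝟙-∈ r)))
          go (no r) = ≤-trans (≤-reflexive (trans (+-comm _ 1) (sym (c′-rejected (∈⟦⟧⁺ U? (inj₁ q)) r)))) (m≤m+n _ _)

        inv : Inv m next M
        inv = record
          { c≤D = c′≤D ; S<D = λ e∈ → subst (_< D) (sym (c′-S e∈)) (U<D (S′⊆U e∈)) ; S⊆P = S′⊆P′
          ; ind₁ = ind₁′ ; ind₂ = ind₂′ ; la = la′ ; lb = lb′ ; bound = bnd }
          where
          c′≤D : ∀ e → c′ e ≤ D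
          c′≤D e with e ∈? U | e ∈? S′
          ... | yes p | no _ = U<D p
          ... | no _ | _ = c≤D e
          ... | yes _ | yes _ = c≤D e
          bnd : n * D ≤ ∑ (weight next) + m * y
          bnd = begin
            n * D ≤⟨ bound ⟩
            ∑ (weight st) + (y + m * y) ≡⟨ +-assoc (∑ (weight st)) y _ ⟨
            ∑ (weight st) + y + m * y ≤⟨ +-monoˡ-≤ (m * y) (+-monoʳ-≤ (∑ (weight st)) many) ⟩
            ∑ (weight st) + ∣ proposing st ∣ + m * y ≡⟨ cong (λ k → ∑ (weight st) + k + m * y) (∑𝟙 (proposing st)) ⟨
            ∑ (weight st) + ∑ (𝟙 (proposing st)) + m * y ≡⟨ cong (_+ m * y) (∑-+ (weight st) (𝟙 (proposing st))) ⟨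
            ∑ (λ e → weight st e + 𝟙 (proposing st) e) + m * y ≤⟨ +-monoˡ-≤ (m * y) (∑-mono grows) ⟩
            ∑ (weight next) + m * y ∎
            where open ≤-Reasoning

  Post : State → Inst n → Set
  Post st M = (∃[ m ] Inv m st M) × ∣ proposing st ∣ < y

  loop : 1 ≤ y → ∀ m st → Call (Inv m st) Post (m * (n + n))
  loop 1≤y m st with ∣ proposing st ∣ <? y
  loop 1≤y m st | yes few = return st λ M I → ((m , I) , few) , z≤n
  loop 1≤y zero st | no many = return st λ M I → ⊥-elim (<-irrefl refl (begin-strict
      n * D ≤⟨ Inv.bound I ⟩
      ∑ (weight st) + 0 <⟨ +-monoʳ-< (∑ (weight st)) (≤-trans 1≤y (≮⇒≥ many)) ⟩
      ∑ (weight st) + ∣ proposing st ∣ ≤⟨ weight≤ I ⟩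
      n * D ∎)) , z≤n
    where open ≤-Reasoning
  loop 1≤y (suc m) st | no many =
    weaken (call (greedy κ₁ one [] (elems U)) λ S′ → let open Next S′ in
      call (greedy κ₂ two [] (allFin n)) λ P′ →
        weaken (loop 1≤y m (state c′ S′ P′)) λ M ((I , g₁) , g₂) → Correct.inv I (≮⇒≥ many) g₁ g₂ , ≤-refl)
    λ M I → I , ≤-trans (≤-reflexive (sym (+-assoc (length (elems U) * 1) _ _))) (+-monoˡ-≤ (m * (n + n))
      (+-mono-≤ (≤-trans (≤-reflexive (*-identityʳ _)) (length-elems≤n U))
        (≤-reflexive (trans (*-identityʳ _) (List.length-tabulate id)))))
    where open Round st

  Result : Subset n → Inst n → Set
  Result S M = Common S M
    × (∀ T → Common T M → D * ∣ T ∣ ≤ D * (∣ S ∣ + y) + ∣ S ∣)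

  auction : ∀ {K : Inst n → Set} → 1 ≤ y → ∀ m → n * D ≤ m * y → Call K Result (n + m * (n + n))
  auction 1≤y m le =
    weaken (call (greedy (λ _ → 0) two [] (allFin n)) λ P →
      bind (weaken (loop 1≤y m (state (λ _ → 0) ⊥ P)) λ M (k , g) → start g , ≤-refl) λ st →
        return (S st) λ M (_ , (m′ , I) , few) → finish I few , z≤n)
    λ M k → k , +-monoˡ-≤ (m * (n + n)) (≤-reflexive (trans (*-identityʳ _) (List.length-tabulate id)))
    where
    start : ∀ {M P} → GreedyPost (λ _ → 0) (two ∷ []) ⊥ (sortBy (λ _ → 0) (allFin n)) P M →
            Inv m (state (λ _ → 0) ⊥ P) M
    start {M} {P} (_ , _ , ind , sp) = record
      { c≤D = λ _ → z≤n ; S<D = λ e∈ → ⊥-elim (∉⊥ e∈) ; S⊆P = λ e∈ → ⊥-elim (∉⊥ e∈)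
      ; ind₁ = indep-∅ (proj₁ M) ; ind₂ = All.head ind ; la = λ _ () ; lb = λ {e} _ → below-ok e
      ; bound = ≤-trans le (m≤n+m _ _) }
      where
      below-ok : ∀ e → Span two M (below P (λ _ → 0) 0) e
      below-ok e with sp (∈-resp-↭ (↭-sym (sortBy-↭ (λ _ → 0) _)) (∈-allFin e))
      ... | .two , here refl , s = s
    finish : ∀ {M m′ st} → Inv m′ st M → ∣ proposing st ∣ < y → Result (S st) M
    finish {M} {m′} {st} I few = (ind₁ , downward (proj₂ M) S⊆P ind₂) , λ T ci →
      ≤-trans (LabelBound.labels-bound (proj₁ M) (proj₂ M) S⊆P ind₁ ind₂ la lb ci)
        (+-monoˡ-≤ ∣ S st ∣ (*-monoʳ-≤ D (+-monoʳ-≤ ∣ S st ∣ (<⇒≤ (≤-<-trans (p⊆q⇒∣p∣≤∣q∣ same) few)))))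
      where
      open Inv I
      same : LabelBound.excess (proj₁ M) (proj₂ M) S⊆P ind₁ ind₂ la lb ⊆ proposing st
      same x∈ = ∈⟦⟧⁺ (proposing? st) (∈⟦⟧⁻ (λ x → x ∈? P st ×-dec ¬? (x ∈? S st) ×-dec c st x <? D) x∈)

-- Shortest augmenting paths

module _ {n : ℕ} where

  length-elems : ∀ (X : Subset n) → length (elems X) ≡ ∣ X ∣
  length-elems X = trans (go id) (∑𝟙 X)
    where
    go : ∀ {k} (f : Fin k → Fin n) → length (filter (_∈? X) (Data.List.tabulate f)) ≡ ∑ (𝟙 X ∘ f)
    go {zero} f = refl
    go {suc k} f with f zero ∈? X
    ... | yes _ = cong suc (go (f ∘ suc))
    ... | no _ = go (f ∘ suc)

  update : ∀ {A : Set} → (Fin n → A) → Fin n → A → Fin n → A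
  update f u x e = if does (e Fin.≟ u) then x else f e

  update-≡ : ∀ {A : Set} (f : Fin n → A) u x → update f u x u ≡ x
  update-≡ f u x with u Fin.≟ u
  ... | yes _ = refl
  ... | no ne = ⊥-elim (ne refl)

  update-≢ : ∀ {A : Set} (f : Fin n → A) {u x e} → e ≢ u → update f u x e ≡ f e
  update-≢ f {u} {x} {e} ne with e Fin.≟ u
  ... | yes r = ⊥-elim (ne r)
  ... | no _ = refl

  -- The side conditions of a search may depend on the instance; when the data contradicts them,
  -- no instance is left and any answer will do.
  find : ∀ {A : Set} (key : A → Fin n) i X u (u∉X : u ∉ X) f fs (K : Inst n → Set) (K⇒ : ∀ {M} → K M → ⟪ i ⟫ M X × Span i M X u) →
    (∀ {M} → K M → length fs ≤ 2 ^ f × All (λ a → key a ∈ X) fs × ¬ Span i M (X ∖ map key fs) u) →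
    Call K (BinarySearch.Found key i X u u∉X K K⇒ fs) f
  find key i X u u∉X f fs K K⇒ side with length fs ≤? 2 ^ f | All.all? (λ a → key a ∈? X) fs
  ... | yes p | yes q = weaken (BinarySearch.search key i X u u∉X K K⇒ f fs p q) λ M k → (k , proj₂ (proj₂ (side k))) , ≤-refl
  ... | no p | _ = return [] λ M k → ⊥-elim (p (proj₁ (side k))) , z≤n
  ... | yes _ | no q = return [] λ M k → ⊥-elim (q (proj₁ (proj₂ (side k)))) , z≤n

-- One search for a shortest augmenting path.  The levels a are lower bounds for distances from the
-- sources; elements of level below k and the elements of done are known to have a tight predecessor.
module Sweep {n : ℕ} (dmax ℓ m : ℕ) (m≤ : m ≤ 2 ^ ℓ) where

  record State : Set where
    constructor state
    field
      a : Fin n → ℕ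
      S : Subset n
      D k : ℕ
      done : Subset n
      par : Fin n → Fin n
  open State

  raises : (Fin n → ℕ) → ℕ
  raises a = ∑ (λ e → dmax ∸ a e)

  found? : ∀ st x → Dec (x ∈ S st × x ∈ done st)
  found? st x = x ∈? S st ×-dec x ∈? done st

  found missing : State → Subset n
  found st = ⟦ found? st ⟧
  missing st = ⟦ (λ x → x ∈? S st ×-dec ¬? (x ∈? done st)) ⟧

  missing⁺ : ∀ {st x} → x ∈ S st → x ∉ done st → x ∈ missing st
  missing⁺ {st} p q = ∈⟦⟧⁺ (λ x → x ∈? S st ×-dec ¬? (x ∈? done st)) (p , q)

  missing⁻ : ∀ {st x} → x ∈ missing st → x ∈ S st × x ∉ done st
  missing⁻ {st} = ∈⟦⟧⁻ (λ x → x ∈? S st ×-dec ¬? (x ∈? done st))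

  -- What passes from one search to the next; `D` bounds the distance from sources to sinks from
  -- below.
  record Valid (a : Fin n → ℕ) (S : Subset n) (D : ℕ) (M : Inst n) : Set where
    field
      ind₁ : ⟪ one ⟫ M S
      ind₂ : ⟪ two ⟫ M S
      la : ∀ {t} → LabelsAbove (proj₁ M) S a t
      lb : LabelsBelow (proj₂ M) S a D
      -- At `k = D`, where `lb` says nothing, this cap pins the level of a newly found element.
      aS≤D : ∀ {v} → v ∈ S → a v ≤ D
      D< : D < dmax
      S≤m : ∣ S ∣ ≤ m

  -- Together with `LabelsAbove` this gives an `M₁` edge into `u` from the level just below its own.
  -- At level 0 the set is all of `S`, so `u` is a source.
  Tight : State → Fin n → Inst n → Set
  Tight st u M = u ∉ S st × ¬ Span one M (above (S st) (a st) (a st u)) u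

  record Parent (st : State) (v : Fin n) (M : Inst n) : Set where
    field
      level : a st (par st v) ≡ a st v
      tight : Tight st (par st v) M
      edge : Closure.Edge (proj₂ M) (S st) (par st v) v

  record Inv (st : State) (M : Inst n) : Set where
    field
      ub : ∀ T → Common T M → ∣ T ∣ ≤ m
      valid : Valid (a st) (S st) (D st) M
      k≤D : k st ≤ D st
      parent : ∀ {v} → v ∈ S st → v ∈ done st → Parent st v M
      done≤k : ∀ {e} → e ∈ done st → a st e ≤ k st
      missing≥ : ∀ {v} → v ∈ S st → v ∉ done st → k st ≤ a st v
      -- A finished outside element has its whole `M₂` circuit among the elements already found.
      doneU : ∀ {u} → u ∉ S st → u ∈ done st → Span two M (found st) u
    open Valid valid public

  module Extract (st : State) where

    Leveled : Fin n → List (Fin n × Fin n) → Set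
    Leveled u qs = All (λ q → a st (proj₂ q) ≡ suc (a st (proj₁ q))) qs
                 × All (λ q → a st (proj₁ q) ≡ a st (proj₂ q)) (tailPairs u qs)

    later≥ : ∀ u qs → Leveled u qs → All (λ q → a st u ≤ a st (proj₁ q)) qs
    later≥ u [] _ = []
    later≥ u ((v , w) ∷ qs) (e ∷ es , f ∷ fs) = ≤-reflexive (sym f) ∷
      All.map (≤-trans (≤-trans (≤-trans (≤-reflexive (sym f)) (n≤1+n _)) (≤-reflexive (sym e)))) (later≥ w qs (es , fs))

    Good : Fin n → List (Fin n × Fin n) → Inst n → Set
    Good u qs M = Path.Path (proj₁ M) (proj₂ M) (S st) u qs × Leveled u qs × Tight st u M
                × All (λ w → a st w ≤ D st) (u ∷ map proj₂ qs)

    Extracted : Fin n × List (Fin n × Fin n) → Inst n → Set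
    Extracted (u , qs) M = Good u qs M × ¬ Span one M (S st) u

    -- Backwards from the sink, one level per step: tightness and a binary search give the `M₁`
    -- edge, `par` the `M₂` edge. The label conditions rule out every shortcut, since edges cannot
    -- climb faster than the path does.
    extract : ∀ j u qs → u ∉ S st → Call (λ M → Inv st M × Good u qs M × a st u ≡ j × j ≤ k st) Extracted (j * ℓ)
    extract zero u qs u∉ = return (u , qs) λ M (I , g@(_ , _ , (_ , t) , _) , e , _) →
      (g , λ c → t (Closure.cl-mono (proj₁ M) (λ x∈ → above⁺ x∈ (≤-trans (≤-reflexive e) z≤n)) c)) , z≤n
    extract (suc j) u qs u∉ = bind (frame (j * ℓ) (find id one X u u∉X ℓ fs K K⇒ side)) next
      where
      X = above (S st) (a st) j
      fs? : ∀ x → Dec (x ∈ S st × a st x ≡ j)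
      fs? x = x ∈? S st ×-dec a st x ≟ j
      fs = elems ⟦ fs? ⟧
      K : Inst n → Set
      K M = Inv st M × Good u qs M × a st u ≡ suc j × suc j ≤ k st
      u∉X : u ∉ X
      u∉X = u∉ ∘ proj₁ ∘ above⁻
      X⊆S : X ⊆ S st
      X⊆S x∈ = proj₁ (above⁻ x∈)
      K⇒ : ∀ {M} → K M → ⟪ one ⟫ M X × Span one M X u
      K⇒ {M} (I , _ , e , _) = downward (proj₁ M) X⊆S (Inv.ind₁ I) , Inv.la I u∉ e
      side : ∀ {M} → K M → length fs ≤ 2 ^ ℓ × All (λ v → v ∈ X) fs × ¬ Span one M (X ∖ map id fs) u
      side {M} (I , (_ , _ , (_ , t) , _) , e , _) =
        ≤-trans (≤-reflexive (length-elems ⟦ fs? ⟧)) (≤-trans (p⊆q⇒∣p∣≤∣q∣ (λ x∈ → proj₁ (∈⟦⟧⁻ fs? x∈))) (≤-trans (Inv.S≤m I) m≤))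
        , All.tabulate (λ i → let p , q = ∈⟦⟧⁻ fs? (elems⁻ i) in above⁺ p (≤-reflexive (sym q)))
        , λ c → t (Closure.cl-mono (proj₁ M) sub c)
        where
        sub : X ∖ map id fs ⊆ above (S st) (a st) (a st u)
        sub x∈ with ∖-∈⁻ (map id fs) x∈
        ... | x∈X , x∉ = let p , q = above⁻ x∈X in above⁺ p (≤-trans (≤-reflexive e)
          (≤∧≢⇒< q λ eq → x∉ (subst (_ ∈ₗ_) (sym (List.map-id fs)) (elems⁺ (∈⟦⟧⁺ fs? (p , sym eq))))))
      facts : ∀ {M v post} → K M → BinarySearch.Found id one X u u∉X K K⇒ fs (v ∷ post) M →
              Good (par st v) ((v , u) ∷ qs) M × a st (par st v) ≡ j × j ≤ k st
      facts {M} {v} {post} κ@(I , (path , L@(es , fs′) , (u∉S , _) , low) , e , j<) ((pre , eq) , ¬c , _) =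
        (Path.step edge later₂ edge₁ later₁ path
        , (trans e (cong suc (sym av)) ∷ es , trans av (sym ay) ∷ fs′) , tight
        , ≤-trans (≤-reflexive ay) (≤-trans (<⇒≤ j<) k≤D) ∷ low) , ay , <⇒≤ j<
        where
        open Inv I
        v∈ = ∈⟦⟧⁻ fs? (elems⁻ {X = ⟦ fs? ⟧} (subst (v ∈ₗ_) (sym eq) (∈-++⁺ʳ pre (here refl))))
        v∈S = proj₁ v∈
        av : a st v ≡ j
        av = proj₂ v∈
        v∈done : v ∈ done st
        v∈done with v ∈? done st
        ... | yes p = p
        ... | no p = ⊥-elim (<⇒≱ j< (≤-trans (missing≥ v∈S p) (≤-reflexive av)))
        open Parent (parent v∈S v∈done)
        ay : a st (par st v) ≡ j
        ay = trans level av
        edge₁ : Closure.Edge (proj₁ M) (S st) u v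
        edge₁ = v∈S , u∉S , Closure.cl-mono (proj₁ M) X⊆S (proj₂ (K⇒ κ))
              , λ d → ¬c (Closure.cl-∩ (proj₁ M) ind₁ X⊆S v∈S (proj₂ (K⇒ κ)) d)
        later₂ : All (λ q → Span two M (del (S st) (proj₁ q)) (par st v)) qs
        later₂ = All.map (λ le → Closure.cl-mono (proj₂ M)
            (λ x∈ → let p , q = below⁻ x∈ in del⁺ p λ { refl → <⇒≱ (≤-trans (≤-reflexive (sym e)) le) (≤-trans q (≤-reflexive ay)) })
            (lb (≤-trans (s≤s (≤-reflexive ay)) (≤-trans j< k≤D))))
          (later≥ u qs L)
        later₁ : All (λ q → Span one M (del (S st) v) (proj₂ q)) qs
        later₁ = All.zipWith (λ ((le , e₁) , e₂) → Closure.cl-mono (proj₁ M)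
            (λ x∈ → let p , q = above⁻ x∈ in del⁺ p λ { refl → <⇒≱ (≤-trans (≤-reflexive (trans (cong suc av) (sym e))) le) q })
            (la (proj₁ (proj₂ e₁)) e₂))
          (All.zip (later≥ u qs L , Path.edges₁ (proj₁ M) (proj₂ M) (S st) path) , es)
      next : ∀ s → Spec (λ M → K M × BinarySearch.Found id one X u u∉X K K⇒ fs s M) Extracted (λ _ → 0) (j * ℓ)
      next [] = return (u , qs) λ M ()
      next (v ∷ post) with par st v ∈? S st
      ... | yes bad = return (u , qs) λ M (κ , f) → ⊥-elim (proj₁ (proj₁ (proj₂ (proj₂ (proj₁ (facts κ f))))) bad) , z≤n
      ... | no y∉ = weaken (extract j (par st v) ((v , u) ∷ qs) y∉) λ M (κ , f) →
              let g , e , le = facts κ f in (proj₁ κ , g , e , le) , ≤-refl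

  -- The query showed that no `M₁` edge enters `u` from a level below `k`, so `k + 1` is again a
  -- lower bound.
  module Raise {st u M} (I : Inv st M) (u∉ : u ∉ S st) (u∉d : u ∉ done st) (au : a st u ≡ k st)
    (c : Span one M (above (S st) (a st) (k st)) u) where
    open Inv I

    a′ : Fin n → ℕ
    a′ = update (a st) u (suc (k st))

    private
      same : ∀ {e} → e ≢ u → a′ e ≡ a st e
      same = update-≢ (a st)
      sameS : ∀ {e} → e ∈ S st → a′ e ≡ a st e
      sameS e∈ = same λ { refl → u∉ e∈ }
      up : ∀ {t} → above (S st) (a st) t ⊆ above (S st) a′ t
      up x∈ = let p , q = above⁻ x∈ in above⁺ p (≤-trans q (≤-reflexive (sym (sameS p))))
      up⁻ : ∀ {t} → above (S st) a′ t ⊆ above (S st) (a st) t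
      up⁻ x∈ = let p , q = above⁻ x∈ in above⁺ p (≤-trans q (≤-reflexive (sameS p)))
      down : ∀ {s t} → s ≤ t → below (S st) (a st) s ⊆ below (S st) a′ t
      down s≤ x∈ = let p , q = below⁻ x∈ in below⁺ p (≤-trans (≤-reflexive (sameS p)) (≤-trans q s≤))

    next : State
    next = record st { a = a′ }

    inv : Inv next M
    inv = record
      { ub = ub ; k≤D = k≤D
      ; valid = record { ind₁ = ind₁ ; ind₂ = ind₂ ; la = la′ ; lb = lb′ ; D< = D< ; S≤m = S≤m
                       ; aS≤D = λ v∈ → subst (_≤ D st) (sym (sameS v∈)) (aS≤D v∈) }
      ; parent = par′
      ; done≤k = λ {e} e∈ → subst (_≤ k st) (sym (same λ { refl → u∉d e∈ })) (done≤k e∈)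
      ; missing≥ = λ v∈ v∉ → subst (k st ≤_) (sym (sameS v∈)) (missing≥ v∈ v∉)
      ; doneU = doneU }
      where
      la′ : ∀ {t} → LabelsAbove (proj₁ M) (S st) a′ t
      la′ {t} {e} e∉ eq with e Fin.≟ u
      ... | yes refl = subst (λ i → Span one M (above (S st) a′ i) e) (suc-injective eq) (Closure.cl-mono (proj₁ M) up c)
      ... | no ne = Closure.cl-mono (proj₁ M) up (la e∉ eq)
      lb′ : LabelsBelow (proj₂ M) (S st) a′ (D st)
      lb′ {e} lt with e Fin.≟ u
      ... | yes refl = Closure.cl-mono (proj₂ M) (down (≤-trans (≤-reflexive au) (n≤1+n _))) (lb (≤-trans (s≤s (≤-reflexive au)) (<⇒≤ lt)))
      ... | no ne = Closure.cl-mono (proj₂ M) (down ≤-refl) (lb lt)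
      par′ : ∀ {v} → v ∈ S st → v ∈ done st → Parent next v M
      par′ {v} v∈ v∈d = go (parent v∈ v∈d) (par st v Fin.≟ u)
        where
        go : Parent st v M → Dec (par st v ≡ u) → Parent next v M
        go P (yes refl) = ⊥-elim (proj₂ (Parent.tight P) (subst (λ i → Span one M (above (S st) (a st) i) u) (sym au) c))
        go P (no ne) = record
          { level = trans (same ne) (trans (Parent.level P) (sym (sameS v∈)))
          ; tight = proj₁ (Parent.tight P) , λ d → proj₂ (Parent.tight P)
              (subst (λ i → Span one M (above (S st) (a st) i) (par st v)) (same ne) (Closure.cl-mono (proj₁ M) up⁻ d))
          ; edge = Parent.edge P }

  inv-done : ∀ {st u M} → Inv st M → u ∉ S st → a st u ≡ k st → Span two M (found st) u →
             Inv (record st { done = done st ⊕ u }) M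
  inv-done {st} {u} {M} I u∉ au c = record
    { ub = ub ; k≤D = k≤D ; valid = valid
    ; parent = λ v∈ v∈d → let P = parent v∈ (old v∈ v∈d) in
        record { level = Parent.level P ; tight = Parent.tight P ; edge = Parent.edge P }
    ; done≤k = λ e∈ → [ done≤k , (λ { refl → ≤-reflexive au }) ]′ (∪-∈⁻ (done st) u e∈)
    ; missing≥ = λ v∈ v∉ → missing≥ v∈ (v∉ ∘ ∪-∈ˡ u)
    ; doneU = λ e∉ e∈ → Closure.cl-mono (proj₂ M) grow ([ doneU e∉ , (λ { refl → c }) ]′ (∪-∈⁻ (done st) u e∈)) }
    where
    open Inv I
    old : ∀ {v} → v ∈ S st → v ∈ done st ⊕ u → v ∈ done st
    old v∈ v∈d = [ id , (λ { refl → ⊥-elim (u∉ v∈) }) ]′ (∪-∈⁻ (done st) u v∈d)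
    grow : found st ⊆ found (record st { done = done st ⊕ u })
    grow x∈ = let p , q = ∈⟦⟧⁻ (found? st) x∈ in ∈⟦⟧⁺ (found? (record st { done = done st ⊕ u })) (p , ∪-∈ˡ u q)

  inv-found : ∀ {st u v M} → Inv st M → Tight st u M → a st u ≡ k st → v ∉ done st → a st v ≡ k st →
              Closure.Edge (proj₂ M) (S st) u v →
              Inv (record st { done = done st ⊕ v ; par = update (par st) v u }) M
  inv-found {st} {u} {v} {M} I t au v∉d av edge = record
    { ub = ub ; k≤D = k≤D ; valid = valid
    ; parent = par′
    ; done≤k = λ e∈ → [ done≤k , (λ { refl → ≤-reflexive av }) ]′ (∪-∈⁻ (done st) v e∈)
    ; missing≥ = λ x∈ x∉ → missing≥ x∈ (x∉ ∘ ∪-∈ˡ v)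
    ; doneU = λ {e} e∉ e∈ → Closure.cl-mono (proj₂ M) grow
        ([ doneU e∉ , (λ { refl → ⊥-elim (e∉ (proj₁ edge)) }) ]′ (∪-∈⁻ (done st) v e∈)) }
    where
    open Inv I
    st′ = record st { done = done st ⊕ v ; par = update (par st) v u }
    grow : found st ⊆ found st′
    grow x∈ = let p , q = ∈⟦⟧⁻ (found? st) x∈ in ∈⟦⟧⁺ (found? st′) (p , ∪-∈ˡ v q)
    mk : ∀ {x y} → update (par st) v u x ≡ y → a st y ≡ a st x → Tight st y M → Closure.Edge (proj₂ M) (S st) y x → Parent st′ x M
    mk refl l t e = record { level = l ; tight = t ; edge = e }
    par′ : ∀ {x} → x ∈ S st → x ∈ done st ⊕ v → Parent st′ x M
    par′ {x} x∈ x∈d with ∪-∈⁻ (done st) v x∈d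
    ... | inj₂ refl = mk (update-≡ (par st) v u) (trans au (sym av)) t edge
    ... | inj₁ p = let P = parent x∈ p in
      mk (update-≢ (par st) λ { refl → v∉d p }) (Parent.level P) (Parent.tight P) (Parent.edge P)

  -- When every outside element of level `k` is finished, an element of `S` still missing there has
  -- no predecessor on that level and moves up. If `k` was `D`, no sink lies on level `D` and the
  -- distance bound grows.
  module LevelUp (st : State) where

    up? : ∀ x → Dec (x ∈ S st × x ∉ done st × a st x ≡ k st)
    up? x = x ∈? S st ×-dec ¬? (x ∈? done st) ×-dec a st x ≟ k st

    abstract
      a′ : Fin n → ℕ
      a′ x = if does (up? x) then suc (k st) else a st x

      D′ : ℕ
      D′ = if does (k st ≟ D st) then suc (D st) else D st

      a′-view : ∀ x → (a′ x ≡ a st x × ¬ (x ∈ S st × x ∉ done st × a st x ≡ k st))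
                ⊎ (a′ x ≡ suc (k st) × x ∈ S st × x ∉ done st × a st x ≡ k st)
      a′-view x = go (up? x) refl
        where
        go : (d : Dec (x ∈ S st × x ∉ done st × a st x ≡ k st)) → d ≡ up? x →
             (a′ x ≡ a st x × ¬ (x ∈ S st × x ∉ done st × a st x ≡ k st)) ⊎ (a′ x ≡ suc (k st) × x ∈ S st × x ∉ done st × a st x ≡ k st)
        go (yes p) e = inj₂ (cong (if_then suc (k st) else a st x) (sym (cong does e)) , p)
        go (no p) e = inj₁ (cong (if_then suc (k st) else a st x) (sym (cong does e)) , p)

      D′-view : (k st ≡ D st × D′ ≡ suc (D st)) ⊎ (k st ≢ D st × D′ ≡ D st)
      D′-view = go (k st ≟ D st) refl
        where
        go : (d : Dec (k st ≡ D st)) → d ≡ (k st ≟ D st) → (k st ≡ D st × D′ ≡ suc (D st)) ⊎ (k st ≢ D st × D′ ≡ D st)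
        go (yes p) e = inj₁ (p , cong (if_then suc (D st) else D st) (sym (cong does e)))
        go (no p) e = inj₂ (p , cong (if_then suc (D st) else D st) (sym (cong does e)))

    next : State
    next = record st { a = a′ ; D = D′ ; k = suc (k st) }

    a≤a′ : ∀ x → a st x ≤ a′ x
    a≤a′ x with a′-view x
    ... | inj₁ (e , _) = ≤-reflexive (sym e)
    ... | inj₂ (e , _ , _ , f) = ≤-trans (≤-trans (≤-reflexive f) (n≤1+n _)) (≤-reflexive (sym e))

    module Correct {M} (I : Inv st M) (none : ∀ {u} → u ∉ S st → a st u ≡ k st → u ∈ done st) where
      open Inv I

      same-done : ∀ {x} → x ∈ done st → a′ x ≡ a st x
      same-done {x} x∈ with a′-view x
      ... | inj₁ (e , _) = e
      ... | inj₂ (_ , _ , p , _) = ⊥-elim (p x∈)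

      same-out : ∀ {x} → x ∉ S st → a′ x ≡ a st x
      same-out {x} x∉ with a′-view x
      ... | inj₁ (e , _) = e
      ... | inj₂ (_ , p , _) = ⊥-elim (x∉ p)

      la′ : ∀ {t} → LabelsAbove (proj₁ M) (S st) a′ t
      la′ e∉ eq = Closure.cl-mono (proj₁ M) (λ {x} x∈ → let p , q = above⁻ x∈ in above⁺ p (≤-trans q (a≤a′ x)))
        (la e∉ (trans (sym (same-out e∉)) eq))

      lb′ : LabelsBelow (proj₂ M) (S st) a′ D′
      lb′ {e} lt with e ∈? S st
      ... | yes e∈ = inj₁ (below⁺ e∈ ≤-refl)
      ... | no e∉ with a st e ≟ k st
      ... | yes ae = Closure.cl-mono (proj₂ M) (λ x∈ → let p , q = ∈⟦⟧⁻ (found? st) x∈ in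
                below⁺ p (≤-trans (≤-reflexive (same-done q)) (≤-trans (done≤k q) (≤-reflexive (sym (trans (same-out e∉) ae))))))
              (doneU e∉ (none e∉ ae))
      ... | no ae = Closure.cl-mono (proj₂ M) sub (lb lt′)
        where
        lt′ : a st e < D st
        lt′ with D′-view
        ... | inj₂ (_ , eq) = subst₂ _<_ (same-out e∉) eq lt
        ... | inj₁ (k≡ , eq) = ≤∧≢⇒< (s≤s⁻¹ (subst₂ _<_ (same-out e∉) eq lt)) λ r → ae (trans r (sym k≡))
        sub : below (S st) (a st) (a st e) ⊆ below (S st) a′ (a′ e)
        sub {x} x∈ with below⁻ x∈ | a′-view x
        ... | p , q | inj₁ (ex , _) = below⁺ p (≤-trans (≤-reflexive ex) (≤-trans q (a≤a′ e)))
        ... | p , q | inj₂ (ex , _ , _ , ax) = below⁺ p (≤-trans (≤-reflexive ex) (≤-trans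
              (≤∧≢⇒< (≤-trans (≤-reflexive (sym ax)) q) (ae ∘ sym)) (a≤a′ e)))

      k<D′ : suc (k st) ≤ D′
      k<D′ with D′-view
      ... | inj₁ (k≡ , eq) = ≤-reflexive (trans (cong suc k≡) (sym eq))
      ... | inj₂ (k≢ , eq) = ≤-trans (≤∧≢⇒< k≤D k≢) (≤-reflexive (sym eq))

      inv : D′ < dmax → Inv next M
      inv D′< = record
        { ub = ub ; k≤D = k<D′
        ; valid = record { ind₁ = ind₁ ; ind₂ = ind₂ ; la = la′ ; lb = lb′ ; D< = D′< ; S≤m = S≤m ; aS≤D = aS }
        ; parent = par′
        ; done≤k = λ e∈ → ≤-trans (≤-reflexive (same-done e∈)) (≤-trans (done≤k e∈) (n≤1+n _))
        ; missing≥ = miss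
        ; doneU = doneU }
        where
        D≤D′ : D st ≤ D′
        D≤D′ with D′-view
        ... | inj₁ (_ , eq) = ≤-trans (n≤1+n _) (≤-reflexive (sym eq))
        ... | inj₂ (_ , eq) = ≤-reflexive (sym eq)
        aS : ∀ {v} → v ∈ S st → a′ v ≤ D′
        aS {v} v∈ with a′-view v
        ... | inj₁ (e , _) = ≤-trans (≤-reflexive e) (≤-trans (aS≤D v∈) D≤D′)
        ... | inj₂ (e , _) = ≤-trans (≤-reflexive e) k<D′
        miss : ∀ {v} → v ∈ S st → v ∉ done st → suc (k st) ≤ a′ v
        miss {v} v∈ v∉ with a′-view v
        ... | inj₁ (e , no-up) = ≤-trans (≤∧≢⇒< (missing≥ v∈ v∉) λ r → no-up (v∈ , v∉ , sym r)) (≤-reflexive (sym e))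
        ... | inj₂ (e , _) = ≤-reflexive (sym e)
        par′ : ∀ {v} → v ∈ S st → v ∈ done st → Parent next v M
        par′ {v} v∈ v∈d = record
          { level = trans ey (trans (Parent.level P) (sym (same-done v∈d)))
          ; tight = y∉ , λ d → proj₂ (Parent.tight P) (Closure.cl-mono (proj₁ M) sub d)
          ; edge = Parent.edge P }
          where
          P = parent v∈ v∈d
          y = par st v
          y∉ = proj₁ (Parent.tight P)
          ey : a′ y ≡ a st y
          ey = same-out y∉
          sub : above (S st) a′ (a′ y) ⊆ above (S st) (a st) (a st y)
          sub {x} x∈ with above⁻ x∈ | a′-view x
          ... | p , q | inj₁ (e , _) = above⁺ p (subst₂ _≤_ ey e q)
          ... | p , q | inj₂ (_ , _ , _ , e) = above⁺ p (≤-trans (≤-reflexive (Parent.level P)) (≤-trans (done≤k v∈d) (≤-reflexive (sym e))))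

      -- In this phase `P` is `S`, so there is no excess and only the averaging term remains.
      stop-bound : ¬ D′ < dmax → ∀ T → Common T M → dmax * ∣ T ∣ ≤ dmax * ∣ S st ∣ + ∣ S st ∣
      stop-bound D′≮ T ci = subst (λ d → d * ∣ T ∣ ≤ d * ∣ S st ∣ + ∣ S st ∣) (≤-antisym D′≤ (≮⇒≥ D′≮))
        (≤-trans (LabelBound.labels-bound (proj₁ M) (proj₂ M) id ind₁ ind₂ la′ lb′ ci)
          (+-monoˡ-≤ ∣ S st ∣ (*-monoʳ-≤ D′ (≤-reflexive (trans (cong (∣ S st ∣ +_) no-excess) (+-identityʳ _))))))
        where
        D′≤ : D′ ≤ dmax
        D′≤ with D′-view
        ... | inj₁ (_ , eq) = ≤-trans (≤-reflexive eq) D<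
        ... | inj₂ (_ , eq) = ≤-trans (≤-reflexive eq) (<⇒≤ D<)
        no-excess : ∣ LabelBound.excess (proj₁ M) (proj₂ M) id ind₁ ind₂ la′ lb′ ∣ ≡ 0
        no-excess = trans (cong ∣_∣ (Empty-unique λ (x , x∈) →
          let p , q , _ = ∈⟦⟧⁻ (λ x → x ∈? S st ×-dec ¬? (x ∈? S st) ×-dec a′ x <? D′) x∈ in q p)) (∣⊥∣≡0 n)

∑-strict : ∀ {n} {f g : Fin n → ℕ} u → (∀ i → f i ≤ g i) → f u < g u → ∑ f < ∑ g
∑-strict zero h lt = +-mono-<-≤ lt (∑-mono (h ∘ suc))
∑-strict (suc u) h lt = +-mono-≤-< (h zero) (∑-strict u (h ∘ suc) lt)

⊕-card-∸ : ∀ {n} {X : Subset n} {u} → u ∉ X → suc (n ∸ ∣ X ⊕ u ∣) ≤ n ∸ ∣ X ∣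
⊕-card-∸ {n} {X} {u} u∉ = ∸-monoʳ-< (∣∪⁅⁆∣> u∉) (∣p∣≤n (X ⊕ u))

module ShortestPath {n : ℕ} (dmax ℓ m : ℕ) (m≤ : m ≤ 2 ^ ℓ) where
  open Sweep {n} dmax ℓ m m≤
  open State

  data Outcome : Set where
    augmented : (Fin n → ℕ) → Subset n → ℕ → Outcome
    exhausted : Outcome

  UpperBound : Inst n → Set
  UpperBound M = ∀ T → Common T M → ∣ T ∣ ≤ m

  Post : Subset n → Outcome → Inst n → Set
  Post S₀ (augmented a S D) M = Valid a S D M × ∣ S₀ ∣ < ∣ S ∣
  Post S₀ exhausted M = ∀ T → Common T M → dmax * ∣ T ∣ ≤ dmax * ∣ S₀ ∣ + ∣ S₀ ∣

  leftover : Outcome → ℕ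
  leftover (augmented a _ _) = raises a
  leftover exhausted = 0

  -- Prepaid queries: one per label increase, up to three tests per element entering `done`, `ℓ` per
  -- element of `S` found, and the final extraction. The term `dmax ∸ k` pays no query; it makes a
  -- change of level decrease the potential, which is also the fuel of `loop`.
  base : State → ℕ
  base st = raises (a st) + (3 * (n ∸ ∣ done st ∣) + (ℓ * (∣ S st ∣ ∸ ∣ found st ∣) + ((dmax ∸ k st) + dmax * ℓ)))

  private
    shift : ∀ i r x t → i + (r + (x + t)) ≡ r + (i + x + t)
    shift = solve-∀

    shift₂ : ∀ l r x y t → (l + 3) + (r + (x + (y + t))) ≡ r + (3 + x + (l + y + t))
    shift₂ = solve-∀

    triple : ∀ {x x′} → suc x′ ≤ x → 3 + 3 * x′ ≤ 3 * x
    triple {x} {x′} le = ≤-trans (≤-reflexive (sym (*-suc 3 x′))) (*-monoʳ-≤ 3 le)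

  base-raise : ∀ {st u} → a st u ≡ k st → k st < dmax → suc (base (record st { a = update (a st) u (suc (k st)) })) ≤ base st
  base-raise {st} {u} au k< = +-monoˡ-≤ _ (∑-strict u le lt)
    where
    le : ∀ e → dmax ∸ update (a st) u (suc (k st)) e ≤ dmax ∸ a st e
    le e with e Fin.≟ u
    ... | yes refl = ∸-monoʳ-≤ dmax (≤-trans (≤-reflexive au) (n≤1+n _))
    ... | no _ = ≤-refl
    lt : dmax ∸ update (a st) u (suc (k st)) u < dmax ∸ a st u
    lt = subst (λ i → dmax ∸ i < dmax ∸ a st u) (sym (update-≡ (a st) u _))
      (∸-monoʳ-< (≤-reflexive (cong suc au)) k<)

  found-grows : ∀ {st st′} → S st′ ≡ S st → done st ⊆ done st′ → found st ⊆ found st′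
  found-grows {st} {st′} refl sub x∈ = let p , q = ∈⟦⟧⁻ (found? st) x∈ in ∈⟦⟧⁺ (found? st′) (p , sub q)

  base-done : ∀ {st u} → u ∉ done st → 3 + base (record st { done = done st ⊕ u }) ≤ base st
  base-done {st} {u} u∉ = ≤-trans (≤-reflexive (shift 3 (raises (a st)) (3 * (n ∸ ∣ done st ⊕ u ∣)) _))
    (+-monoʳ-≤ (raises (a st)) (+-mono-≤ (triple (⊕-card-∸ u∉))
      (+-monoˡ-≤ _ (*-monoʳ-≤ ℓ (∸-monoʳ-≤ ∣ S st ∣ (p⊆q⇒∣p∣≤∣q∣ (found-grows {st} {record st { done = done st ⊕ u }} refl (∪-∈ˡ u))))))))

  base-found : ∀ {st v p} → v ∈ S st → v ∉ done st → (ℓ + 3) + base (record st { done = done st ⊕ v ; par = p }) ≤ base st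
  base-found {st} {v} {p} v∈ v∉ = ≤-trans (≤-reflexive (shift₂ ℓ (raises (a st)) (3 * (n ∸ ∣ done st ⊕ v ∣)) (ℓ * (∣ S st ∣ ∸ ∣ found st′ ∣)) _))
    (+-monoʳ-≤ (raises (a st)) (+-mono-≤ (triple (⊕-card-∸ v∉)) (+-monoˡ-≤ _ one-less)))
    where
    st′ = record st { done = done st ⊕ v ; par = p }
    lt : ∣ found st ∣ < ∣ found st′ ∣
    lt = p⊂q⇒∣p∣<∣q∣ (found-grows {st} {st′} refl (∪-∈ˡ v) , v , ∈⟦⟧⁺ (found? st′) (v∈ , ∪-∈ʳ (done st) v) , λ v∈f → v∉ (proj₂ (∈⟦⟧⁻ (found? st) v∈f)))
    one-less : ℓ + ℓ * (∣ S st ∣ ∸ ∣ found st′ ∣) ≤ ℓ * (∣ S st ∣ ∸ ∣ found st ∣)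
    one-less = ≤-trans (≤-reflexive (sym (*-suc ℓ _))) (*-monoʳ-≤ ℓ (∸-monoʳ-< lt (p⊆q⇒∣p∣≤∣q∣ (λ x∈ → proj₁ (∈⟦⟧⁻ (found? st′) x∈)))))

  base-up : ∀ st → k st < dmax → suc (base (LevelUp.next st)) ≤ base st
  base-up st k< = ≤-trans (≤-reflexive (shift₄ (raises a′) (3 * (n ∸ ∣ done st ∣)) (ℓ * (∣ S st ∣ ∸ ∣ found st ∣)) (dmax ∸ suc (k st)) (dmax * ℓ)))
    (+-mono-≤ (∑-mono (λ e → ∸-monoʳ-≤ dmax (a≤a′ e)))
      (+-monoʳ-≤ (3 * (n ∸ ∣ done st ∣)) (+-monoʳ-≤ (ℓ * (∣ S st ∣ ∸ ∣ found st ∣))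
        (+-monoˡ-≤ (dmax * ℓ) (∸-monoʳ-< ≤-refl k<)))))
    where
    open LevelUp st
    shift₄ : ∀ r x y z w → suc (r + (x + (y + (z + w)))) ≡ r + (x + (y + (suc z + w)))
    shift₄ = solve-∀

  aug-valid : ∀ {st M u qs} → Inv st M → Extract.Extracted st (u , qs) M →
              Valid (a st) (augment (S st) u qs) (D st) M × ∣ S st ∣ < ∣ augment (S st) u qs ∣
  aug-valid {st} {M} {u} {qs} I ((path , (es , fs) , _ , low) , ¬c) = record
    { ind₁ = A.ind₁ ; ind₂ = A.ind₂ ; la = A.labels-above es la ; lb = A.labels-below fs lb
    ; aS≤D = λ v∈ → [ aS≤D ∘ proj₁ , All.lookup low ]′ (augment⁻ {qs = qs} v∈)
    ; D< = D< ; S≤m = ub _ (A.ind₁ , A.ind₂) } , A.card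
    where
    open Inv I
    module A = Path.Augment (proj₁ M) (proj₂ M) (S st) path ind₁ ind₂ ¬c

  loop : ∀ f st → Spec (λ M → Inv st M × base st < f) (Post (S st)) leftover (3 + base st)
  loop zero st = return exhausted λ M ()
  loop (suc f) st with any? (λ u → ¬? (u ∈? S st) ×-dec ¬? (u ∈? done st) ×-dec a st u ≟ k st)
  ... | no none with LevelUp.D′ st <? dmax
  ... | yes lt = weaken (loop f next) λ M (I , b) →
            let up = base-up st (≤-<-trans (Inv.k≤D I) (Inv.D< I)) in
            (Correct.inv I (λ u∉ au → dec-∈ u∉ au) lt , ≤-trans up (s≤s⁻¹ b)) , +-monoʳ-≤ 3 (≤-trans (n≤1+n _) up)
    where
    open LevelUp st
    dec-∈ : ∀ {u} → u ∉ S st → a st u ≡ k st → u ∈ done st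
    dec-∈ {u} u∉ au = decidable-stable (u ∈? done st) λ u∉d → none (u , u∉ , u∉d , au)
  ... | no ≮ = return exhausted λ M (I , b) →
            Correct.stop-bound I (λ {u} u∉ au → decidable-stable (u ∈? done st) λ u∉d → none (u , u∉ , u∉d , au)) ≮ , z≤n
    where open LevelUp st
  loop (suc f) st | yes (u , u∉S , u∉d , au) =
    branch-span one X u u∉X (sinkTest (k st ≟ D st))
      (weaken (loop f (record st { a = update (a st) u (suc (k st)) })) λ M ((I , b) , c) →
        let le = base-raise {st} au (≤-<-trans (Inv.k≤D I) (Inv.D< I)) in
        (Raise.inv I u∉S u∉d au c , ≤-trans le (s≤s⁻¹ b)) , +-monoʳ-≤ 2 le)
    where
    X = above (S st) (a st) (k st)
    u∉X : u ∉ X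
    u∉X = u∉S ∘ proj₁ ∘ above⁻
    K₁ K₂ K₃ : Inst n → Set
    K₁ M = (Inv st M × base st < suc f) × ¬ Span one M X u
    K₂ M = K₁ M × Span two M (S st) u
    K₃ M = K₂ M × ¬ Span two M (found st) u
    tight : ∀ {M} → K₁ M → Tight st u M
    tight {M} (_ , t) = u∉S , subst (λ i → ¬ Span one M (above (S st) (a st) i) u) (sym au) t
    fs = elems (missing st)
    K₃⇒ : ∀ {M} → K₃ M → ⟪ two ⟫ M (S st) × Span two M (S st) u
    K₃⇒ ((((I , _) , _) , c) , _) = Inv.ind₂ I , c
    side : ∀ {M} → K₃ M → length fs ≤ 2 ^ ℓ × All (λ v → v ∈ S st) fs × ¬ Span two M (S st ∖ map id fs) u
    side {M} ((((I , _) , _) , _) , ¬c) =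
      ≤-trans (≤-reflexive (length-elems (missing st))) (≤-trans (p⊆q⇒∣p∣≤∣q∣ (proj₁ ∘ missing⁻ {st})) (≤-trans (Inv.S≤m I) m≤))
      , All.tabulate (λ i → proj₁ (missing⁻ {st} (elems⁻ i)))
      , λ c → ¬c (Closure.cl-mono (proj₂ M) (λ {x} x∈ → let p , q = ∖-∈⁻ (map id fs) x∈ in
          ∈⟦⟧⁺ (found? st) (p , decidable-stable (x ∈? done st) λ x∉ →
            q (subst (x ∈ₗ_) (sym (List.map-id fs)) (elems⁺ (missing⁺ {st} p x∉))))) c)
    Found′ = BinarySearch.Found id two (S st) u u∉S K₃ K₃⇒ fs
    foundNext : ∀ {M v post} → K₃ M → Found′ (v ∷ post) M → v ∈ S st × v ∉ done st × Inv (record st { done = done st ⊕ v ; par = update (par st) v u }) M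
    foundNext {M} {v} {post} κ@(((( I , _) , _) , cS) , _) ((pre , eq) , ¬c , _) =
      proj₁ v∈ , proj₂ v∈ , inv-found I (tight (proj₁ (proj₁ κ))) au (proj₂ v∈) (≤-antisym av≤ (Inv.missing≥ I (proj₁ v∈) (proj₂ v∈)))
        (proj₁ v∈ , u∉S , cS , ¬c)
      where
      open Inv I
      v∈ : v ∈ S st × v ∉ done st
      v∈ = missing⁻ {st} (elems⁻ (subst (v ∈ₗ_) (sym eq) (∈-++⁺ʳ pre (here refl))))
      av≤ : a st v ≤ k st
      av≤ with k st ≟ D st
      ... | yes k≡D = ≤-trans (aS≤D (proj₁ v∈)) (≤-reflexive (sym k≡D))
      ... | no k≢D = ≮⇒≥ λ lt → ¬c (Closure.cl-mono (proj₂ M)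
            (λ x∈ → let p , q = below⁻ x∈ in del⁺ p λ { refl → <⇒≱ lt (≤-trans q (≤-reflexive au)) })
            (lb (subst (_< D st) (sym au) (≤∧≢⇒< k≤D k≢D))))
    foundTest : Spec K₂ (Post (S st)) leftover (suc (base st))
    foundTest = branch-span two (found st) u (u∉S ∘ proj₁ ∘ ∈⟦⟧⁻ (found? st))
      (weaken (bind (frame (base st ∸ ℓ) (find id two (S st) u u∉S ℓ fs K₃ K₃⇒ side)) continue)
        λ M κ → κ , ≤-reflexive (m+[n∸m]≡n (ℓ≤ (proj₁ (proj₁ (proj₁ κ))))))
      (weaken (loop f (record st { done = done st ⊕ u })) λ M ((((I , b) , _) , _) , c) →
        (inv-done I u∉S au c , ≤-trans (≤-trans (s≤s (m≤n+m _ 2)) (base-done {st} u∉d)) (s≤s⁻¹ b)) , base-done {st} u∉d)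
      where
      ℓ≤ : ∀ {M} → Inv st M × base st < suc f → ℓ ≤ base st
      ℓ≤ (I , _) = ≤-trans (≤-trans (≤-reflexive (sym (*-identityˡ ℓ))) (*-monoˡ-≤ ℓ (≤-trans (s≤s z≤n) (Inv.D< I))))
        (≤-trans (m≤n+m _ (dmax ∸ k st)) (≤-trans (m≤n+m _ (ℓ * _)) (≤-trans (m≤n+m _ (3 * (n ∸ ∣ done st ∣))) (m≤n+m _ (raises (a st))))))
      continue : ∀ s → Spec (λ M → K₃ M × Found′ s M) (Post (S st)) leftover (base st ∸ ℓ)
      continue [] = return exhausted λ M ()
      continue (v ∷ post) = weaken (loop f (record st { done = done st ⊕ v ; par = update (par st) v u })) λ M (κ , g) →
        let v∈ , v∉ , I′ = foundNext κ g
            le = base-found {st} {p = update (par st) v u} v∈ v∉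
            (((_ , b) , _) , _) , _ = κ in
        (I′ , ≤-trans (≤-trans (+-monoˡ-≤ _ (≤-trans (s≤s z≤n) (m≤n+m 3 ℓ))) le) (s≤s⁻¹ b))
        , ≤-trans (≤-reflexive (sym (m+n∸m≡n ℓ _))) (∸-monoˡ-≤ ℓ (≤-trans (≤-reflexive (sym (+-assoc ℓ 3 _))) le))
    -- Below level `D` the labels already exclude sinks, so the query is made only at `k = D`.
    sinkTest : Dec (k st ≡ D st) → Spec K₁ (Post (S st)) leftover (suc (suc (base st)))
    sinkTest (no k≢D) = weaken foundTest λ M κ → (κ , Closure.cl-mono (proj₂ M) (proj₁ ∘ below⁻) (Inv.lb (proj₁ (proj₁ κ))
      (subst (_< D st) (sym au) (≤∧≢⇒< (Inv.k≤D (proj₁ (proj₁ κ))) k≢D)))) , n≤1+n _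
    sinkTest (yes k≡D) = branch-span two (S st) u u∉S
      (weaken (bind (frame (raises (a st)) (Extract.extract st (k st) u [] u∉S)) λ (w , qs) →
          return (augmented (a st) (augment (S st) w qs) (D st)) λ M ((I , _) , ex) → aug-valid I ex , ≤-refl)
        λ M (κ , ¬c) → let I = proj₁ (proj₁ κ) in
          (I , (Path.sink u∉S ¬c , ([] , []) , tight κ , ≤-trans (≤-reflexive au) (Inv.k≤D I) ∷ []) , au , ≤-refl)
          , ≤-trans (≤-reflexive (+-comm (k st * ℓ) _)) (≤-trans (+-monoʳ-≤ (raises (a st))
              (≤-trans (*-monoˡ-≤ ℓ (≤-trans (Inv.k≤D I) (<⇒≤ (Inv.D< I))))
                (≤-trans (m≤n+m _ (dmax ∸ k st)) (≤-trans (m≤n+m _ (ℓ * _)) (m≤n+m _ (3 * (n ∸ ∣ done st ∣))))))) (n≤1+n _)))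
      foundTest

  sweepCost : ℕ
  sweepCost = 3 + (3 * n + (ℓ * m + (dmax + dmax * ℓ)))

  start : (Fin n → ℕ) → Subset n → ℕ → State
  start a S D = state a S D 0 ⊥ id

  start-inv : ∀ {a S D M} → UpperBound M → Valid a S D M → Inv (start a S D) M
  start-inv ub V = record
    { ub = ub ; valid = V ; k≤D = z≤n ; parent = λ _ v∈ → ⊥-elim (∉⊥ v∈) ; done≤k = λ e∈ → ⊥-elim (∉⊥ e∈)
    ; missing≥ = λ _ _ → z≤n ; doneU = λ _ e∈ → ⊥-elim (∉⊥ e∈) }

  start-base : ∀ {a S D M} → Valid a S D M → 3 + base (start a S D) ≤ raises a + sweepCost
  start-base {a} {S} {D} V = ≤-trans (≤-reflexive (assoc (raises a) _)) (+-monoʳ-≤ (raises a) (+-monoʳ-≤ 3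
    (+-mono-≤ (*-monoʳ-≤ 3 (m∸n≤m n ∣ ⊥ {n} ∣)) (+-monoˡ-≤ _ (*-monoʳ-≤ ℓ (≤-trans (m∸n≤m ∣ S ∣ ∣ found (start a S D) ∣) (Valid.S≤m V)))))))
    where
    assoc : ∀ r x → 3 + (r + x) ≡ r + (3 + x)
    assoc = solve-∀

  Done : Subset n → Inst n → Set
  Done S M = Common S M ×
    (∀ T → Common T M → dmax * ∣ T ∣ ≤ dmax * ∣ S ∣ + ∣ S ∣)

  Gap : ℕ → Subset n → Inst n → Set
  Gap g S M = ∀ T → Common T M → ∣ T ∣ ≤ ∣ S ∣ + g

  -- Every augmentation uses up one unit of the gap `g`; the extra sweep is the last one, which
  -- finds no path.
  augmentAll : ∀ g a S D → Call (λ M → (UpperBound M × Valid a S D M) × Gap g S M) Done (raises a + sweepCost * suc g)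
  augmentAll g a S D =
    weaken (bind (frame (sweepCost * g) (weaken (loop (suc (base (start a S D))) (start a S D))
        λ M ((ub , V) , _) → (start-inv ub V , ≤-refl) , start-base V)) (next g))
      λ M k → k , ≤-reflexive (trans (+-assoc (raises a) sweepCost _) (cong (raises a +_) (sym (*-suc sweepCost g))))
    where
    next : ∀ g (r : Outcome) → Call (λ M → ((UpperBound M × Valid a S D M) × Gap g S M) × Post S r M) Done (leftover r + sweepCost * g)
    next g exhausted = return S λ M (((_ , V) , _) , b) → ((Valid.ind₁ V , Valid.ind₂ V) , b) , z≤n
    next zero (augmented a′ S′ D′) = return S λ M ((_ , gap) , (V′ , lt)) →
      ⊥-elim (<-irrefl refl (<-≤-trans lt (≤-trans (gap S′ (Valid.ind₁ V′ , Valid.ind₂ V′)) (≤-reflexive (+-identityʳ _))))) , z≤n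
    next (suc g) (augmented a′ S′ D′) = weaken (augmentAll g a′ S′ D′) λ M (((ub , _) , gap) , (V′ , lt)) →
      ((ub , V′) , λ T ci → ≤-trans (gap T ci) (≤-trans (≤-reflexive (+-suc ∣ S ∣ g)) (+-monoˡ-≤ g lt))) , ≤-refl

  shortestPaths : ∀ g S → 1 ≤ dmax →
    Call (λ M → (UpperBound M × Common S M) × Gap g S M) Done (n * dmax + sweepCost * suc g)
  shortestPaths g S 1≤ = weaken (augmentAll g (λ _ → 0) S 0) λ M ((ub , ci) , gap) →
    ((ub , record { ind₁ = proj₁ ci ; ind₂ = proj₂ ci ; la = λ _ () ; lb = λ () ; aS≤D = λ _ → z≤n
                  ; D< = 1≤ ; S≤m = ub S ci }) , gap)
    , +-monoˡ-≤ (sweepCost * suc g) (≤-reflexive (∑-const n dmax))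

-- Augmenting by reachability

++-length : ∀ {A : Set} (pre : List A) {post fs} → fs ≡ pre ++ post → length post ≤ length fs
++-length pre {post} refl = ≤-trans (m≤n+m _ (length pre)) (≤-reflexive (sym (List.length-++ pre)))

-- Alternating paths back to a source, stored from their end x; all exchange edges may have shortcuts.
module BackPath {n : ℕ} (M₁ M₂ : Matroid n) (S : Subset n) where
  private
    module A = Closure M₁
    module B = Closure M₂

  data BackPath : Fin n → List (Fin n × Fin n) → Set where
    source : ∀ {x} → x ∉ S → ¬ A.Cl S x → BackPath x []
    step : ∀ {x v y ps} → A.Edge S x v → B.Edge S y v → BackPath y ps → BackPath x ((v , y) ∷ ps)

  data BackPath₁ : Fin n → List (Fin n × Fin n) → Set where
    source : ∀ {x} → x ∉ S → ¬ A.Cl S x → BackPath₁ x []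
    step : ∀ {x v y ps} → A.Edge S x v → All (λ p → A.Cl (del S (proj₁ p)) x) ps →
             B.Edge S y v → BackPath₁ y ps → BackPath₁ x ((v , y) ∷ ps)

  suffix₁ : ∀ pre {v y ps v′ y′ post} → B.Edge S y v → BackPath₁ y ps →
            (v , y) ∷ ps ≡ pre ++ (v′ , y′) ∷ post → B.Edge S y′ v′ × BackPath₁ y′ post
  suffix₁ [] e p refl = e , p
  suffix₁ (_ ∷ []) e (step _ _ e′ p) refl = e′ , p
  suffix₁ (_ ∷ q ∷ pre) e (step _ _ e′ p) refl = suffix₁ (q ∷ pre) e′ p refl
  suffix₁ (_ ∷ []) e (source _ _) ()
  suffix₁ (_ ∷ _ ∷ _) e (source _ _) ()

  open Path M₁ M₂ S using (Path; sink) renaming (step to pstep)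

  Joined : Fin n → Fin n → List (Fin n × Fin n) → Set
  Joined v x qs = A.Edge S x v × All (λ q → A.Cl (del S v) (proj₂ q)) qs × Path x qs

  suffix₂ : ∀ pre {v x qs v′ x′ post} → Joined v x qs →
            (v , x) ∷ qs ≡ pre ++ (v′ , x′) ∷ post → Joined v′ x′ post
  suffix₂ [] j refl = j
  suffix₂ (_ ∷ []) (_ , _ , pstep _ _ e a p) refl = e , a , p
  suffix₂ (_ ∷ q ∷ pre) (_ , _ , pstep _ _ e a p) refl = suffix₂ (q ∷ pre) (e , a , p) refl
  suffix₂ (_ ∷ []) (_ , _ , sink _ _) ()
  suffix₂ (_ ∷ _ ∷ _) (_ , _ , sink _ _) ()

-- Removing shortcuts with one binary search per element, first in M₁ and then in M₂.
module Shorten {n : ℕ} (S : Subset n) (ℓ : ℕ) where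

  Back Back₁ Front : Fin n → List (Fin n × Fin n) → Inst n → Set
  Back x ps M = BackPath.BackPath (proj₁ M) (proj₂ M) S x ps
  Back₁ x ps M = BackPath.BackPath₁ (proj₁ M) (proj₂ M) S x ps
  Front x qs M = Path.Path (proj₁ M) (proj₂ M) S x qs

  not-all : ∀ {i M u} (fs : List (Fin n × Fin n)) {p} → p ∈ₗ fs → ¬ Span i M (del S (proj₁ p)) u → ¬ Span i M (S ∖ map proj₁ fs) u
  not-all {i} {M} fs p∈ ¬c c = ¬c (Closure.cl-mono (mat i M) (λ x∈ → let a , b = ∖-∈⁻ (map proj₁ fs) x∈ in
    del⁺ a λ { refl → b (∈-map⁺ proj₁ p∈) }) c)

  -- The tail is shortened first. Then `x` jumps to its `M₁` neighbour nearest the source, beyond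
  -- which none is left.
  shorten₁ : ∀ x ps → Call (λ M → (Common S M × length ps ≤ 2 ^ ℓ) × Back x ps M)
               (λ ps′ M → Back₁ x ps′ M × length ps′ ≤ length ps) (length ps * ℓ)
  shorten₁ x [] = return [] λ where M (_ , BackPath.source p q) → (BackPath.source p q , z≤n) , z≤n
  shorten₁ x ((v , y) ∷ ps) with x ∈? S
  ... | yes bad = return [] λ where M (_ , BackPath.step e _ _) → ⊥-elim (proj₁ (proj₂ e) bad) , z≤n
  ... | no x∉ = weaken (call (weaken (shorten₁ y ps) λ M k → sub k , ≤-refl) next)
                  λ M k → k , ≤-reflexive (+-comm (length ps * ℓ) ℓ)
    where
    K : Inst n → Set
    K M = (Common S M × length ((v , y) ∷ ps) ≤ 2 ^ ℓ) × Back x ((v , y) ∷ ps) M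
    sub : ∀ {M} → K M → (Common S M × length ps ≤ 2 ^ ℓ) × Back y ps M
    sub ((c , le) , BackPath.step _ _ b) = (c , ≤-trans (n≤1+n _) le) , b
    next : ∀ ps′ → Call (λ M → K M × Back₁ y ps′ M × length ps′ ≤ length ps)
             (λ qs M → Back₁ x qs M × length qs ≤ length ((v , y) ∷ ps)) ℓ
    next ps′ = bind (find proj₁ one S x x∉ ℓ fs K′ K′⇒ side) λ s → return s λ M (k , f) → found s k f , z≤n
      where
      fs = (v , y) ∷ ps′
      K′ : Inst n → Set
      K′ M = K M × Back₁ y ps′ M × length ps′ ≤ length ps
      K′⇒ : ∀ {M} → K′ M → ⟪ one ⟫ M S × Span one M S x
      K′⇒ (((c , _) , BackPath.step e _ _) , _) = proj₁ c , proj₁ (proj₂ (proj₂ e))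
      members : ∀ {M y ps} → Back₁ y ps M → All (λ p → proj₁ p ∈ S) ps
      members (BackPath.source _ _) = []
      members (BackPath.step e _ _ b) = proj₁ e ∷ members b
      side : ∀ {M} → K′ M → length fs ≤ 2 ^ ℓ × All (λ p → proj₁ p ∈ S) fs × ¬ Span one M (S ∖ map proj₁ fs) x
      side {M} (((_ , le) , BackPath.step e _ _) , (b , le′)) = ≤-trans (s≤s le′) le , proj₁ e ∷ members b
        , not-all {one} {M} fs (here refl) (proj₂ (proj₂ (proj₂ e)))
      found : ∀ s {M} → K′ M → BinarySearch.Found proj₁ one S x x∉ K′ K′⇒ fs s M → Back₁ x s M × length s ≤ length ((v , y) ∷ ps)
      found ((v′ , y′) ∷ post) {M} ((_ , BackPath.step e e₂ _) , (b , le)) ((pre , eq) , ¬c , as) =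
        let f , b′ = BackPath.suffix₁ (proj₁ M) (proj₂ M) S pre e₂ b eq in
        BackPath.step (proj₁ f , x∉ , proj₁ (proj₂ (proj₂ e)) , ¬c) as f b′ , ≤-trans (++-length pre eq) (s≤s le)

  Shortened : Fin n × List (Fin n × Fin n) → Inst n → Set
  Shortened (u , qs) M = Front u qs M × ¬ Span one M S u

  -- The second pass moves from the sink towards the source, and `y` jumps to its `M₂` neighbour
  -- nearest the sink. Only pairs between are dropped, so the `M₁` conditions in the last hypothesis
  -- persist.
  shorten₂ : ∀ x qs ps → Call (λ M → (Common S M × length qs + length ps ≤ 2 ^ ℓ) × (Back₁ x ps M × Front x qs M)
                 × All (λ p → All (λ q → Span one M (del S (proj₁ p)) (proj₂ q)) qs) ps)
               Shortened (length ps * ℓ)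
  shorten₂ x qs [] = return (x , qs) λ where M (_ , (BackPath.source _ ¬c , p) , _) → (p , ¬c) , z≤n
  shorten₂ x qs ((v , y) ∷ ps) with y ∈? S
  ... | yes bad = return (x , qs) λ where M (_ , (BackPath.step _ _ e _ , _) , _) → ⊥-elim (proj₁ (proj₂ e) bad) , z≤n
  ... | no y∉ = bind (frame (length ps * ℓ) (find proj₁ two S y y∉ ℓ fs K K⇒ side)) next
    where
    fs = (v , x) ∷ qs
    K : Inst n → Set
    K M = (Common S M × length qs + length ((v , y) ∷ ps) ≤ 2 ^ ℓ) × (Back₁ x ((v , y) ∷ ps) M × Front x qs M)
      × All (λ p → All (λ q → Span one M (del S (proj₁ p)) (proj₂ q)) qs) ((v , y) ∷ ps)
    K⇒ : ∀ {M} → K M → ⟪ two ⟫ M S × Span two M S y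
    K⇒ ((c , _) , (BackPath.step _ _ e _ , _) , _) = proj₂ c , proj₁ (proj₂ (proj₂ e))
    members : ∀ {M x qs} → Front x qs M → All (λ p → proj₁ p ∈ S) qs
    members (Path.sink _ _) = []
    members (Path.step e _ _ _ p) = proj₁ e ∷ members p
    size : length qs + length ((v , y) ∷ ps) ≤ 2 ^ ℓ → length fs + length ps ≤ 2 ^ ℓ
    size = ≤-trans (≤-reflexive (sym (+-suc (length qs) (length ps))))
    side : ∀ {M} → K M → length fs ≤ 2 ^ ℓ × All (λ p → proj₁ p ∈ S) fs × ¬ Span two M (S ∖ map proj₁ fs) y
    side {M} ((_ , le) , (BackPath.step _ _ e _ , p) , _) = ≤-trans (m≤m+n _ (length ps)) (size le) , proj₁ e ∷ members p
      , not-all {two} {M} fs (here refl) (proj₂ (proj₂ (proj₂ e)))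
    next : ∀ s → Call (λ M → K M × BinarySearch.Found proj₁ two S y y∉ K K⇒ fs s M)
             Shortened (length ps * ℓ)
    next [] = return (x , qs) λ M ()
    next ((v′ , x′) ∷ post) = weaken (shorten₂ y ((v′ , x′) ∷ post) ps) λ where
      M (((c , le) , (BackPath.step e as e₂ b , p) , (cr ∷ crs)) , ((pre , eq) , ¬c , bs)) →
        let e′ , a′ , p′ = BackPath.suffix₂ (proj₁ M) (proj₂ M) S pre (e , cr , p) eq in
        ((c , ≤-trans (+-monoˡ-≤ (length ps) (++-length pre eq)) (size le))
        , (b , Path.step (proj₁ e′ , y∉ , proj₁ (proj₂ (proj₂ e₂)) , ¬c) bs e′ a′ p′)
        , All.zipWith (λ (a , cs) → Allₚ.++⁻ʳ pre (subst (All _) eq (a ∷ cs))) (as , crs)) , ≤-refl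

  Better : Subset n → Inst n → Set
  Better S′ M = Common S′ M × ∣ S ∣ < ∣ S′ ∣

  augmentAlong : ∀ x ps → Call (λ M → (Common S M × length ps ≤ 2 ^ ℓ) × Back x ps M × x ∉ S × ¬ Span two M S x)
                   Better (length ps * ℓ + length ps * ℓ)
  augmentAlong x ps = call (weaken (shorten₁ x ps) λ M (k , b , _) → (k , b) , ≤-refl) λ ps₁ → bind′ ps₁
    where
    bind′ : ∀ ps₁ → Call (λ M → ((Common S M × length ps ≤ 2 ^ ℓ) × Back x ps M × x ∉ S × ¬ Span two M S x)
                × (Back₁ x ps₁ M × length ps₁ ≤ length ps)) Better (length ps * ℓ)
    bind′ ps₁ = bind (weaken (shorten₂ x [] ps₁)
      λ M (((c , le) , _ , x∉ , ¬c) , (b , le′)) →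
        ((c , ≤-trans le′ le) , (b , Path.sink x∉ ¬c) , All.universal (λ _ → []) ps₁) , *-monoˡ-≤ ℓ le′)
      λ (u , qs) → return (augment S u qs) λ M ((((c , _) , _) , _) , (p , ¬c)) →
        let module P = Path.Augment (proj₁ M) (proj₂ M) S p (proj₁ c) (proj₂ c) ¬c in
        ((P.ind₁ , P.ind₂) , P.card) , z≤n

module _ {n : ℕ} where

  Collected : Which → (Fin n → Subset n) → (Fin n → Fin n) → List (Fin n) → Subset n → Inst n → Set
  Collected i X t es W M = (∀ {e} → e ∈ W → e ∈ₗ es × ¬ Span i M (X e) (t e))
                         × (∀ {e} → e ∈ₗ es → e ∉ W → Span i M (X e) (t e))

  collect : ∀ {K : Inst n → Set} i (X : Fin n → Subset n) (t : Fin n → Fin n) es → All (λ e → t e ∉ X e) es →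
            Call K (Collected i X t es) (length es)
  collect i X t [] [] = return ⊥ λ M k → ((λ e∈ → ⊥-elim (∉⊥ e∈)) , λ ()) , z≤n
  collect {K} i X t (e ∷ es) (t∉ ∷ ts) = branch-span i (X e) (t e) t∉
    (bind (collect i X t es ts) λ W → return (W ⊕ e) λ M ((_ , ¬c) , (f , g)) →
      ((λ x∈ → [ (λ p → let a , b = f p in there a , b) , (λ { refl → here refl , ¬c }) ]′ (∪-∈⁻ W e x∈))
      , λ { (here refl) x∉ → ⊥-elim (x∉ (∪-∈ʳ W e)) ; (there i) x∉ → g i (x∉ ∘ ∪-∈ˡ e) }) , z≤n)
    (bind (collect i X t es ts) λ W → return W λ M ((_ , c) , (f , g)) →
      ((λ x∈ → let a , b = f x∈ in there a , b)
      , λ { (here refl) _ → c ; (there i) x∉ → g i x∉ }) , z≤n)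

-- Double counting for neighbour lists of bounded load

∑-cong : ∀ {n} {f g : Fin n → ℕ} → (∀ i → f i ≡ g i) → ∑ f ≡ ∑ g
∑-cong {zero} e = refl
∑-cong {suc n} e = cong₂ _+_ (e zero) (∑-cong (e ∘ suc))

∑-swap : ∀ {m n} (f : Fin m → Fin n → ℕ) → ∑ (λ i → ∑ (λ j → f i j)) ≡ ∑ (λ j → ∑ (λ i → f i j))
∑-swap {zero} {n} f = sym (trans (∑-const n 0) (*-zeroʳ n))
∑-swap {suc m} f = trans (cong (∑ (f zero) +_) (∑-swap (f ∘ suc))) (sym (∑-+ (f zero) _))

drop-* : ∀ k {x x′} → suc x′ ≤ x → k + k * x′ ≤ k * x
drop-* k {x} {x′} le = ≤-trans (≤-reflexive (sym (*-suc k x′))) (*-monoʳ-≤ k le)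

module Loads {n : ℕ} (L : Fin n → Subset n) (R : Subset n) where

  live? : ∀ u v → Dec (v ∈ L u × v ∉ R)
  live? u v = v ∈? L u ×-dec ¬? (v ∈? R)

  live : Fin n → Subset n
  live u = ⟦ live? u ⟧

  load : Fin n → ℕ
  load v = ∑ (λ u → 𝟙 (L u) v)

  total : ℕ
  total = ∑ (λ u → ∣ L u ∣)

  module _ {h} (cap : ∀ u → ∣ live u ∣ ≤ h) where

    private
      ∑live : ∑ (λ u → ∑ (𝟙 (live u))) ≤ n * h
      ∑live = ≤-trans (∑-mono (λ u → ≤-trans (≤-reflexive (∑𝟙 (live u))) (cap u))) (≤-reflexive (∑-const n h))

      weighted : ∀ Y → ∑ (λ v → 𝟙 Y v * load v) ≡ ∑ (λ u → ∑ (λ v → 𝟙 Y v * 𝟙 (L u) v))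
      weighted Y = trans (∑-cong λ v → sym (∑-*ˡ (𝟙 Y v) (λ u → 𝟙 (L u) v))) (∑-swap (λ v u → 𝟙 Y v * 𝟙 (L u) v))

      𝟙*-mono : ∀ (Y : Subset n) v {a b} → (v ∈ Y → a ≤ b) → 𝟙 Y v * a ≤ 𝟙 Y v * b
      𝟙*-mono Y v le with v ∈? Y
      ... | yes p = *-monoʳ-≤ 1 (le p)
      ... | no _ = z≤n

      ∑𝟙* : ∀ (Y : Subset n) a → ∑ (λ v → 𝟙 Y v * a) ≡ ∣ Y ∣ * a
      ∑𝟙* Y a = trans (∑-cong λ v → *-comm (𝟙 Y v) a) (trans (∑-*ˡ a (𝟙 Y)) (trans (*-comm a _) (cong (_* a) (∑𝟙 Y))))

    -- Entries are split by whether `v` is visited: each list holds at most `h` live ones, and each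
    -- visited `v` occurs at most `c` times.
    total-bound : ∀ {c} → (∀ v → load v ≤ c) → total ≤ n * h + ∣ R ∣ * c
    total-bound {c} ld = begin
      ∑ (λ u → ∣ L u ∣) ≤⟨ ∑-mono (λ u → ≤-trans (≤-reflexive (sym (∑𝟙 (L u)))) (∑-mono (pt u))) ⟩
      ∑ (λ u → ∑ (λ v → 𝟙 (live u) v + 𝟙 R v * 𝟙 (L u) v)) ≤⟨ ∑-mono (λ u → ≤-reflexive (∑-+ (𝟙 (live u)) (λ v → 𝟙 R v * 𝟙 (L u) v))) ⟩
      ∑ (λ u → ∑ (𝟙 (live u)) + ∑ (λ v → 𝟙 R v * 𝟙 (L u) v)) ≡⟨ ∑-+ (λ u → ∑ (𝟙 (live u))) _ ⟩
      ∑ (λ u → ∑ (𝟙 (live u))) + ∑ (λ u → ∑ (λ v → 𝟙 R v * 𝟙 (L u) v)) ≡⟨ cong (∑ (λ u → ∑ (𝟙 (live u))) +_) (weighted R) ⟨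
      ∑ (λ u → ∑ (𝟙 (live u))) + ∑ (λ v → 𝟙 R v * load v) ≤⟨ +-mono-≤ ∑live (∑-mono (λ v → 𝟙*-mono R v (λ _ → ld v))) ⟩
      n * h + ∑ (λ v → 𝟙 R v * c) ≡⟨ cong (n * h +_) (∑𝟙* R c) ⟩
      n * h + ∣ R ∣ * c ∎
      where
      open ≤-Reasoning
      pt : ∀ u v → 𝟙 (L u) v ≤ 𝟙 (live u) v + 𝟙 R v * 𝟙 (L u) v
      pt u v with v ∈? L u | v ∈? R
      ... | no _ | _ = z≤n
      ... | yes p | yes _ = m≤n+m 1 _
      ... | yes p | no q = ≤-reflexive (sym (trans (+-identityʳ _) (𝟙-∈ (∈⟦⟧⁺ (live? u) (p , q)))))

    -- A saturated unvisited `v` accounts for `c` live entries, and there are at most `n * h` of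
    -- these.
    saturated-bound : ∀ {c Z} → (∀ {v} → v ∈ Z → v ∉ R × c ≤ load v) → ∣ Z ∣ * c ≤ n * h
    saturated-bound {c} {Z} sat = begin
      ∣ Z ∣ * c ≡⟨ ∑𝟙* Z c ⟨
      ∑ (λ v → 𝟙 Z v * c) ≤⟨ ∑-mono (λ v → 𝟙*-mono Z v (λ p → proj₂ (sat p))) ⟩
      ∑ (λ v → 𝟙 Z v * load v) ≡⟨ weighted Z ⟩
      ∑ (λ u → ∑ (λ v → 𝟙 Z v * 𝟙 (L u) v)) ≤⟨ ∑-mono (λ u → ∑-mono (pt u)) ⟩
      ∑ (λ u → ∑ (𝟙 (live u))) ≤⟨ ∑live ⟩
      n * h ∎
      where
      open ≤-Reasoning
      pt : ∀ u v → 𝟙 Z v * 𝟙 (L u) v ≤ 𝟙 (live u) v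
      pt u v with v ∈? Z | v ∈? L u
      ... | no _ | _ = z≤n
      ... | yes _ | no _ = z≤n
      ... | yes p | yes q = ≤-reflexive (sym (𝟙-∈ (∈⟦⟧⁺ (live? u) (q , proj₁ (sat p)))))

module _ {n : ℕ} (L : Fin n → Subset n) (R : Subset n) (u v : Fin n) where
  private
    L′ = update L u (L u ⊕ v)
    module O = Loads L R
    module N = Loads L′ R

  L′-view : ∀ {e x} → x ∈ L′ e → x ∈ L e ⊎ (e ≡ u × x ≡ v)
  L′-view {e} x∈ with e Fin.≟ u
  ... | no _ = inj₁ x∈
  ... | yes refl = [ inj₁ , (λ q → inj₂ (refl , q)) ]′ (∪-∈⁻ (L u) v x∈)

  L⊆L′ : ∀ {e} → L e ⊆ L′ e
  L⊆L′ {e} x∈ with e Fin.≟ u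
  ... | no _ = x∈
  ... | yes refl = ∪-∈ˡ v x∈

  load-add : ∀ {c} → (∀ w → O.load w ≤ c) → O.load v < c → ∀ w → N.load w ≤ c
  load-add {c} ld lt w with w Fin.≟ v
  ... | yes refl = ≤-trans (∑-mono le) (≤-trans (≤-reflexive (trans (∑-+ (λ e → 𝟙 (L e) v) (𝟙 ⁅ u ⁆)) (trans (cong (O.load v +_) (trans (∑𝟙 ⁅ u ⁆) (∣⁅x⁆∣≡1 u))) (+-comm _ 1)))) lt)
    where
    le : ∀ e → 𝟙 (L′ e) v ≤ 𝟙 (L e) v + 𝟙 ⁅ u ⁆ e
    le e with e Fin.≟ u
    ... | no _ = m≤m+n _ _
    ... | yes refl = ≤-trans (𝟙≤1 (L u ⊕ v) v) (≤-trans (≤-reflexive (sym (𝟙-∈ (x∈⁅x⁆ u)))) (m≤n+m _ _))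
  ... | no ne = ≤-trans (∑-mono le) (ld w)
    where
    le : ∀ e → 𝟙 (L′ e) w ≤ 𝟙 (L e) w
    le e with w ∈? L′ e
    ... | no _ = z≤n
    ... | yes p with L′-view p
    ... | inj₁ q = ≤-reflexive (sym (𝟙-∈ q))
    ... | inj₂ (_ , q) = ⊥-elim (ne q)

  live-add : ∀ {h} → (∀ e → ∣ O.live e ∣ ≤ h) → ∣ O.live u ∣ < h → ∀ e → ∣ N.live e ∣ ≤ h
  live-add {h} cap lt e = go (e Fin.≟ u)
   where
   go : Dec (e ≡ u) → ∣ N.live e ∣ ≤ h
   go (no ne) = ≤-trans (p⊆q⇒∣p∣≤∣q∣ sub) (cap e)
    where
    sub : N.live e ⊆ O.live e
    sub x∈ with ∈⟦⟧⁻ (N.live? e) x∈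
    ... | p , q with L′-view p
    ... | inj₁ r = ∈⟦⟧⁺ (O.live? e) (r , q)
    ... | inj₂ (r , _) = ⊥-elim (ne r)
   go (yes refl) = ≤-trans (card-⊎ {Y = O.live u} {⁅ v ⁆} sub) (≤-trans (≤-reflexive (trans (cong (∣ O.live u ∣ +_) (∣⁅x⁆∣≡1 v)) (+-comm _ 1))) lt)
    where
    sub : ∀ {x} → x ∈ N.live u → x ∈ O.live u ⊎ x ∈ ⁅ v ⁆
    sub x∈ with ∈⟦⟧⁻ (N.live? u) x∈
    ... | p , q with L′-view p
    ... | inj₁ r = inj₁ (∈⟦⟧⁺ (O.live? u) (r , q))
    ... | inj₂ (_ , refl) = inj₂ (x∈⁅x⁆ v)

  total-add : v ∉ L u → O.total < N.total
  total-add v∉ = ∑-strict u (λ e → p⊆q⇒∣p∣≤∣q∣ L⊆L′) (subst (λ X → ∣ L u ∣ < ∣ X ∣) (sym (update-≡ L u _)) (∣∪⁅⁆∣> v∉))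

-- A single augmentation.  For every u ∉ S some out-neighbours L u are listed, until either the list
-- is complete or h of its elements are unvisited; every v occurs in at most c lists, so few elements
-- are saturated.  A round searches backwards from the sinks and the incomplete u, through complete u
-- only; reaching an incomplete u adds h new elements to the set R of visited elements.
module Reach {n : ℕ} (S src snk : Subset n) (ℓ h c z m₀ : ℕ)
  (1≤h : 1 ≤ h) (1≤c : 1 ≤ c) (z-bound : n * h ≤ z * c) (m₀-bound : ∣ S ∣ ≤ h * m₀) where
  open Shorten S ℓ

  maxLength : ℕ
  maxLength = suc ∣ S ∣ * suc m₀

  record Pre (M : Inst n) : Set where
    field
      common : Common S M
      size : maxLength ≤ 2 ^ ℓ
      src⁻ : ∀ {u} → u ∈ src → u ∉ S × ¬ Span one M S u
      src⁺ : ∀ {u} → u ∉ S → u ∉ src → Span one M S u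
      snk⁻ : ∀ {u} → u ∈ snk → u ∉ S × ¬ Span two M S u
      snk⁺ : ∀ {u} → u ∉ S → u ∉ snk → Span two M S u

  record Outer : Set where
    constructor outer
    field
      R : Subset n
      back : Fin n → Fin n × List (Fin n × Fin n)
      L : Fin n → Subset n
      comp : Subset n
      Z : Fin n → Subset n
      m : ℕ
  open Outer

  record Inner : Set where
    constructor inner
    field
      B : Subset n
      fwd : Fin n → Fin n × List (Fin n × Fin n)
      done : Subset n
  open Inner

  module Ld (o : Outer) = Loads (L o) (R o)

  E₁ E₂ : Inst n → Fin n → Fin n → Set
  E₁ M = Closure.Edge (proj₁ M) S
  E₂ M = Closure.Edge (proj₂ M) S

  Target : Outer → Fin n → Set
  Target o x = x ∈ snk ⊎ x ∉ comp o

  record OInv (o : Outer) (M : Inst n) : Set where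
    field
      pre : Pre M
      R⊆S : R o ⊆ S
      backOk : ∀ {v} → v ∈ R o → E₂ M (proj₁ (back o v)) v × Back (proj₁ (back o v)) (proj₂ (back o v)) M
      -- Each round extends a path by at most `∣ S ∣ + 1` pairs. These are walks that may repeat
      -- vertices.
      backLen : ∀ {v} → v ∈ R o → length (proj₂ (back o v)) + suc ∣ S ∣ * m o ≤ suc ∣ S ∣ * m₀
      m≤m₀ : m o ≤ m₀
      listed : ∀ {u v} → v ∈ L o u ⊎ v ∈ Z o u → E₂ M u v
      -- Edges into visited elements need not be listed, because the backward search set `B` stays
      -- disjoint from `R`.
      complete : ∀ {u v} → u ∈ comp o → u ∉ S → u ∉ snk → v ∈ S → v ∉ R o → v ∉ L o u → v ∉ Z o u →
                 Span two M (del S v) u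
      cap : ∀ u → ∣ Ld.live o u ∣ ≤ h
      loads : ∀ v → Ld.load o v ≤ c
      rounds : ∣ S ∣ ≤ ∣ R o ∣ + h * m o
    open Pre pre public

  Full : Outer → Set
  Full o = ∀ u → u ∉ S → u ∉ snk → u ∉ comp o → h ≤ ∣ Ld.live o u ∣

  data Fwd (o : Outer) (M : Inst n) : Fin n → List (Fin n × Fin n) → Set where
    end : ∀ {x} → x ∉ S → Target o x → Fwd o M x []
    step : ∀ {x v u qs} → E₂ M x v → E₁ M u v → Fwd o M u qs → Fwd o M x ((v , u) ∷ qs)

  record IInv (o : Outer) (i : Inner) (M : Inst n) : Set where
    field
      oinv : OInv o M
      full : Full o
      fwdOk : ∀ {v} → v ∈ B i → E₁ M (proj₁ (fwd i v)) v × Fwd o M (proj₁ (fwd i v)) (proj₂ (fwd i v))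
      fwdLen : ∀ {v} → v ∈ B i → length (proj₂ (fwd i v)) < ∣ B i ∣
      B∩R : ∀ {v} → v ∈ B i → v ∉ R o
      closed : ∀ {u} → u ∈ done i → Span one M (B i) u
    open OInv oinv public

  extend : Fin n → List (Fin n × Fin n) → List (Fin n × Fin n) → Fin n × List (Fin n × Fin n)
  extend x ps [] = x , ps
  extend x ps ((v , u) ∷ qs) = extend u ((v , x) ∷ ps) qs

  extend-ok : ∀ {o M} x ps qs → Back x ps M → Fwd o M x qs → let w , rs = extend x ps qs in
              Back w rs M × w ∉ S × Target o w × length rs ≡ length ps + length qs
  extend-ok x ps [] b (end x∉ t) = b , x∉ , t , sym (+-identityʳ _)
  extend-ok x ps ((v , u) ∷ qs) b (step e₂ e₁ f) =
    let b′ , w∉ , t , len = extend-ok u ((v , x) ∷ ps) qs (BackPath.step e₁ e₂ b) f in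
    b′ , w∉ , t , trans len (sym (+-suc (length ps) (length qs)))

  -- Respectively: all list entries ever made, the queries of one round, and the shortening of the
  -- one path used for augmenting.
  Amax W final : ℕ
  Amax = n * h + ∣ S ∣ * c
  W = 3 + (n + (1 + ℓ) * ∣ S ∣)
  final = maxLength * ℓ + maxLength * ℓ

  -- A new entry pays for a test and a binary search, a completed `u` for a test and up to `z`
  -- single queries, a remaining round for `W`. The potentials built on it are also the fuel of the
  -- recursion.
  pot : Outer → ℕ
  pot o = (1 + ℓ) * (Amax ∸ Ld.total o) + ((1 + z) * (n ∸ ∣ comp o ∣) + W * m o)

  potR : Outer → ℕ
  potR o = pot o + (W + final)

  potS : Outer → Inner → ℕ
  potS o i = pot o + ((1 + ((n ∸ ∣ done i ∣) + (1 + ℓ) * (∣ S ∣ ∸ ∣ B i ∣))) + final)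

  data Outcome : Set where
    better : Subset n → Outcome
    optimal : Outcome

  Post : Outcome → Inst n → Set
  Post (better S′) M = Better S′ M
  Post optimal M = ∀ T → Common T M → ∣ T ∣ ≤ ∣ S ∣

  total≤ : ∀ {o M} → OInv o M → Ld.total o ≤ Amax
  total≤ {o} I = ≤-trans (Ld.total-bound o cap loads) (+-monoʳ-≤ (n * h) (*-monoˡ-≤ c (p⊆q⇒∣p∣≤∣q∣ R⊆S)))
    where open OInv I

  S≤max : ∣ S ∣ ≤ maxLength
  S≤max = ≤-trans (n≤1+n _) (m≤m*n (suc ∣ S ∣) (suc m₀))

  module Refill (o : Outer) (u : Fin n) (u∉S : u ∉ S) (u∉snk : u ∉ snk) (u∉comp : u ∉ comp o)
    (few : ∣ Ld.live o u ∣ < h) where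

    new? : ∀ v → Dec (v ∈ S × v ∉ R o × v ∉ L o u)
    new? v = v ∈? S ×-dec ¬? (v ∈? R o) ×-dec ¬? (v ∈? L o u)
    free? : ∀ v → Dec ((v ∈ S × v ∉ R o × v ∉ L o u) × Ld.load o v < c)
    free? v = new? v ×-dec Ld.load o v <? c
    saturated? : ∀ v → Dec ((v ∈ S × v ∉ R o × v ∉ L o u) × c ≤ Ld.load o v)
    saturated? v = new? v ×-dec c ≤? Ld.load o v

    free saturated : List (Fin n)
    free = elems ⟦ free? ⟧
    saturated = elems ⟦ saturated? ⟧

    added : Fin n → Outer
    added v = record o { L = update (L o) u (L o u ⊕ v) }

    added-inv : ∀ {v M} → OInv o M → v ∈ ⟦ free? ⟧ → ¬ Span two M (del S v) u → OInv (added v) M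
    added-inv {v} {M} I v∈ ¬c = record
      { pre = pre ; R⊆S = R⊆S ; backOk = backOk ; backLen = backLen ; m≤m₀ = m≤m₀
      ; listed = listed′
      ; complete = λ a b c′ d e f g → complete a b c′ d e (f ∘ L⊆L′ (L o) (R o) u v) g
      ; cap = live-add (L o) (R o) u v cap few
      ; loads = load-add (L o) (R o) u v loads (proj₂ (∈⟦⟧⁻ free? v∈))
      ; rounds = rounds }
      where
      open OInv I
      v∈S = proj₁ (proj₁ (∈⟦⟧⁻ free? v∈))
      listed′ : ∀ {x y} → y ∈ update (L o) u (L o u ⊕ v) x ⊎ y ∈ Z o x → E₂ M x y
      listed′ (inj₂ q) = listed (inj₂ q)
      listed′ (inj₁ p) with L′-view (L o) (R o) u v p
      ... | inj₁ q = listed (inj₁ q)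
      ... | inj₂ (refl , refl) = v∈S , u∉S , snk⁺ u∉S u∉snk , ¬c

    added-pot : ∀ {v M} → OInv o M → OInv (added v) M → v ∈ ⟦ free? ⟧ → (1 + ℓ) + potR (added v) ≤ potR o
    added-pot {v} I I′ v∈ = ≤-trans (≤-reflexive (assoc (1 + ℓ) ((1 + ℓ) * (Amax ∸ Ld.total (added v))) _ _))
      (+-monoˡ-≤ _ (+-monoˡ-≤ _ (drop-* (1 + ℓ) (∸-monoʳ-< (total-add (L o) (R o) u v (proj₂ (proj₂ (proj₁ (∈⟦⟧⁻ free? v∈))))) (total≤ I′)))))
      where
      assoc : ∀ k x y w → k + (x + y + w) ≡ k + x + y + w
      assoc = solve-∀

    completed : Subset n → Outer
    completed Q = record o { comp = comp o ⊕ u ; Z = update (Z o) u Q }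

    completed-inv : ∀ {Q M} → OInv o M → Span two M (S ∖ free) u →
      Collected two (del S) (λ _ → u) saturated Q M → OInv (completed Q) M
    completed-inv {Q} {M} I cF (col , col′) = record
      { pre = pre ; R⊆S = R⊆S ; backOk = backOk ; backLen = backLen ; m≤m₀ = m≤m₀
      ; listed = listed′ ; complete = complete′ ; cap = cap ; loads = loads ; rounds = rounds }
      where
      open OInv I
      listed′ : ∀ {x y} → y ∈ L o x ⊎ y ∈ update (Z o) u Q x → E₂ M x y
      listed′ (inj₁ p) = listed (inj₁ p)
      listed′ {x} (inj₂ q) with x Fin.≟ u
      ... | no _ = listed (inj₂ q)
      ... | yes refl = let i , ¬c = col q in
        proj₁ (proj₁ (∈⟦⟧⁻ saturated? (elems⁻ i))) , u∉S , snk⁺ u∉S u∉snk , ¬c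
      complete′ : ∀ {x v} → x ∈ comp o ⊕ u → x ∉ S → x ∉ snk → v ∈ S → v ∉ R o → v ∉ L o x → v ∉ update (Z o) u Q x →
                  Span two M (del S v) x
      complete′ {x} {v} x∈ x∉S x∉snk v∈ v∉R v∉L v∉Q with x Fin.≟ u | ∪-∈⁻ (comp o) u x∈
      ... | no ne | inj₂ r = ⊥-elim (ne r)
      ... | no ne | inj₁ p = complete p x∉S x∉snk v∈ v∉R v∉L v∉Q
      ... | yes refl | _ with Ld.load o v <? c
      ... | yes lt = Closure.cl-mono (proj₂ M) (λ y∈ → let a , b = ∖-∈⁻ free y∈ in
                del⁺ a λ { refl → b (elems⁺ (∈⟦⟧⁺ free? ((v∈ , v∉R , v∉L) , lt))) }) cF
      ... | no ≮ = col′ (elems⁺ (∈⟦⟧⁺ saturated? ((v∈ , v∉R , v∉L) , ≮⇒≥ ≮))) v∉Q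

    completed-pot : ∀ {Q} → (1 + z) + potR (completed Q) ≤ potR o
    completed-pot {Q} = ≤-trans (≤-reflexive (assoc (1 + z) ((1 + ℓ) * (Amax ∸ Ld.total o)) ((1 + z) * (n ∸ ∣ comp o ⊕ u ∣)) _ _))
      (+-monoˡ-≤ _ (+-monoʳ-≤ ((1 + ℓ) * (Amax ∸ Ld.total o)) (+-monoˡ-≤ _ (drop-* (1 + z) (⊕-card-∸ u∉comp)))))
      where
      assoc : ∀ k x y w t → k + (x + (y + w) + t) ≡ x + (k + y + w) + t
      assoc = solve-∀

    few-saturated : ∀ {M} → OInv o M → length saturated ≤ z
    few-saturated I = ≤-trans (≤-reflexive (length-elems ⟦ saturated? ⟧)) (*-cancelʳ-≤ _ z c {{>-nonZero 1≤c}}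
      (≤-trans (Ld.saturated-bound o (OInv.cap I) (λ v∈ → let (_ , a , _) , b = ∈⟦⟧⁻ saturated? v∈ in a , b)) z-bound))

  module Visit (o : Outer) (x : Fin n) (ps : List (Fin n × Fin n)) where

    visited : ℕ → Outer
    visited m′ = record o { R = R o ∪ L o x ; back = λ v → if does (v ∈? R o) then back o v else (x , ps) ; m = m′ }

    grows : ∣ R o ∣ + ∣ Ld.live o x ∣ ≤ ∣ R o ∪ L o x ∣
    grows = ≤-trans (card-+ {Z = R o ∪ L o x} {⊥} (λ p → x∈p∪q⁺ (inj₁ p)) (λ p → x∈p∪q⁺ (inj₂ (proj₁ (∈⟦⟧⁻ (Ld.live? o x) p))))
        (λ p q → ⊥-elim (proj₂ (∈⟦⟧⁻ (Ld.live? o x) q) p)))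
      (≤-reflexive (trans (cong (∣ R o ∪ L o x ∣ +_) (∣⊥∣≡0 n)) (+-identityʳ _)))

    R∪L⊆S : ∀ {M} → OInv o M → R o ∪ L o x ⊆ S
    R∪L⊆S I v∈ with x∈p∪q⁻ (R o) (L o x) v∈
    ... | inj₁ p = OInv.R⊆S I p
    ... | inj₂ q = proj₁ (OInv.listed I (inj₁ q))

    visited-inv : ∀ {m′ M} → m o ≡ suc m′ → OInv o M → h ≤ ∣ Ld.live o x ∣ → Back x ps M →
                  length ps + suc ∣ S ∣ * m o ≤ maxLength → OInv (visited m′) M
    visited-inv {m′} {M} refl I many b len = record
      { pre = pre ; R⊆S = R∪L⊆S I ; backOk = ok′ ; backLen = len′ ; m≤m₀ = <⇒≤ m≤m₀ ; listed = listed
      ; complete = λ p q r s t → complete p q r s (t ∘ x∈p∪q⁺ ∘ inj₁)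
      ; cap = λ u → ≤-trans (p⊆q⇒∣p∣≤∣q∣ (λ v∈ → let p , q = ∈⟦⟧⁻ (Loads.live? (L o) (R o ∪ L o x) u) v∈ in
          ∈⟦⟧⁺ (Ld.live? o u) (p , q ∘ x∈p∪q⁺ ∘ inj₁))) (cap u)
      ; loads = loads
      ; rounds = ≤-trans rounds (≤-trans (≤-reflexive (trans (cong (∣ R o ∣ +_) (*-suc h m′)) (sym (+-assoc ∣ R o ∣ h _))))
          (+-monoˡ-≤ (h * m′) (≤-trans (+-monoʳ-≤ ∣ R o ∣ many) grows))) }
      where
      open OInv I
      ok′ : ∀ {v} → v ∈ R o ∪ L o x → E₂ M (proj₁ (back (visited m′) v)) v × Back (proj₁ (back (visited m′) v)) (proj₂ (back (visited m′) v)) M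
      ok′ {v} v∈ with v ∈? R o
      ... | yes p = backOk p
      ... | no p = listed (inj₁ ([ (λ q → ⊥-elim (p q)) , id ]′ (x∈p∪q⁻ (R o) (L o x) v∈))) , b
      len′ : ∀ {v} → v ∈ R o ∪ L o x → length (proj₂ (back (visited m′) v)) + suc ∣ S ∣ * m′ ≤ suc ∣ S ∣ * m₀
      len′ {v} v∈ with v ∈? R o
      ... | yes p = ≤-trans (+-monoʳ-≤ (length (proj₂ (back o v))) (*-monoʳ-≤ (suc ∣ S ∣) (n≤1+n m′))) (backLen p)
      ... | no p = +-cancelˡ-≤ (suc ∣ S ∣) _ _ (≤-trans (≤-reflexive (trans (swap (suc ∣ S ∣) (length ps) _) (cong (length ps +_) (sym (*-suc (suc ∣ S ∣) m′)))))
              (≤-trans len (≤-reflexive (*-suc (suc ∣ S ∣) m₀))))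
        where
        swap : ∀ a b d → a + (b + d) ≡ b + (a + d)
        swap = solve-∀

  module SearchStep (o : Outer) (i : Inner) where

    reaching? : ∀ u → Dec (Target o u ⊎ ∃[ v ] v ∈ B i × (v ∈ L o u ⊎ v ∈ Z o u))
    reaching? u = (u ∈? snk ⊎-dec ¬? (u ∈? comp o)) ⊎-dec any? (λ v → v ∈? B i ×-dec (v ∈? L o u ⊎-dec v ∈? Z o u))

    onward : ∀ {u} → Target o u ⊎ (∃[ v ] v ∈ B i × (v ∈ L o u ⊎ v ∈ Z o u)) → List (Fin n × Fin n)
    onward (inj₁ _) = []
    onward (inj₂ (v , _)) = (v , proj₁ (fwd i v)) ∷ proj₂ (fwd i v)

    onward-ok : ∀ {u M} (r : Target o u ⊎ (∃[ v ] v ∈ B i × (v ∈ L o u ⊎ v ∈ Z o u))) → IInv o i M → u ∉ S →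
                Fwd o M u (onward r) × length (onward r) ≤ ∣ B i ∣
    onward-ok (inj₁ t) I u∉ = end u∉ t , z≤n
    onward-ok (inj₂ (v , v∈B , l)) I u∉ = let open IInv I ; e , f = fwdOk v∈B in step (listed l) e f , fwdLen v∈B

    B⊆S : ∀ {M} → IInv o i M → B i ⊆ S
    B⊆S I v∈ = proj₁ (proj₁ (IInv.fwdOk I v∈))

    rest? : ∀ v → Dec (v ∈ S × v ∉ B i)
    rest? v = v ∈? S ×-dec ¬? (v ∈? B i)

    rest : List (Fin n)
    rest = elems ⟦ rest? ⟧

    -- The cut at the end of a failed search: `B` and the outside elements reaching it are spanned
    -- by `B` in `M₁`; the others have no `M₂` edge into `B`, so `S` without `B` spans them in `M₂`.
    optimal-ok : ∀ {M} → IInv o i M → (∀ u → u ∉ S → Target o u ⊎ (∃[ v ] v ∈ B i × (v ∈ L o u ⊎ v ∈ Z o u)) → u ∈ done i) →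
                 Post optimal M
    optimal-ok {M} I all T ci = ≤-trans (cut-bound (proj₁ M) (proj₂ M) X? (downward (proj₁ M) (B⊆S I) (proj₁ common))
        (downward (proj₂ M) (λ v∈ → proj₁ (∈⟦⟧⁻ rest? v∈)) (proj₂ common)) ci c₁ c₂)
      (≤-trans (card-+ {Z = S} {⊥} (B⊆S I) (λ v∈ → proj₁ (∈⟦⟧⁻ rest? v∈)) (λ p q → ⊥-elim (proj₂ (∈⟦⟧⁻ rest? q) p)))
        (≤-reflexive (trans (cong (∣ S ∣ +_) (∣⊥∣≡0 n)) (+-identityʳ _))))
      where
      open IInv I
      X? : ∀ e → Dec (e ∈ B i ⊎ (e ∉ S × (Target o e ⊎ ∃[ v ] v ∈ B i × (v ∈ L o e ⊎ v ∈ Z o e))))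
      X? e = e ∈? B i ⊎-dec (¬? (e ∈? S) ×-dec reaching? e)
      c₁ : ∀ e → e ∈ B i ⊎ (e ∉ S × (Target o e ⊎ ∃[ v ] v ∈ B i × (v ∈ L o e ⊎ v ∈ Z o e))) → Span one M (B i) e
      c₁ e (inj₁ p) = inj₁ p
      c₁ e (inj₂ (p , r)) = closed (all e p r)
      c₂ : ∀ e → ¬ (e ∈ B i ⊎ (e ∉ S × (Target o e ⊎ ∃[ v ] v ∈ B i × (v ∈ L o e ⊎ v ∈ Z o e)))) → Span two M ⟦ rest? ⟧ e
      c₂ e ¬x with e ∈? S
      ... | yes p = inj₁ (∈⟦⟧⁺ rest? (p , ¬x ∘ inj₁))
      ... | no p = Closure.cl-mono (proj₂ M) (λ v∈ → let a , b = ∖-∈⁻ (elems (B i)) v∈ in ∈⟦⟧⁺ rest? (a , b ∘ elems⁺))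
              (Closure.cl-∖ (proj₂ M) (elems (B i)) (proj₂ common) (snk⁺ p e∉snk) (All.tabulate λ j →
                let v∈B = elems⁻ j in B⊆S I v∈B , complete e∈comp p e∉snk (B⊆S I v∈B) (B∩R v∈B)
                  (λ l → ¬r (inj₂ (_ , v∈B , inj₁ l))) (λ l → ¬r (inj₂ (_ , v∈B , inj₂ l)))))
        where
        ¬r : ¬ (Target o e ⊎ ∃[ v ] v ∈ B i × (v ∈ L o e ⊎ v ∈ Z o e))
        ¬r r = ¬x (inj₂ (p , r))
        e∉snk : e ∉ snk
        e∉snk q = ¬r (inj₁ (inj₁ q))
        e∈comp : e ∈ comp o
        e∈comp = decidable-stable (e ∈? comp o) λ q → ¬r (inj₁ (inj₂ q))

    closed-inv : ∀ {u M} → IInv o i M → Span one M (B i) u → IInv o (record i { done = done i ⊕ u }) M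
    closed-inv {u} I c = record
      { oinv = oinv ; full = full ; fwdOk = fwdOk ; fwdLen = fwdLen ; B∩R = B∩R
      ; closed = λ x∈ → [ closed , (λ { refl → c }) ]′ (∪-∈⁻ (done i) u x∈) }
      where open IInv I

    found-inv : ∀ {u v qs M} → IInv o i M → E₁ M u v → Fwd o M u qs → length qs ≤ ∣ B i ∣ → v ∉ R o → v ∉ B i →
                IInv o (record i { B = B i ⊕ v ; fwd = update (fwd i) v (u , qs) }) M
    found-inv {u} {v} {qs} {M} I e f len v∉R v∉B = record
      { oinv = oinv ; full = full ; fwdOk = ok′ ; fwdLen = len′
      ; B∩R = λ x∈ → [ B∩R , (λ { refl → v∉R }) ]′ (∪-∈⁻ (B i) v x∈)
      ; closed = λ x∈ → Closure.cl-mono (proj₁ M) (∪-∈ˡ v) (closed x∈) }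
      where
      open IInv I
      ok′ : ∀ {x} → x ∈ B i ⊕ v → E₁ M (proj₁ (update (fwd i) v (u , qs) x)) x
              × Fwd o M (proj₁ (update (fwd i) v (u , qs) x)) (proj₂ (update (fwd i) v (u , qs) x))
      ok′ {x} x∈ with x Fin.≟ v | ∪-∈⁻ (B i) v x∈
      ... | yes refl | _ = e , f
      ... | no ne | inj₁ p = fwdOk p
      ... | no ne | inj₂ r = ⊥-elim (ne r)
      len′ : ∀ {x} → x ∈ B i ⊕ v → length (proj₂ (update (fwd i) v (u , qs) x)) < ∣ B i ⊕ v ∣
      len′ {x} x∈ with x Fin.≟ v | ∪-∈⁻ (B i) v x∈
      ... | yes refl | _ = ≤-trans (s≤s len) (∣∪⁅⁆∣> v∉B)
      ... | no ne | inj₁ p = ≤-trans (fwdLen p) (<⇒≤ (∣∪⁅⁆∣> v∉B))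
      ... | no ne | inj₂ r = ⊥-elim (ne r)

    potS⁻ : ℕ
    potS⁻ = pot o + (((n ∸ ∣ done i ∣) + (1 + ℓ) * (∣ S ∣ ∸ ∣ B i ∣)) + final)

    potS⁻< : suc potS⁻ ≤ potS o i
    potS⁻< = ≤-reflexive (sym (+-suc (pot o) _))

    closed-pot : ∀ {u} → u ∉ done i → potS o (record i { done = done i ⊕ u }) ≤ potS⁻
    closed-pot u∉ = +-monoʳ-≤ (pot o) (+-monoˡ-≤ final (+-monoˡ-≤ _ (⊕-card-∸ u∉)))

    found-pot : ∀ {v M} {f} → IInv o i M → v ∈ S → v ∉ B i →
                ℓ + potS o (record i { B = B i ⊕ v ; fwd = f }) ≤ potS⁻
    found-pot {v} I v∈ v∉ = ≤-trans (≤-reflexive (assoc ℓ (pot o) (n ∸ ∣ done i ∣) ((1 + ℓ) * (∣ S ∣ ∸ ∣ B i ⊕ v ∣)) final))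
      (+-monoʳ-≤ (pot o) (+-monoˡ-≤ final (+-monoʳ-≤ (n ∸ ∣ done i ∣)
        (drop-* (1 + ℓ) (∸-monoʳ-< (∣∪⁅⁆∣> v∉) (p⊆q⇒∣p∣≤∣q∣ (⊕-⊆ (B⊆S I) v∈)))))))
      where
      assoc : ∀ l p x y t → l + (p + ((1 + (x + y)) + t)) ≡ p + ((x + (1 + l + y)) + t)
      assoc = solve-∀

    finish-pot : ∀ {v M} → IInv o i M → v ∈ S → v ∉ B i → ℓ + (pot o + final) ≤ potS⁻
    finish-pot {v} I v∈ v∉ = ≤-trans (+-monoʳ-≤ ℓ (+-monoʳ-≤ (pot o) (m≤n+m final (1 + ((n ∸ ∣ done i ∣) + (1 + ℓ) * (∣ S ∣ ∸ ∣ B i ⊕ v ∣)))))) (found-pot {f = fwd i} I v∈ v∉)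

    rest-side : ∀ {u M} → IInv o i M → ¬ Span one M (B i) u →
                length rest ≤ 2 ^ ℓ × All (λ v → v ∈ S) rest × ¬ Span one M (S ∖ map id rest) u
    rest-side {u} {M} I ¬c =
      ≤-trans (≤-reflexive (length-elems ⟦ rest? ⟧)) (≤-trans (p⊆q⇒∣p∣≤∣q∣ (λ x∈ → proj₁ (∈⟦⟧⁻ rest? x∈))) (≤-trans S≤max (IInv.size I)))
      , All.tabulate (λ j → proj₁ (∈⟦⟧⁻ rest? (elems⁻ j)))
      , λ c → ¬c (Closure.cl-mono (proj₁ M) (λ {x} x∈ → let p , q = ∖-∈⁻ (map id rest) x∈ in
          decidable-stable (x ∈? B i) λ x∉ → q (subst (x ∈ₗ_) (sym (List.map-id rest)) (elems⁺ (∈⟦⟧⁺ rest? (p , x∉))))) c)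

  private
    ℓ≤final : ℓ ≤ final
    ℓ≤final = ≤-trans (m≤m+n ℓ _) (m≤m+n (maxLength * ℓ) (maxLength * ℓ))

  Finishing : Outer → Fin n → List (Fin n × Fin n) → Inst n → Set
  Finishing o x ps M = (OInv o M × Full o) × (Back x ps M × x ∉ S × Target o x) × length ps + suc ∣ S ∣ * m o ≤ maxLength

  mutual
    refill : ∀ f o → Call (λ M → OInv o M × potR o < f) Post (potR o)
    refill zero o = return optimal λ M ()
    refill (suc f) o with any? (λ u → ¬? (u ∈? S) ×-dec ¬? (u ∈? snk) ×-dec ¬? (u ∈? comp o) ×-dec ∣ Ld.live o u ∣ <? h)
    ... | no none = weaken (search f o start) λ M (I , b) →
        (record { oinv = I ; full = λ u p q r → ≮⇒≥ λ s → none (u , p , q , r , s)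
                ; fwdOk = λ x∈ → ⊥-elim (∉⊥ x∈) ; fwdLen = λ x∈ → ⊥-elim (∉⊥ x∈) ; B∩R = λ x∈ → ⊥-elim (∉⊥ x∈)
                ; closed = λ x∈ → ⊥-elim (∉⊥ x∈) } , ≤-trans smaller (s≤s⁻¹ b)) , <⇒≤ smaller
      where
      start : Inner
      start = inner ⊥ (λ v → v , []) ⊥
      smaller : suc (potS o start) ≤ potR o
      smaller = ≤-trans (≤-reflexive (sym (+-suc (pot o) _))) (+-monoʳ-≤ (pot o) (+-monoˡ-≤ final
        (s≤s (s≤s (≤-trans (+-mono-≤ (m∸n≤m n ∣ ⊥ {n} ∣) (*-monoʳ-≤ (1 + ℓ) (m∸n≤m ∣ S ∣ ∣ ⊥ {n} ∣))) (n≤1+n _))))))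
    ... | yes (u , u∉S , u∉snk , u∉comp , few) =
      weaken (branch-span two (S ∖ free) u (u∉S ∘ ∖-⊆ S free)
        (weaken (bind (frame (b ∸ ℓ) (find id two S u u∉S ℓ free K K⇒ side)) continue)
          λ M k → k , ≤-reflexive (m+[n∸m]≡n ℓ≤b))
        (weaken (call (collect two (del S) (λ _ → u) saturated (All.universal (λ _ → u∉S ∘ del-⊆) saturated)) λ Q →
            weaken (refill f (completed Q)) λ M (((I , lt) , c) , col) →
              (completed-inv I c col , ≤-trans (≤-trans (s≤s (m≤n+m _ z)) (completed-pot {Q})) (s≤s⁻¹ lt))
              , ≤-trans (≤-reflexive (sym (m+n∸m≡n z _))) (∸-monoˡ-≤ z (∸-monoˡ-≤ 1 (completed-pot {Q}))))
          λ M k → k , ≤-trans (+-monoˡ-≤ (b ∸ z) (few-saturated (proj₁ (proj₁ k)))) (≤-reflexive (m+[n∸m]≡n z≤b))))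
      λ M k → k , ≤-reflexive (m+[n∸m]≡n 1≤potR)
      where
      open Refill o u u∉S u∉snk u∉comp few
      b : ℕ
      b = potR o ∸ 1
      1+ℓ≤potR : suc ℓ ≤ potR o
      1+ℓ≤potR = ≤-trans (+-mono-≤ (s≤s (z≤n {2 + (n + (1 + ℓ) * ∣ S ∣)})) ℓ≤final) (m≤n+m (W + final) (pot o))
      1≤potR : 1 ≤ potR o
      1≤potR = ≤-trans (s≤s z≤n) 1+ℓ≤potR
      ℓ≤b : ℓ ≤ b
      ℓ≤b = ∸-monoˡ-≤ 1 1+ℓ≤potR
      z≤b : z ≤ b
      z≤b = ∸-monoˡ-≤ 1 (≤-trans (m≤m+n (suc z) _) (completed-pot {⊥}))
      K : Inst n → Set
      K M = (OInv o M × potR o < suc f) × ¬ Span two M (S ∖ free) u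
      K⇒ : ∀ {M} → K M → ⟪ two ⟫ M S × Span two M S u
      K⇒ ((I , _) , _) = proj₂ (OInv.common I) , OInv.snk⁺ I u∉S u∉snk
      side : ∀ {M} → K M → length free ≤ 2 ^ ℓ × All (λ v → v ∈ S) free × ¬ Span two M (S ∖ map id free) u
      side {M} ((I , _) , ¬c) =
        ≤-trans (≤-reflexive (length-elems ⟦ free? ⟧)) (≤-trans (p⊆q⇒∣p∣≤∣q∣ (λ x∈ → proj₁ (proj₁ (∈⟦⟧⁻ free? x∈)))) (≤-trans S≤max (OInv.size I)))
        , All.tabulate (λ j → proj₁ (proj₁ (∈⟦⟧⁻ free? (elems⁻ j))))
        , subst (λ xs → ¬ Span two M (S ∖ xs) u) (sym (List.map-id free)) ¬c
      continue : ∀ s → Call (λ M → K M × BinarySearch.Found id two S u u∉S K K⇒ free s M) Post (b ∸ ℓ)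
      continue [] = return optimal λ M ()
      continue (v ∷ post) = weaken (refill f (added v)) λ M (((I , lt) , _) , ((pre , eq) , ¬c , _)) →
        let v∈ = elems⁻ (subst (v ∈ₗ_) (sym eq) (∈-++⁺ʳ pre (here refl)))
            I′ = added-inv I v∈ ¬c
            le = added-pot I I′ v∈ in
        (I′ , ≤-trans (≤-trans (s≤s (m≤n+m _ ℓ)) le) (s≤s⁻¹ lt))
        , ≤-trans (≤-reflexive (sym (m+n∸m≡n ℓ _))) (∸-monoˡ-≤ ℓ (∸-monoˡ-≤ 1 le))

    search : ∀ f o i → Call (λ M → IInv o i M × potS o i < f) Post (potS o i)
    search zero o i = return optimal λ M ()
    search (suc f) o i with any? (λ u → ¬? (u ∈? S) ×-dec ¬? (u ∈? done i) ×-dec SearchStep.reaching? o i u)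
    ... | no none = return optimal λ M (I , _) → SearchStep.optimal-ok o i I
          (λ u u∉ r → decidable-stable (u ∈? done i) λ u∉d → none (u , u∉ , u∉d , r)) , z≤n
    ... | yes (u , u∉S , u∉d , r) with u ∈? src
    ... | yes u∈src = weaken (finish f o (proj₁ path) (proj₂ path)) λ M (I , b) →
            let open IInv I ; g , len = onward-ok r I u∉S
                bk , w∉ , t , eq = extend-ok u [] (onward r) (BackPath.source u∉S (proj₂ (src⁻ u∈src))) g in
            (((oinv , full) , (bk , w∉ , t) , (≤-trans (+-mono-≤ (≤-trans (≤-reflexive eq) (≤-trans len (p⊆q⇒∣p∣≤∣q∣ (B⊆S I)))) (*-monoʳ-≤ (suc ∣ S ∣) m≤m₀))
              (≤-trans (n≤1+n _) (≤-reflexive (sym (*-suc (suc ∣ S ∣) m₀))))))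
            , ≤-trans (≤-trans (s≤s skip) potS⁻<) (s≤s⁻¹ b)) , ≤-trans skip (≤-trans (n≤1+n _) potS⁻<)
          where
          open SearchStep o i
          path = extend u [] (onward r)
          skip : pot o + final ≤ potS⁻
          skip = +-monoʳ-≤ (pot o) (m≤n+m final ((n ∸ ∣ done i ∣) + (1 + ℓ) * (∣ S ∣ ∸ ∣ B i ∣)))
    ... | no u∉src with u ∈? B i
    ... | yes bad = return optimal λ M (I , _) → ⊥-elim (u∉S (SearchStep.B⊆S o i I bad)) , z≤n
    ... | no u∉B =
      weaken (branch-span one (B i) u u∉B
        (weaken (bind (frame (potS⁻ ∸ ℓ) (find id one S u u∉S ℓ rest K K⇒ (λ ((I , _) , ¬c) → rest-side I ¬c))) continue)
          λ M k → k , ≤-reflexive (m+[n∸m]≡n (≤-trans ℓ≤final (≤-trans (m≤n+m final ((n ∸ ∣ done i ∣) + (1 + ℓ) * (∣ S ∣ ∸ ∣ B i ∣))) (m≤n+m _ (pot o))))))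
        (weaken (search f o (record i { done = done i ⊕ u })) λ M ((I , b) , c) →
          (closed-inv I c , ≤-trans (s≤s (closed-pot u∉d)) (≤-trans potS⁻< (s≤s⁻¹ b))) , closed-pot u∉d))
      λ M k → k , potS⁻<
      where
      open SearchStep o i
      K : Inst n → Set
      K M = (IInv o i M × potS o i < suc f) × ¬ Span one M (B i) u
      K⇒ : ∀ {M} → K M → ⟪ one ⟫ M S × Span one M S u
      K⇒ ((I , _) , _) = proj₁ (IInv.common I) , IInv.src⁺ I u∉S u∉src
      continue : ∀ s → Call (λ M → K M × BinarySearch.Found id one S u u∉S K K⇒ rest s M) Post (potS⁻ ∸ ℓ)
      continue [] = return optimal λ M ()
      continue (v ∷ post) with v ∈? R o
      ... | no v∉R = weaken (search f o (record i { B = B i ⊕ v ; fwd = update (fwd i) v (u , onward r) })) λ M (k@((I , b) , _) , ((pre , eq) , ¬c , _)) →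
        let v∈ , v∉ = ∈⟦⟧⁻ rest? (elems⁻ (subst (v ∈ₗ_) (sym eq) (∈-++⁺ʳ pre (here refl))))
            g , len = onward-ok r I u∉S
            le = found-pot {f = update (fwd i) v (u , onward r)} I v∈ v∉ in
        (found-inv I (v∈ , u∉S , proj₂ (K⇒ k) , ¬c) g len v∉R v∉ , ≤-trans (s≤s (≤-trans (m≤n+m _ ℓ) le)) (≤-trans potS⁻< (s≤s⁻¹ b)))
        , ≤-trans (≤-reflexive (sym (m+n∸m≡n ℓ _))) (∸-monoˡ-≤ ℓ le)
      -- Here the two searches meet: the stored path from a source to `v` is continued by the path
      -- from `u` to its target.
      ... | yes v∈R = weaken (finish f o (proj₁ path) (proj₂ path)) λ M (k@((I , b) , _) , ((front , eq) , ¬c , _)) →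
        let open IInv I
            v∈ , v∉ = ∈⟦⟧⁻ rest? (elems⁻ (subst (v ∈ₗ_) (sym eq) (∈-++⁺ʳ front (here refl))))
            g , len = onward-ok r I u∉S
            e₂ , bk₀ = backOk v∈R
            bk , w∉ , t , leq = extend-ok u ((v , proj₁ (back o v)) ∷ proj₂ (back o v)) (onward r)
              (BackPath.step (v∈ , u∉S , proj₂ (K⇒ k) , ¬c) e₂ bk₀) g
            le = finish-pot I v∈ v∉ in
        (((oinv , full) , (bk , w∉ , t) ,
          (≤-trans (+-monoˡ-≤ (suc ∣ S ∣ * m o) (≤-trans (≤-reflexive leq) (+-monoʳ-≤ (suc (length (proj₂ (back o v)))) (≤-trans len (p⊆q⇒∣p∣≤∣q∣ (B⊆S I))))))
            (≤-trans (≤-reflexive (assoc (length (proj₂ (back o v))) ∣ S ∣ (suc ∣ S ∣ * m o)))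
              (≤-trans (+-monoʳ-≤ (suc ∣ S ∣) (backLen v∈R)) (≤-reflexive (sym (*-suc (suc ∣ S ∣) m₀)))))))
        , ≤-trans (s≤s (≤-trans (m≤n+m _ ℓ) le)) (≤-trans potS⁻< (s≤s⁻¹ b)))
        , ≤-trans (≤-reflexive (sym (m+n∸m≡n ℓ _))) (∸-monoˡ-≤ ℓ le)
        where
        path = extend u ((v , proj₁ (back o v)) ∷ proj₂ (back o v)) (onward r)
        assoc : ∀ a s t → suc a + s + t ≡ suc s + (a + t)
        assoc = solve-∀

    finish : ∀ f o x ps → Call (λ M → Finishing o x ps M × pot o + final < f) Post (pot o + final)
    finish f o x ps with x ∈? snk
    ... | yes x∈ = weaken (bind (augmentAlong x ps) λ S′ → return (better S′) λ M (_ , b) → b , z≤n)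
        λ M (((I , _) , (bk , x∉ , _) , len) , _) → let open OInv I ; le = ≤-trans (m≤m+n (length ps) _) len in
          ((common , ≤-trans le size) , bk , x∉ , proj₂ (snk⁻ x∈))
          , ≤-trans (+-mono-≤ (*-monoˡ-≤ ℓ le) (*-monoˡ-≤ ℓ le)) (m≤n+m final (pot o))
    ... | no x∉snk = go (m o) refl
      where
      many : ∀ {M} → Finishing o x ps M → h ≤ ∣ Ld.live o x ∣
      many ((I , full) , (_ , x∉ , inj₁ p) , _) = ⊥-elim (x∉snk p)
      many ((I , full) , (_ , x∉ , inj₂ p) , _) = full x x∉ x∉snk p
      go : ∀ k → m o ≡ k → Call (λ M → Finishing o x ps M × pot o + final < f) Post (pot o + final)
      -- Without rounds left all of `S` is visited, yet `x` still lists `h ≥ 1` unvisited elements.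
      go zero eq = return optimal λ M (F@((I , _) , _) , _) → ⊥-elim (<-irrefl refl (begin-strict
          ∣ S ∣ ≤⟨ OInv.rounds I ⟩
          ∣ R o ∣ + h * m o ≡⟨ trans (cong (∣ R o ∣ +_) (trans (cong (h *_) eq) (*-zeroʳ h))) (+-identityʳ _) ⟩
          ∣ R o ∣ <⟨ m<m+n ∣ R o ∣ (≤-trans 1≤h (many F)) ⟩
          ∣ R o ∣ + ∣ Ld.live o x ∣ ≤⟨ Visit.grows o x ps ⟩
          ∣ R o ∪ L o x ∣ ≤⟨ p⊆q⇒∣p∣≤∣q∣ (Visit.R∪L⊆S o x ps I) ⟩
          ∣ S ∣ ∎)) , z≤n
        where open ≤-Reasoning
      go (suc k) eq = weaken (refill f (Visit.visited o x ps k)) λ M (F@((I , _) , (bk , _) , len) , b) →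
        (Visit.visited-inv o x ps eq I (many F) bk len , ≤-trans (s≤s (≤-reflexive same)) b) , ≤-reflexive same
        where
        same : potR (Visit.visited o x ps k) ≡ pot o + final
        same = trans (assoc ((1 + ℓ) * (Amax ∸ Ld.total o)) ((1 + z) * (n ∸ ∣ comp o ∣)) (W * k) W final)
          (cong (λ t → (1 + ℓ) * (Amax ∸ Ld.total o) + ((1 + z) * (n ∸ ∣ comp o ∣) + t) + final)
            (trans (sym (*-suc W k)) (cong (W *_) (sym eq))))
          where
          assoc : ∀ a b d w t → a + (b + d) + (w + t) ≡ a + (b + (w + d)) + t
          assoc = solve-∀

  reachCost : ℕ
  reachCost = (1 + ℓ) * Amax + ((1 + z) * n + W * m₀) + (W + final)

  reach : Call Pre Post reachCost
  reach = weaken (refill (suc (potR o₀)) o₀) λ M P → (init P , ≤-refl) , +-monoˡ-≤ (W + final)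
      (+-mono-≤ (*-monoʳ-≤ (1 + ℓ) (m∸n≤m Amax (Ld.total o₀))) (+-monoˡ-≤ (W * m₀) (*-monoʳ-≤ (1 + z) (m∸n≤m n ∣ ⊥ {n} ∣))))
    where
    o₀ : Outer
    o₀ = outer ⊥ (λ v → v , []) (λ _ → ⊥) ⊥ (λ _ → ⊥) m₀
    init : ∀ {M} → Pre M → OInv o₀ M
    init P = record
      { pre = P ; R⊆S = λ x∈ → ⊥-elim (∉⊥ x∈) ; backOk = λ x∈ → ⊥-elim (∉⊥ x∈) ; backLen = λ x∈ → ⊥-elim (∉⊥ x∈)
      ; m≤m₀ = ≤-refl ; listed = λ p → ⊥-elim ([ ∉⊥ , ∉⊥ ]′ p) ; complete = λ x∈ → ⊥-elim (∉⊥ x∈)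
      ; cap = λ u → ≤-trans (p⊆q⇒∣p∣≤∣q∣ {q = ⊥} (λ x∈ → proj₁ (∈⟦⟧⁻ (Ld.live? o₀ u) x∈))) (≤-trans (≤-reflexive (∣⊥∣≡0 n)) z≤n)
      ; loads = λ v → ≤-trans (∑-mono {n} {g = λ _ → 0} (λ u → ≤-reflexive (𝟙-∉ {X = ⊥} {v} ∉⊥))) (≤-trans (≤-reflexive (trans (∑-const n 0) (*-zeroʳ n))) z≤n)
      ; rounds = ≤-trans m₀-bound (m≤n+m _ ∣ ⊥ {n} ∣) }

-- Counting queries

n<2^n : ∀ n → n < 2 ^ n
n<2^n zero = s≤s z≤n
n<2^n (suc n) = ≤-trans (≤-trans (s≤s (n<2^n n)) (≤-reflexive (+-comm 1 (2 ^ n)))) (+-monoʳ-≤ (2 ^ n) (≤-trans (m^n>0 2 n) (m≤m+n (2 ^ n) 0)))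

2^[4+2l] : ∀ l → 2 ^ (4 + (l + l)) ≡ 2 ^ l * 2 ^ l * 16
2^[4+2l] l = trans (^-distribˡ-+-* 2 4 (l + l)) (trans (*-comm (2 ^ 4) (2 ^ (l + l))) (cong (_* 16) (^-distribˡ-+-* 2 l l)))

n<2^suc⌊log₂n⌋ : ∀ n → n < 2 ^ suc ⌊log₂ n ⌋
n<2^suc⌊log₂n⌋ n = ≰⇒> λ le → 1+n≰n (subst (_≤ ⌊log₂ n ⌋) (⌊log₂[2^n]⌋≡n (suc ⌊log₂ n ⌋)) (⌊log₂⌋-mono-≤ le))

^-distrib-* : ∀ x y e → (x * y) ^ e ≡ x ^ e * y ^ e
^-distrib-* x y zero = refl
^-distrib-* x y (suc e) rewrite ^-distrib-* x y e = lem x y (x ^ e) (y ^ e)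
  where
  lem : ∀ a b c d → a * b * (c * d) ≡ a * c * (b * d)
  lem = solve-∀

^-cancel-≤ : ∀ e {x y} → x ^ suc e ≤ y ^ suc e → x ≤ y
^-cancel-≤ e le = ≮⇒≥ λ lt → <⇒≱ (^-monoˡ-< (suc e) lt) le

root : ∀ e s → ∃[ k ] k ^ suc e ≤ s × s < suc k ^ suc e
root e zero = 0 , z≤n , m^n>0 1 (suc e)
root e (suc s) with root e s
... | k , lo , hi with suc k ^ suc e ≤? suc s
... | yes p = suc k , p , ≤-<-trans hi (^-monoˡ-< (suc e) (n<1+n (suc k)))
... | no p = k , m≤n⇒m≤1+n lo , ≰⇒> p

1≤⇒≤* : ∀ x {u} → 1 ≤ u → x ≤ x * u
1≤⇒≤* x 1≤u = ≤-trans (≤-reflexive (sym (*-identityʳ x))) (*-monoʳ-≤ x 1≤u)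

1≤* : ∀ {a b} → 1 ≤ a → 1 ≤ b → 1 ≤ a * b
1≤* = *-mono-≤

div-upper : ∀ s y .{{_ : NonZero y}} → s ≤ suc (s / y) * y
div-upper s y = ≤-trans (≤-reflexive (m≡m%n+[m/n]*n s y)) (+-monoˡ-≤ (s / y * y) (<⇒≤ (m%n<n s y)))

div-lower : ∀ s y .{{_ : NonZero y}} → suc (s / y) * y ≤ y + s
div-lower s y = +-monoʳ-≤ y (m/n*n≤m s y)

-- Large numerals stand on the right of products: ℕ multiplication recurses on its left argument,
-- and unfolding such products makes type checking infeasible.
module ReachArith {n κ ℓ σ c m₀ : ℕ} (1≤κ : 1 ≤ κ) (1≤n : 1 ≤ n) (σ≤n : σ ≤ n) (σ≤ : σ ≤ κ * κ * κ * 128)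
  (c≤ : c * κ ≤ 2 * n) (m₀≤ : m₀ * κ ≤ κ * κ * κ * 129) where

  U W Λ : ℕ
  U = n * (κ * κ) * (1 + ℓ)
  W = 3 + (n + (1 + ℓ) * σ)
  Λ = suc σ * suc m₀

  private
    1≤κκ : 1 ≤ κ * κ
    1≤κκ = 1≤* 1≤κ 1≤κ

    1≤λ : 1 ≤ 1 + ℓ
    1≤λ = s≤s z≤n

    nκκ≤U : n * (κ * κ) ≤ U
    nκκ≤U = 1≤⇒≤* _ 1≤λ

    nλ≤U : n * (1 + ℓ) ≤ U
    nλ≤U = *-monoˡ-≤ (1 + ℓ) (1≤⇒≤* n 1≤κκ)

    n≤U : n ≤ U
    n≤U = ≤-trans (1≤⇒≤* n 1≤λ) nλ≤U

    σc : σ * c ≤ n * (κ * κ) * 256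
    σc = begin
      σ * c ≤⟨ *-monoˡ-≤ c σ≤ ⟩
      κ * κ * κ * 128 * c ≡⟨ r₁ 128 κ c ⟩
      κ * κ * (c * κ) * 128 ≤⟨ *-monoˡ-≤ 128 (*-monoʳ-≤ (κ * κ) c≤) ⟩
      κ * κ * (2 * n) * 128 ≡⟨ r₂ 128 κ n ⟩
      n * (κ * κ) * 256 ∎
      where
      open ≤-Reasoning
      r₁ : ∀ a κ c → κ * κ * κ * a * c ≡ κ * κ * (c * κ) * a
      r₁ = solve-∀
      r₂ : ∀ a κ n → κ * κ * (2 * n) * a ≡ n * (κ * κ) * (2 * a)
      r₂ = solve-∀

    a₁ : (1 + ℓ) * (n * κ + σ * c) ≤ U * 257
    a₁ = begin
      (1 + ℓ) * (n * κ + σ * c) ≤⟨ *-monoʳ-≤ (1 + ℓ) (+-mono-≤ (*-monoʳ-≤ n (1≤⇒≤* κ 1≤κ)) σc) ⟩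
      (1 + ℓ) * (n * (κ * κ) + n * (κ * κ) * 256) ≡⟨ r 256 (1 + ℓ) (n * (κ * κ)) ⟩
      n * (κ * κ) * (1 + ℓ) * 257 ∎
      where
      open ≤-Reasoning
      r : ∀ a l u → l * (u + u * a) ≡ u * l * (1 + a)
      r = solve-∀

    a₂ : (1 + κ * κ) * n ≤ U * 2
    a₂ = ≤-trans (≤-trans (*-monoˡ-≤ n (+-monoˡ-≤ (κ * κ) 1≤κκ)) (≤-reflexive (r (κ * κ) n))) (*-monoˡ-≤ 2 nκκ≤U)
      where
      r : ∀ u n → (u + u) * n ≡ n * u * 2
      r = solve-∀

    W≤ : W ≤ n * (1 + ℓ) * 5
    W≤ = begin
      3 + (n + (1 + ℓ) * σ) ≤⟨ +-mono-≤ (≤-trans (*-monoʳ-≤ 3 1≤n) (*-monoʳ-≤ 3 (1≤⇒≤* n 1≤λ))) (+-mono-≤ (1≤⇒≤* n 1≤λ) (≤-trans (*-monoʳ-≤ (1 + ℓ) σ≤n) (≤-reflexive (*-comm (1 + ℓ) n)))) ⟩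
      3 * (n * (1 + ℓ)) + (n * (1 + ℓ) + n * (1 + ℓ)) ≡⟨ r (n * (1 + ℓ)) ⟩
      n * (1 + ℓ) * 5 ∎
      where
      open ≤-Reasoning
      r : ∀ u → 3 * u + (u + u) ≡ u * 5
      r = solve-∀

    m₀≤′ : m₀ ≤ κ * κ * 129
    m₀≤′ = *-cancelʳ-≤ m₀ _ κ {{>-nonZero 1≤κ}} (≤-trans m₀≤ (≤-reflexive (r 129 κ)))
      where
      r : ∀ a κ → κ * κ * κ * a ≡ κ * κ * a * κ
      r = solve-∀

    a₃ : W * m₀ ≤ U * 645
    a₃ = ≤-trans (*-mono-≤ W≤ m₀≤′) (≤-reflexive (r 5 129 n (1 + ℓ) (κ * κ)))
      where
      r : ∀ b a n l u → n * l * b * (u * a) ≡ n * u * l * (b * a)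
      r = solve-∀

    a₄ : W ≤ U * 5
    a₄ = ≤-trans W≤ (*-monoˡ-≤ 5 nλ≤U)

    a₅ : Λ * ℓ ≤ U * 260
    a₅ = begin
      suc σ * suc m₀ * ℓ ≤⟨ *-mono-≤ (*-mono-≤ (+-mono-≤ 1≤n σ≤n) (+-mono-≤ 1≤κκ m₀≤′)) (n≤1+n ℓ) ⟩
      (n + n) * (κ * κ + κ * κ * 129) * (1 + ℓ) ≡⟨ r 129 n (κ * κ) (1 + ℓ) ⟩
      n * (κ * κ) * (1 + ℓ) * 260 ∎
      where
      open ≤-Reasoning
      r : ∀ a n u l → (n + n) * (u + u * a) * l ≡ n * u * l * (2 * (1 + a))
      r = solve-∀

  reach-arith : n + (n + ((1 + ℓ) * (n * κ + σ * c) + ((1 + κ * κ) * n + W * m₀) + (W + (Λ * ℓ + Λ * ℓ)))) ≤ U * 1431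
  reach-arith = ≤-trans (+-mono-≤ n≤U (+-mono-≤ n≤U (+-mono-≤ (+-mono-≤ a₁ (+-mono-≤ a₂ a₃)) (+-mono-≤ a₄ (+-mono-≤ a₅ a₅))))) (≤-reflexive (r 257 645 260 U))
    where
    r : ∀ a b c u → u + (u + (u * a + (u * 2 + u * b) + (u * 5 + (u * c + u * c)))) ≡ u * (2 + (a + (2 + b) + (5 + (c + c))))
    r = solve-∀

abstract
  bits : ℕ → ℕ
  bits s = suc ⌊log₂ s ⌋

  bits-def : ∀ s → bits s ≡ suc ⌊log₂ s ⌋
  bits-def s = refl

-- The quantities of the algorithm: k ≈ s^{1/6}, L = 1 + ⌊log₂ s⌋, 2 ^ ℓ bounds all search lists, d ≈ s^{5/6} is the
-- number of levels of the shortest path phase, and y bounds the excess left by the auction.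
module Costs (n s k y : ℕ) where

  L κ d ℓ : ℕ
  L = bits s
  κ = k * k
  d = κ * κ * k
  ℓ = 4 + (L + L)

  sweep-max reach-max total : ℕ
  sweep-max = 3 + (3 * n + (ℓ * (5 * s) + (d + d * ℓ)))
  reach-max = n * (κ * κ) * (1 + ℓ) * 1431
  total = n * 2 + ((n + y * 128 * (n + n)) + ((n * d + sweep-max * suc (3 * y)) + reach-max * suc (k * 128)))

  module _ (1≤k : 1 ≤ k) (1≤s : 1 ≤ s) (s≤n : s ≤ n) (1≤y : 1 ≤ y) (k⁶≤s : κ * κ * κ ≤ s) (s≤64k⁶ : s ≤ κ * κ * κ * 64) where

    private
      1≤n : 1 ≤ n
      1≤n = ≤-trans 1≤s s≤n
      1≤κ : 1 ≤ κ
      1≤κ = 1≤* 1≤k 1≤k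
      1≤d : 1 ≤ d
      1≤d = 1≤* (1≤* 1≤κ 1≤κ) 1≤k
      1≤L : 1 ≤ L
      1≤L = ≤-trans (s≤s z≤n) (≤-reflexive (sym (bits-def s)))

    d≤s : d ≤ s
    d≤s = ≤-trans (*-monoʳ-≤ (κ * κ) (1≤⇒≤* k 1≤k)) k⁶≤s

    private
      λ≤ : 1 + ℓ ≤ L * 7
      λ≤ = ≤-trans (+-monoˡ-≤ (L + L) (*-monoʳ-≤ 5 1≤L)) (≤-reflexive (r L))
        where
        r : ∀ l → 5 * l + (l + l) ≡ l * 7
        r = solve-∀

      s≤2^L : s ≤ 2 ^ L
      s≤2^L = subst (λ l → s ≤ 2 ^ l) (sym (bits-def s)) (<⇒≤ (n<2^suc⌊log₂n⌋ s))

      16s² : s * s * 16 ≤ 2 ^ ℓ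
      16s² = ≤-trans (*-monoˡ-≤ 16 (*-mono-≤ s≤2^L s≤2^L)) (≤-reflexive (sym (2^[4+2l] L)))

    5s≤2^ℓ : 5 * s ≤ 2 ^ ℓ
    5s≤2^ℓ = ≤-trans (≤-trans (≤-reflexive (*-comm 5 s)) (*-mono-≤ (1≤⇒≤* s 1≤s) (≤ᵇ⇒≤ 5 16 tt))) 16s²

    -- Origin of `ℓ`: a walk has at most 3 s · 4 s = 12 s² pairs, and `4 + (L + L)` bits cover 16
    -- s².
    length≤2^ℓ : ∀ {σ m₀} → σ ≤ 2 * s → m₀ ≤ suc σ → suc σ * suc m₀ ≤ 2 ^ ℓ
    length≤2^ℓ {σ} {m₀} σ≤ m≤ = begin
      suc σ * suc m₀ ≤⟨ *-mono-≤ σ′ (s≤s m≤) ⟩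
      3 * s * suc (suc σ) ≤⟨ *-monoʳ-≤ (3 * s) (+-mono-≤ 1≤s σ′) ⟩
      3 * s * (s + 3 * s) ≡⟨ r s ⟩
      s * s * 12 ≤⟨ *-monoʳ-≤ (s * s) (≤ᵇ⇒≤ 12 16 tt) ⟩
      s * s * 16 ≤⟨ 16s² ⟩
      2 ^ ℓ ∎
      where
      open ≤-Reasoning
      σ′ : suc σ ≤ 3 * s
      σ′ = +-mono-≤ 1≤s σ≤
      r : ∀ s → 3 * s * (s + 3 * s) ≡ s * s * 12
      r = solve-∀

    private
      sweep≤ : sweep-max ≤ 7 * n + 6 * (ℓ * s)
      sweep≤ = begin
        3 + (3 * n + (ℓ * (5 * s) + (d + d * ℓ))) ≤⟨ +-mono-≤ (*-monoʳ-≤ 3 1≤n) (+-monoʳ-≤ (3 * n) (+-monoʳ-≤ (ℓ * (5 * s)) (+-mono-≤ (≤-trans d≤s s≤n) (*-monoˡ-≤ ℓ d≤s)))) ⟩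
        3 * n + (3 * n + (ℓ * (5 * s) + (n + s * ℓ))) ≡⟨ r n ℓ s ⟩
        7 * n + 6 * (ℓ * s) ∎
        where
        open ≤-Reasoning
        r : ∀ n l s → 3 * n + (3 * n + (l * (5 * s) + (n + s * l))) ≡ 7 * n + 6 * (l * s)
        r = solve-∀

      suc3y : suc (3 * y) ≤ 4 * y
      suc3y = +-monoˡ-≤ (3 * y) 1≤y

      reach-total : reach-max * suc (k * 128) ≤ n * (d * (1 + ℓ)) * 184599
      reach-total = ≤-trans (*-monoʳ-≤ reach-max (+-monoˡ-≤ (k * 128) 1≤k)) (≤-reflexive (r 1431 128 n (κ * κ) (1 + ℓ) k))
        where
        r : ∀ a b n u l k → n * u * l * a * (k + k * b) ≡ n * (u * k * l) * (a * (1 + b))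
        r = solve-∀

      dλ≤ : d * (1 + ℓ) ≤ d * L * 7
      dλ≤ = ≤-trans (*-monoʳ-≤ d λ≤) (≤-reflexive (sym (*-assoc d L 7)))

      auction≤ : ∀ {V} → n ≤ V → n * y ≤ V → n + y * 128 * (n + n) ≤ V * 257
      auction≤ {V} p q = ≤-trans (+-mono-≤ p (≤-trans (≤-reflexive (r 128 y n)) (*-monoˡ-≤ 256 q))) (≤-reflexive (r′ 256 V))
        where
        r : ∀ a d n → d * a * (n + n) ≡ n * d * (2 * a)
        r = solve-∀
        r′ : ∀ a v → v + v * a ≡ v * (1 + a)
        r′ = solve-∀

    total-d : y ≡ d → total ≤ n * (d * L) * 1294209
    total-d refl = begin
      total ≤⟨ +-mono-≤ (*-monoˡ-≤ 2 n≤V) (+-mono-≤ (auction≤ n≤V nd≤V) (+-mono-≤ (+-mono-≤ nd≤V b₃) reach-total)) ⟩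
      V * 2 + (V * 257 + ((V + V * 28) + V * 184599)) ≡⟨ r 257 28 184599 V ⟩
      V * 184887 ≤⟨ *-monoˡ-≤ 184887 (*-monoʳ-≤ n dλ≤) ⟩
      n * (d * L * 7) * 184887 ≡⟨ r′ 7 184887 n (d * L) ⟩
      n * (d * L) * 1294209 ∎
      where
      open ≤-Reasoning
      V = n * (d * (1 + ℓ))
      r : ∀ a b c v → v * 2 + (v * a + ((v + v * b) + v * c)) ≡ v * (2 + (a + ((1 + b) + c)))
      r = solve-∀
      r′ : ∀ b a n u → n * (u * b) * a ≡ n * u * (b * a)
      r′ = solve-∀
      nd≤V : n * d ≤ V
      nd≤V = *-monoʳ-≤ n (1≤⇒≤* d (s≤s z≤n))
      n≤V : n ≤ V
      n≤V = ≤-trans (1≤⇒≤* n 1≤d) nd≤V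
      b₃ : sweep-max * suc (3 * d) ≤ V * 28
      b₃ = ≤-trans (*-mono-≤ (≤-trans sweep≤ sw) suc3y) (≤-reflexive (e n (1 + ℓ) d))
        where
        sw : 7 * n + 6 * (ℓ * s) ≤ 7 * (n * (1 + ℓ))
        sw = ≤-trans (+-monoʳ-≤ (7 * n) (≤-trans (*-monoʳ-≤ 6 (*-monoʳ-≤ ℓ s≤n)) (*-monoˡ-≤ (ℓ * n) (≤ᵇ⇒≤ 6 7 tt)))) (≤-reflexive (e₁ n ℓ))
          where
          e₁ : ∀ n l → 7 * n + 7 * (l * n) ≡ 7 * (n * (1 + l))
          e₁ = solve-∀
        e : ∀ n l d → 7 * (n * l) * (4 * d) ≡ n * (d * l) * 28
        e = solve-∀

    module _ (k⁹<n : κ * κ * κ * κ * k < n) (y-root : n * (s * s * s) * (L * L * L * L) < suc y ^ 5) where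

      private
        -- A crude logarithm from `k ≤ 2 ^ k`; it only serves to trade one factor `L` for k².
        L≤13κ : L ≤ κ * 13
        L≤13κ = begin
          L ≡⟨ bits-def s ⟩
          suc ⌊log₂ s ⌋ ≤⟨ s≤s (⌊log₂⌋-mono-≤ s≤2^) ⟩
          suc ⌊log₂ 2 ^ e ⌋ ≡⟨ cong suc (⌊log₂[2^n]⌋≡n e) ⟩
          suc e ≡⟨ r′ k ⟩
          7 + 6 * k ≤⟨ +-monoˡ-≤ (6 * k) (*-monoʳ-≤ 7 1≤k) ⟩
          7 * k + 6 * k ≡⟨ r k ⟩
          k * 13 ≤⟨ *-monoˡ-≤ 13 (1≤⇒≤* k 1≤k) ⟩
          κ * 13 ∎
          where
          open ≤-Reasoning
          e : ℕ
          e = (k + k + (k + k) + (k + k)) + 6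
          r : ∀ k → 7 * k + 6 * k ≡ k * 13
          r = solve-∀
          r′ : ∀ k → suc ((k + k + (k + k) + (k + k)) + 6) ≡ 7 + 6 * k
          r′ = solve-∀
          k≤ : k ≤ 2 ^ k
          k≤ = <⇒≤ (n<2^n k)
          κ≤ : κ ≤ 2 ^ (k + k)
          κ≤ = ≤-trans (*-mono-≤ k≤ k≤) (≤-reflexive (sym (^-distribˡ-+-* 2 k k)))
          κκ≤ : κ * κ ≤ 2 ^ (k + k + (k + k))
          κκ≤ = ≤-trans (*-mono-≤ κ≤ κ≤) (≤-reflexive (sym (^-distribˡ-+-* 2 (k + k) (k + k))))
          κκκ≤ : κ * κ * κ ≤ 2 ^ (k + k + (k + k) + (k + k))
          κκκ≤ = ≤-trans (*-mono-≤ κκ≤ κ≤) (≤-reflexive (sym (^-distribˡ-+-* 2 (k + k + (k + k)) (k + k))))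
          s≤2^ : s ≤ 2 ^ e
          s≤2^ = ≤-trans s≤64k⁶ (≤-trans (*-monoˡ-≤ 64 κκκ≤) (≤-reflexive (sym (^-distribˡ-+-* 2 (k + k + (k + k) + (k + k)) 6))))

        -- Here s log s is O(k⁸), below n > k⁹, so a sweep costs O(n) without a logarithm.
        ℓs≤ : ℓ * s ≤ n * 4992
        ℓs≤ = begin
          ℓ * s ≤⟨ *-mono-≤ ℓ≤ s≤64k⁶ ⟩
          κ * 13 * 6 * (κ * κ * κ * 64) ≡⟨ r 13 6 64 κ ⟩
          κ * κ * κ * κ * 4992 ≤⟨ *-monoˡ-≤ 4992 (≤-trans (1≤⇒≤* (κ * κ * κ * κ) 1≤k) (<⇒≤ k⁹<n)) ⟩
          n * 4992 ∎
          where
          open ≤-Reasoning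
          r : ∀ a c b κ → κ * a * c * (κ * κ * κ * b) ≡ κ * κ * κ * κ * (a * c * b)
          r = solve-∀
          six : ∀ l → 4 * l + (l + l) ≡ l * 6
          six = solve-∀
          ℓ≤ : ℓ ≤ κ * 13 * 6
          ℓ≤ = ≤-trans (≤-trans (+-monoˡ-≤ (L + L) (*-monoʳ-≤ 4 1≤L)) (≤-reflexive (six L))) (*-monoˡ-≤ 6 L≤13κ)

        suc-y : suc y ≤ 2 * y
        suc-y = ≤-trans (+-monoˡ-≤ y 1≤y) (≤-reflexive (r y))
          where
          r : ∀ y → y + y ≡ 2 * y
          r = solve-∀

        -- One factor `L` becomes 13 k², turning k²⁵ L⁵ into 13 k⁹ k¹⁸ L⁴; then k⁹ < n and k¹⁸ ≤ s³.
        -- So the `d * L` terms are absorbed by `y`.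
        d⁵L⁵ : (d * L) ^ 5 ≤ n * (s * s * s) * (L * L * L * L) * 13
        d⁵L⁵ = begin
          (d * L) ^ 5 ≡⟨ ^-distrib-* d L 5 ⟩
          d ^ 5 * L ^ 5 ≡⟨ cong₂ _*_ (^-distrib-* (κ * κ) k 5) (r₁ L) ⟩
          (κ * κ) ^ 5 * k ^ 5 * (L * L * L * L * L) ≤⟨ *-monoʳ-≤ ((κ * κ) ^ 5 * k ^ 5) (*-monoʳ-≤ (L * L * L * L) L≤13κ) ⟩
          (κ * κ) ^ 5 * k ^ 5 * (L * L * L * L * (κ * 13)) ≡⟨ cong₂ (λ u v → u * v * (L * L * L * L * (κ * 13))) (r₄ κ) (r₅ k) ⟩
          t * t * t * κ * (κ * κ * k) * (L * L * L * L * (κ * 13)) ≡⟨ r₂ 13 κ k t (L * L * L * L) ⟩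
          κ * κ * κ * κ * k * (t * t * t) * (L * L * L * L) * 13 ≤⟨ *-monoˡ-≤ 13 (*-monoˡ-≤ (L * L * L * L) (*-mono-≤ (<⇒≤ k⁹<n) (*-mono-≤ (*-mono-≤ k⁶≤s k⁶≤s) k⁶≤s))) ⟩
          n * (s * s * s) * (L * L * L * L) * 13 ∎
          where
          open ≤-Reasoning
          t = κ * κ * κ
          r₁ : ∀ L → L * (L * (L * (L * (L * 1)))) ≡ L * L * L * L * L
          r₁ = solve-∀
          r₄ : ∀ κ → (κ * κ) * ((κ * κ) * ((κ * κ) * ((κ * κ) * ((κ * κ) * 1)))) ≡ (κ * κ * κ) * (κ * κ * κ) * (κ * κ * κ) * κ
          r₄ = solve-∀
          r₅ : ∀ k → k * (k * (k * (k * (k * 1)))) ≡ (k * k) * (k * k) * k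
          r₅ = solve-∀
          r₂ : ∀ a κ k t m → t * t * t * κ * (κ * κ * k) * (m * (κ * a)) ≡ κ * κ * κ * κ * k * (t * t * t) * m * a
          r₂ = solve-∀

        dL≤ : d * L ≤ y * 26
        dL≤ = ^-cancel-≤ 4 (≤-trans d⁵L⁵ (≤-trans (*-mono-≤ (<⇒≤ y-root) (≤ᵇ⇒≤ 13 (13 ^ 5) tt))
          (≤-trans (*-monoˡ-≤ (13 ^ 5) (^-monoˡ-≤ 5 suc-y))
            (≤-reflexive (trans (sym (^-distrib-* (2 * y) 13 5)) (cong (_^ 5) (r 13 y)))))))
          where
          r : ∀ a y → 2 * y * a ≡ y * (2 * a)
          r = solve-∀

      total-y : total ≤ n * y * 33717139
      total-y = begin
        total ≤⟨ +-mono-≤ (*-monoˡ-≤ 2 n≤V) (+-mono-≤ (auction≤ n≤V ≤-refl) (+-mono-≤ (+-mono-≤ b₂ b₃) b₄)) ⟩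
        V * 2 + (V * 257 + ((V * 26 + V * 119836) + V * 33597018)) ≡⟨ r 257 26 119836 33597018 V ⟩
        V * 33717139 ∎
        where
        open ≤-Reasoning
        V = n * y
        r : ∀ a b c d v → v * 2 + (v * a + ((v * b + v * c) + v * d)) ≡ v * (2 + (a + ((b + c) + d)))
        r = solve-∀
        n≤V : n ≤ V
        n≤V = 1≤⇒≤* n 1≤y
        b₂ : n * d ≤ V * 26
        b₂ = ≤-trans (*-monoʳ-≤ n (≤-trans (1≤⇒≤* d 1≤L) dL≤)) (≤-reflexive (sym (*-assoc n y 26)))
        b₃ : sweep-max * suc (3 * y) ≤ V * 119836
        b₃ = ≤-trans (*-mono-≤ (≤-trans sweep≤ (+-monoʳ-≤ (7 * n) (*-monoʳ-≤ 6 ℓs≤))) suc3y) (≤-reflexive (e 7 6 4 4992 n y))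
          where
          e : ∀ b c f a n y → (b * n + c * (n * a)) * (f * y) ≡ n * y * ((b + c * a) * f)
          e = solve-∀
        b₄ : reach-max * suc (k * 128) ≤ V * 33597018
        b₄ = ≤-trans reach-total (≤-trans (*-monoˡ-≤ 184599 (*-monoʳ-≤ n (≤-trans dλ≤ (*-monoˡ-≤ 7 dL≤)))) (≤-reflexive (e 184599 26 7 n y)))
          where
          e : ∀ a b c n y → n * (y * b * c) * a ≡ n * y * (b * c * a)
          e = solve-∀

-- The algorithm

module Exact {n : ℕ} (s k : ℕ) where
  open Costs n s k 0 using (κ; ℓ; reach-max)

  Max : Subset n → Inst n → Set
  Max S M = MaxCommonIndep (proj₁ M) (proj₂ M) S

  Bounded Gap : ℕ → Subset n → Inst n → Set
  Bounded b _ M = ∀ T → Common T M → ∣ T ∣ ≤ b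
  Gap g S M = ∀ T → Common T M → ∣ T ∣ ≤ ∣ S ∣ + g

  module _ (1≤k : 1 ≤ k) (1≤s : 1 ≤ s) (s≤n : s ≤ n) (k⁶≤s : κ * κ * κ ≤ s) (s≤64k⁶ : s ≤ κ * κ * κ * 64) where

    private
      1≤κ : 1 ≤ κ
      1≤κ = 1≤* 1≤k 1≤k
      instance
        κ-nonZero : NonZero κ
        κ-nonZero = >-nonZero 1≤κ
      κ≤κκκ : κ ≤ κ * κ * κ
      κ≤κκκ = ≤-trans (1≤⇒≤* κ 1≤κ) (1≤⇒≤* (κ * κ) 1≤κ)

      c : ℕ
      c = suc (n / κ)
      rounds : Subset n → ℕ
      rounds S = suc (∣ S ∣ / κ)

    2s≤ : 2 * s ≤ κ * κ * κ * 128
    2s≤ = ≤-trans (*-monoʳ-≤ 2 s≤64k⁶) (≤-reflexive (r 64 (κ * κ * κ)))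
      where
      r : ∀ a u → 2 * (u * a) ≡ u * (2 * a)
      r = solve-∀

    z-bound : n * κ ≤ κ * κ * c
    z-bound = ≤-trans (*-monoˡ-≤ κ (div-upper n κ)) (≤-reflexive (r c κ))
      where
      r : ∀ c κ → c * κ * κ ≡ κ * κ * c
      r = solve-∀

    m₀-bound : ∀ S → ∣ S ∣ ≤ κ * rounds S
    m₀-bound S = ≤-trans (div-upper ∣ S ∣ κ) (≤-reflexive (*-comm _ κ))

    -- With `h = κ` of order s^{1/3}, `c` of order n / s^{1/3} and `z = κ * κ`, the refilled
    -- entries, the saturated queries and the roughly s^{2/3} rounds each cost about n s^{2/3}, up
    -- to the logarithm.
    module Search (S src snk : Subset n) = Reach S src snk ℓ κ c (κ * κ) (rounds S) 1≤κ (s≤s z≤n) z-bound (m₀-bound S)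

    searchCost : Subset n → ℕ
    searchCost S = Search.reachCost S ⊥ ⊥

    cost≤ : ∀ S → ∣ S ∣ ≤ 2 * s → length (elems (∁ S)) + (length (elems (∁ S)) + searchCost S) ≤ reach-max
    cost≤ S S≤ = ≤-trans (+-mono-≤ (length-elems≤n (∁ S)) (+-monoˡ-≤ _ (length-elems≤n (∁ S))))
      (ReachArith.reach-arith {n} {κ} {ℓ} {∣ S ∣} {c} {rounds S} 1≤κ (≤-trans 1≤s s≤n) (∣p∣≤n S) (≤-trans S≤ 2s≤)
        (≤-trans (div-lower n κ) (≤-trans (+-monoˡ-≤ n (≤-trans κ≤κκκ (≤-trans k⁶≤s s≤n))) (≤-reflexive (r n))))
        (≤-trans (div-lower ∣ S ∣ κ) (≤-trans (+-mono-≤ κ≤κκκ (≤-trans S≤ 2s≤)) (≤-reflexive (sym (*-suc (κ * κ * κ) 128))))))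
      where
      r : ∀ n → n + n ≡ 2 * n
      r = solve-∀

    exact : ∀ g S → Call (λ M → (Common S M × Bounded (2 * s) S M) × Gap g S M) Max (reach-max * suc g)
    exact g S = weaken
      (call {b = length es + (searchCost S + reach-max * g)} (collect one (λ _ → S) id es outside-S) λ src →
        call {b = searchCost S + reach-max * g} (collect two (λ _ → S) id es outside-S) λ snk →
        bind (frame (reach-max * g) (weaken (Search.reach S src snk)
          λ M ((((ci , ub) , _) , f) , h) → pre src snk ci ub f h , ≤-refl)) (next g src snk))
      λ M k → k , ≤-trans (≤-reflexive (assoc (length es) (length es) (searchCost S) (reach-max * g)))
        (≤-trans (+-monoˡ-≤ (reach-max * g) (cost≤ S (proj₂ (proj₁ k) S (proj₁ (proj₁ k))))) (≤-reflexive (sym (*-suc reach-max g))))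
      where
      es : List (Fin n)
      es = elems (∁ S)
      assoc : ∀ a b c d → a + (b + (c + d)) ≡ a + (b + c) + d
      assoc = solve-∀
      outside-S : All (λ e → e ∉ S) es
      outside-S = All.tabulate λ i → x∈∁p⇒x∉p (elems⁻ i)
      pre : ∀ src snk {M} → Common S M → Bounded (2 * s) S M → Collected one (λ _ → S) id es src M → Collected two (λ _ → S) id es snk M →
            Search.Pre S src snk M
      pre src snk ci ub (f , f′) (h , h′) = record
        { common = ci
        ; size = Costs.length≤2^ℓ n s k 1 1≤k 1≤s s≤n (s≤s z≤n) k⁶≤s s≤64k⁶ (ub S ci) (s≤s (≤-trans (1≤⇒≤* _ 1≤κ) (m/n*n≤m ∣ S ∣ κ)))
        ; src⁻ = λ u∈ → let i , ¬c = f u∈ in x∈∁p⇒x∉p (elems⁻ i) , ¬c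
        ; src⁺ = λ u∉S u∉ → f′ (elems⁺ (x∉p⇒x∈∁p u∉S)) u∉
        ; snk⁻ = λ u∈ → let i , ¬c = h u∈ in x∈∁p⇒x∉p (elems⁻ i) , ¬c
        ; snk⁺ = λ u∉S u∉ → h′ (elems⁺ (x∉p⇒x∈∁p u∉S)) u∉ }
      next : ∀ g src snk (r : Search.Outcome S src snk) →
             Call (λ M → ((((Common S M × Bounded (2 * s) S M) × Gap g S M) × Collected one (λ _ → S) id es src M) × Collected two (λ _ → S) id es snk M)
               × Search.Post S src snk r M) Max (reach-max * g)
      next g src snk Search.optimal = return S λ M (((((ci , _) , _) , _) , _) , opt) → (ci , opt) , z≤n
      next zero src snk (Search.better S′) = return S λ M ((((_ , gap) , _) , _) , (ci′ , lt)) →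
        ⊥-elim (<-irrefl refl (<-≤-trans lt (≤-trans (gap S′ ci′) (≤-reflexive (+-identityʳ _))))) , z≤n
      next (suc g) src snk (Search.better S′) = weaken (exact g S′) λ M (((((_ , ub) , gap) , _) , _) , (ci′ , lt)) →
        ((ci′ , ub) , λ T ci → ≤-trans (gap T ci) (≤-trans (≤-reflexive (+-suc ∣ S ∣ g)) (+-monoˡ-≤ g lt))) , ≤-refl

module Phases {n : ℕ} (s k y : ℕ) where
  open Costs n s k y
  open Exact {n} s k using (Max; Bounded; Gap)

  module _ (1≤k : 1 ≤ k) (1≤s : 1 ≤ s) (s≤n : s ≤ n) (1≤y : 1 ≤ y) (k⁶≤s : κ * κ * κ ≤ s) (s≤64k⁶ : s ≤ κ * κ * κ * 64)
    (auction-ok : y < s → n * s ≤ y * y * y * 64) where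

    private
      instance
        y-nonZero : NonZero y
        y-nonZero = >-nonZero 1≤y

      D₁ : ℕ
      D₁ = suc (s / y)

    -- For `y ≥ s` the maximal set is within `s` of the optimum and the auction is skipped.
    -- Otherwise about s / y levels lose at most `2 * y` by averaging, and the pending proposals at
    -- most `y`.
    approximate : ∀ S₀ → ∣ S₀ ∣ ≡ s → Call (λ M → Common S₀ M × Bounded (2 * s) S₀ M) (λ S M → Common S M × Gap (3 * y) S M) (n + y * 128 * (n + n))
    approximate S₀ eq with y <? s
    ... | no y≮s = return S₀ λ M (ci , ub) → (ci , λ T ct → ≤-trans (ub T ct)
            (≤-trans (≤-reflexive (cong (s +_) (+-identityʳ s))) (+-mono-≤ (≤-reflexive (sym eq)) (≤-trans (≮⇒≥ y≮s) (m≤m+n y _))))) , z≤n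
    ... | yes y<s = weaken (strengthen (Auction.auction D₁ y 1≤y (y * 128) rounds-ok) λ S M (_ , ub) (ci , bd) → ci , λ T ct →
            *-cancelˡ-≤ D₁ (≤-trans (bd T ct) (≤-trans (+-monoʳ-≤ (D₁ * (∣ S ∣ + y)) (≤-trans (ub S ci) (≤-trans (*-monoʳ-≤ 2 (div-upper s y)) (≤-reflexive (r₁ D₁ y)))))
              (≤-reflexive (r₂ D₁ ∣ S ∣ y))))) λ M k → k , ≤-refl
      where
      r₁ : ∀ D y → 2 * (D * y) ≡ D * (2 * y)
      r₁ = solve-∀
      r₂ : ∀ D a y → D * (a + y) + D * (2 * y) ≡ D * (a + 3 * y)
      r₂ = solve-∀
      r₃ : ∀ n D y → n * D * y ≡ n * (D * y)
      r₃ = solve-∀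
      r₄ : ∀ n s → n * (s + s) ≡ n * s * 2
      r₄ = solve-∀
      r₅ : ∀ a y → y * y * y * a * 2 ≡ y * (2 * a) * y * y
      r₅ = solve-∀
      -- Since `D₁ * y ≤ 2 * s`, the bound `n * s ≤ y * y * y * 64` makes `y * 128` rounds enough.
      rounds-ok : n * D₁ ≤ y * 128 * y
      rounds-ok = *-cancelʳ-≤ (n * D₁) (y * 128 * y) y (begin
        n * D₁ * y ≡⟨ r₃ n D₁ y ⟩
        n * (D₁ * y) ≤⟨ *-monoʳ-≤ n (≤-trans (div-lower s y) (+-monoˡ-≤ s (<⇒≤ y<s))) ⟩
        n * (s + s) ≡⟨ r₄ n s ⟩
        n * s * 2 ≤⟨ *-monoˡ-≤ 2 (auction-ok y<s) ⟩
        y * y * y * 64 * 2 ≡⟨ r₅ 64 y ⟩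
        y * 128 * y * y ∎)
        where open ≤-Reasoning

    2s≤2^ℓ : 2 * s ≤ 2 ^ ℓ
    2s≤2^ℓ = ≤-trans (*-monoˡ-≤ s (≤ᵇ⇒≤ 2 5 tt)) (5s≤2^ℓ 1≤k 1≤s s≤n 1≤y k⁶≤s s≤64k⁶)

    1≤d : 1 ≤ d
    1≤d = 1≤* (1≤* (1≤* 1≤k 1≤k) (1≤* 1≤k 1≤k)) 1≤k

    -- The set has at most 2 s ≤ 128 k⁶ = d · 128 k elements, so `d` levels leave a gap of at most
    -- `k * 128`.
    improve : ∀ S → Call (λ M → (Common S M × Bounded (2 * s) S M) × Gap (3 * y) S M) (λ S′ M → Common S′ M × Gap (k * 128) S′ M)
                (n * d + sweep-max * suc (3 * y))
    improve S = weaken (strengthen (ShortestPath.shortestPaths d ℓ (2 * s) 2s≤2^ℓ (3 * y) S 1≤d)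
        λ S′ M ((ub , _) , _) (ci , bd) → ci , λ T ct → *-cancelˡ-≤ d {{>-nonZero 1≤d}} (≤-trans (bd T ct)
          (≤-trans (+-monoʳ-≤ (d * ∣ S′ ∣) (≤-trans (ub S′ ci) (≤-trans (Exact.2s≤ {n} s k 1≤k 1≤s s≤n k⁶≤s s≤64k⁶) (≤-reflexive (r₁ 128 k)))))
            (≤-reflexive (sym (*-distribˡ-+ d ∣ S′ ∣ (k * 128)))))))
      λ M ((ci , ub) , gap) → ((ub , ci) , gap) , +-monoʳ-≤ (n * d) (*-monoˡ-≤ (suc (3 * y))
        (+-monoʳ-≤ 3 (+-monoʳ-≤ (3 * n) (+-monoˡ-≤ (d + d * ℓ) (*-monoʳ-≤ ℓ (*-monoˡ-≤ s (≤ᵇ⇒≤ 2 5 tt)))))))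
      where
      r₁ : ∀ a k → (k * k) * (k * k) * (k * k) * a ≡ (k * k) * (k * k) * k * (k * a)
      r₁ = solve-∀

    solve : ∀ S₀ → ∣ S₀ ∣ ≡ s → Call (λ M → Common S₀ M × Bounded (2 * s) S₀ M) Max
              ((n + y * 128 * (n + n)) + ((n * d + sweep-max * suc (3 * y)) + reach-max * suc (k * 128)))
    solve S₀ eq = call (approximate S₀ eq) λ S →
      call (weaken (improve S) λ M ((_ , ub) , (ci , gap)) → ((ci , ub) , gap) , ≤-refl) λ S′ →
      weaken (Exact.exact s k 1≤k 1≤s s≤n k⁶≤s s≤64k⁶ (k * 128) S′) λ M (((_ , ub) , _) , (ci , gap)) → ((ci , ub) , gap) , ≤-refl

toAlg : ∀ {n} → Tree n (Subset n) → Alg n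
toAlg (ret S) = ret S
toAlg (ask X i t) = ask X i (λ b → toAlg (t b))

run-toAlg : ∀ {n} (t : Tree n (Subset n)) (M : Inst n) →
            run (toAlg t) (proj₁ M) (proj₂ M) ≡ (result t M , queries t M)
run-toAlg (ret S) M = refl
run-toAlg (ask X one t) M rewrite run-toAlg (t (indep (proj₁ M) X)) M = refl
run-toAlg (ask X two t) M rewrite run-toAlg (t (indep (proj₂ M) X)) M = refl

bound-n·d : ∀ {n q R L d L′} c {C} → c ^ 6 ≤ C → q ≤ n * (d * L) * c → d ^ 6 ≤ R ^ 5 → L ≤ L′ →
            q ^ 6 ≤ C * (n ^ 6 * R ^ 5 * L′ ^ 6)
bound-n·d {n} {q} {R} {L} {d} {L′} c {C} c≤ q≤ d≤ L≤ = begin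
  q ^ 6 ≤⟨ ^-monoˡ-≤ 6 q≤ ⟩
  (n * (d * L) * c) ^ 6 ≡⟨ ^-distrib-* (n * (d * L)) c 6 ⟩
  (n * (d * L)) ^ 6 * c ^ 6 ≡⟨ cong (_* c ^ 6) (trans (^-distrib-* n (d * L) 6) (cong (n ^ 6 *_) (^-distrib-* d L 6))) ⟩
  n ^ 6 * (d ^ 6 * L ^ 6) * c ^ 6 ≤⟨ *-mono-≤ (*-monoʳ-≤ (n ^ 6) (*-mono-≤ d≤ (^-monoˡ-≤ 6 L≤))) c≤ ⟩
  n ^ 6 * (R ^ 5 * L′ ^ 6) * C ≡⟨ trans (*-comm _ C) (cong (C *_) (sym (*-assoc (n ^ 6) (R ^ 5) (L′ ^ 6)))) ⟩
  C * (n ^ 6 * R ^ 5 * L′ ^ 6) ∎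
  where open ≤-Reasoning

bound-n·y : ∀ {n q s R L y L′} c {C} → c ^ 5 ≤ C → q ≤ n * y * c → y ^ 5 ≤ n * (s * s * s) * (L * L * L * L) → s ≤ R → L ≤ L′ →
            q ^ 5 ≤ C * (n ^ 6 * R ^ 3 * L′ ^ 4)
bound-n·y {n} {q} {s} {R} {L} {y} {L′} c {C} c≤ q≤ y≤ s≤ L≤ = begin
  q ^ 5 ≤⟨ ^-monoˡ-≤ 5 q≤ ⟩
  (n * y * c) ^ 5 ≡⟨ trans (^-distrib-* (n * y) c 5) (cong (_* c ^ 5) (^-distrib-* n y 5)) ⟩
  n ^ 5 * y ^ 5 * c ^ 5 ≤⟨ *-mono-≤ (*-monoʳ-≤ (n ^ 5) (≤-trans y≤ (*-mono-≤ (*-monoʳ-≤ n (*-mono-≤ (*-mono-≤ s≤ s≤) s≤)) (*-mono-≤ (*-mono-≤ (*-mono-≤ L≤ L≤) L≤) L≤)))) c≤ ⟩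
  n ^ 5 * (n * (R * R * R) * (L′ * L′ * L′ * L′)) * C ≡⟨ trans (r₁ (n ^ 5) n (R * R * R) (L′ * L′ * L′ * L′) C) (cong₂ (λ u v → C * (n ^ 6 * u * v)) (r₂ R) (r₃ L′)) ⟩
  C * (n ^ 6 * R ^ 3 * L′ ^ 4) ∎
  where
  open ≤-Reasoning
  r₁ : ∀ m n u v C → m * (n * u * v) * C ≡ C * (n * m * u * v)
  r₁ = solve-∀
  r₂ : ∀ R → R * R * R ≡ R * (R * (R * 1))
  r₂ = solve-∀
  r₃ : ∀ L → L * L * L * L ≡ L * (L * (L * (L * 1)))
  r₃ = solve-∀

-- Opaque, so that powers of these numerals are not evaluated during type checking.
abstract
  cₗ cᵣ : ℕ
  cₗ = 1294209
  cᵣ = 33717139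

  cₗ-def : 1294209 ≡ cₗ
  cₗ-def = refl

  cᵣ-def : 33717139 ≡ cᵣ
  cᵣ-def = refl

  2≤cₗ : 2 ≤ cₗ
  2≤cₗ = ≤ᵇ⇒≤ 2 1294209 tt

C₀ : ℕ
C₀ = cₗ ^ 6 + cᵣ ^ 5

C₀-left : cₗ ^ 6 ≤ C₀
C₀-left = m≤m+n (cₗ ^ 6) (cᵣ ^ 5)

C₀-right : cᵣ ^ 5 ≤ C₀
C₀-right = m≤n+m (cᵣ ^ 5) (cₗ ^ 6)

queryBound₁ : ∀ {C n r q d L} c → c ^ 6 ≤ C → q ≤ n * (d * L) * c → d ^ 6 ≤ (r ⊔ 1) ^ 5 → L ≤ suc ⌊log₂ r ⌋ → QueryBound C n r q
queryBound₁ {C} {n} {r} {q} {d} {L} c c≤ q≤ d≤ L≤ = inj₁ (bound-n·d {n} {q} {r ⊔ 1} {L} {d} {suc ⌊log₂ r ⌋} c {C} c≤ q≤ d≤ L≤)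

queryBound₂ : ∀ {C n r q s L y} c → c ^ 5 ≤ C → q ≤ n * y * c → y ^ 5 ≤ n * (s * s * s) * (L * L * L * L) → s ≤ r ⊔ 1 → L ≤ suc ⌊log₂ r ⌋ →
              QueryBound C n r q
queryBound₂ {C} {n} {r} {q} {s} {L} {y} c c≤ q≤ y≤ s≤ L≤ = inj₂ (bound-n·y {n} {q} {s} {r ⊔ 1} {L} {y} {suc ⌊log₂ r ⌋} c {C} c≤ q≤ y≤ s≤ L≤)

-- Choice of the parameters in the two regimes

record Parameters (n s : ℕ) : Set where
  field
    k y : ℕ
  open Costs n s k y using (κ; total) public
  field
    1≤k : 1 ≤ k
    1≤y : 1 ≤ y
    k⁶≤s : κ * κ * κ ≤ s
    s≤64k⁶ : s ≤ κ * κ * κ * 64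
    -- Makes the auction cost O(n y); it is demanded only when the auction runs.
    few : y < s → n * s ≤ y * y * y * 64
    bounded : ∀ {q r} → q ≤ total → s ≤ r → QueryBound C₀ n r q

module _ {n s : ℕ} (1≤s : 1 ≤ s) (s≤n : s ≤ n) where

  private
    bits≤ : ∀ {r} → s ≤ r → bits s ≤ suc ⌊log₂ r ⌋
    bits≤ s≤r = ≤-trans (≤-reflexive (bits-def s)) (s≤s (⌊log₂⌋-mono-≤ s≤r))

    s≤⊔ : ∀ {r} → s ≤ r → s ≤ r ⊔ 1
    s≤⊔ s≤r = ≤-trans s≤r (m≤m⊔n _ 1)

    pow6 : ∀ k → k ^ 6 ≡ (k * k) * (k * k) * (k * k)
    pow6 = solve-∀′
      where
      solve-∀′ : ∀ k → k * (k * (k * (k * (k * (k * 1))))) ≡ (k * k) * (k * k) * (k * k)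
      solve-∀′ = solve-∀

  module _ (k : ℕ) (k⁶≤ : k ^ 6 ≤ s) (<k⁶ : s < suc k ^ 6) where
    private
      κ = k * k

      1≤k : 1 ≤ k
      1≤k = ≮⇒≥ λ k<1 → <⇒≱ <k⁶ (≤-trans (^-monoˡ-≤ 6 k<1) 1≤s)

      k⁶≤s : κ * κ * κ ≤ s
      k⁶≤s = ≤-trans (≤-reflexive (sym (pow6 k))) k⁶≤

      s≤64k⁶ : s ≤ κ * κ * κ * 64
      s≤64k⁶ = ≤-trans (<⇒≤ <k⁶) (≤-trans (^-monoˡ-≤ 6 (≤-trans (+-monoˡ-≤ k 1≤k) (≤-reflexive (r k))))
        (≤-reflexive (trans (^-distrib-* k 2 6) (cong (_* 64) (pow6 k)))))
        where
        r : ∀ k → k + k ≡ k * 2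
        r = solve-∀

    parameters-d : n ≤ κ * κ * κ * κ * k → Parameters n s
    parameters-d n≤ = record
      { k = k ; y = d ; 1≤k = 1≤k ; 1≤y = 1≤d ; k⁶≤s = k⁶≤s ; s≤64k⁶ = s≤64k⁶
      -- The regime boundary comes from here: k⁹ · 64 k⁶ = 64 d³.
      ; few = λ _ → ≤-trans (*-mono-≤ n≤ s≤64k⁶) (≤-reflexive (r₁ 64 k))
      ; bounded = λ {q} {r} q≤ s≤r → queryBound₁ {C₀} {n} {r} {q} {d} {bits s} cₗ C₀-left (≤-trans q≤ (subst (λ c → Costs.total n s k d ≤ n * (d * bits s) * c) cₗ-def (Costs.total-d n s k d 1≤k 1≤s s≤n 1≤d k⁶≤s s≤64k⁶ refl)))
          (≤-trans (≤-reflexive r₂) (^-monoˡ-≤ 5 (≤-trans k⁶≤s (s≤⊔ s≤r)))) (bits≤ s≤r) }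
      where
      d : ℕ
      d = κ * κ * k
      1≤d : 1 ≤ d
      1≤d = 1≤* (1≤* (1≤* 1≤k 1≤k) (1≤* 1≤k 1≤k)) 1≤k
      r₁ : ∀ a k → (k * k) * (k * k) * (k * k) * (k * k) * k * ((k * k) * (k * k) * (k * k) * a) ≡
           ((k * k) * (k * k) * k) * ((k * k) * (k * k) * k) * ((k * k) * (k * k) * k) * a
      r₁ = solve-∀
      r₂ : d ^ 6 ≡ (κ * κ * κ) ^ 5
      r₂ = trans (cong (_^ 6) (r₄ k)) (trans (^-*-assoc k 5 6) (trans (sym (^-*-assoc k 6 5)) (cong (_^ 5) (pow6 k))))
        where
        r₄ : ∀ k → (k * k) * (k * k) * k ≡ k * (k * (k * (k * (k * 1))))
        r₄ = solve-∀

    parameters-y : κ * κ * κ * κ * k < n → Parameters n s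
    parameters-y <n = record
      { k = k ; y = y ; 1≤k = 1≤k ; 1≤y = 1≤y ; k⁶≤s = k⁶≤s ; s≤64k⁶ = s≤64k⁶
      ; few = few′
      ; bounded = λ {q} {r} q≤ s≤r → queryBound₂ {C₀} {n} {r} {q} {s} {bits s} {y} cᵣ C₀-right (≤-trans q≤ (subst (λ c → Costs.total n s k y ≤ n * y * c) cᵣ-def (Costs.total-y n s k y 1≤k 1≤s s≤n 1≤y k⁶≤s s≤64k⁶ <n y-upper)))
          y-lower (s≤⊔ s≤r) (bits≤ s≤r) }
      where
      L N y : ℕ
      L = bits s
      N = n * (s * s * s) * (L * L * L * L)
      y = proj₁ (root 4 N)
      y-lower : y ^ 5 ≤ N
      y-lower = proj₁ (proj₂ (root 4 N))
      y-upper : N < suc y ^ 5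
      y-upper = proj₂ (proj₂ (root 4 N))
      1≤L : 1 ≤ L
      1≤L = ≤-trans (s≤s z≤n) (≤-reflexive (sym (bits-def s)))
      1≤L⁴ : 1 ≤ L * L * L * L
      1≤L⁴ = 1≤* (1≤* (1≤* 1≤L 1≤L) 1≤L) 1≤L
      1≤y : 1 ≤ y
      1≤y = ≮⇒≥ λ y<1 → <⇒≱ y-upper (≤-trans (^-monoˡ-≤ 5 y<1) (1≤* (1≤* (≤-trans 1≤s s≤n) (1≤* (1≤* 1≤s 1≤s) 1≤s)) 1≤L⁴))
      -- The choice of `y` gives n s³ ≤ 32 y⁵, and y < s allows y² to be replaced by s² and
      -- cancelled.
      few′ : y < s → n * s ≤ y * y * y * 64
      few′ y<s = *-cancelʳ-≤ (n * s) _ (s * s) {{>-nonZero (1≤* 1≤s 1≤s)}} (begin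
        n * s * (s * s) ≡⟨ r₁ n s ⟩
        n * (s * s * s) ≤⟨ ≤-trans (1≤⇒≤* _ 1≤L⁴) (<⇒≤ y-upper) ⟩
        suc y ^ 5 ≤⟨ ^-monoˡ-≤ 5 (≤-trans (+-monoˡ-≤ y 1≤y) (≤-reflexive (r₂ y))) ⟩
        (y * 2) ^ 5 ≡⟨ trans (^-distrib-* y 2 5) (cong (_* 32) (r₃ y)) ⟩
        y * y * y * (y * y) * 32 ≤⟨ *-mono-≤ (*-monoʳ-≤ (y * y * y) (*-mono-≤ (<⇒≤ y<s) (<⇒≤ y<s))) (≤ᵇ⇒≤ 32 64 tt) ⟩
        y * y * y * (s * s) * 64 ≡⟨ r₄ 64 (y * y * y) (s * s) ⟩
        y * y * y * 64 * (s * s) ∎)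
        where
        open ≤-Reasoning
        r₁ : ∀ n s → n * s * (s * s) ≡ n * (s * s * s)
        r₁ = solve-∀
        r₂ : ∀ y → y + y ≡ y * 2
        r₂ = solve-∀
        r₃ : ∀ y → y * (y * (y * (y * (y * 1)))) ≡ y * y * y * (y * y)
        r₃ = solve-∀
        r₄ : ∀ a u v → u * v * a ≡ u * a * v
        r₄ = solve-∀

  parameters : Parameters n s
  parameters with root 5 s
  ... | k , lo , hi with n ≤? k * k * (k * k) * (k * k) * (k * k) * k
  ... | yes p = parameters-d k lo hi p
  ... | no p = parameters-y k lo hi (≰⇒> p)

module Algorithm (n : ℕ) where

  Maximal : Subset n → Inst n → Set
  Maximal S M = Common S M × (∀ T → Common T M → ∣ T ∣ ≤ 2 * ∣ S ∣)

  Max : Subset n → Inst n → Set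
  Max S M = MaxCommonIndep (proj₁ M) (proj₂ M) S

  -- Every element is spanned by `S` in one of the two matroids; the cut at the `M₁` span of `S` has
  -- `S` on both sides, hence the factor two.
  maximal : Call (λ _ → ⊤) Maximal (n * 2)
  maximal = weaken (strengthen (greedy (λ _ → 0) one (two ∷ []) (allFin n)) λ S M _ g → ok′ S M g)
    λ M _ → tt , *-monoˡ-≤ 2 (≤-reflexive (List.length-tabulate {n = n} id))
    where
    ok′ : ∀ S M → GreedyPost (λ _ → 0) (one ∷ two ∷ []) ⊥ (sortBy (λ _ → 0) (allFin n)) S M → Maximal S M
    ok′ S M (_ , _ , i₁ ∷ i₂ ∷ [] , sp) = (i₁ , i₂) , λ T ci → ≤-trans
      (cut-bound (proj₁ M) (proj₂ M) (Closure.cl? (proj₁ M) S) i₁ i₂ ci (λ _ c → c) second)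
      (≤-reflexive (cong (∣ S ∣ +_) (sym (+-identityʳ _))))
      where
      second : ∀ e → ¬ Span one M S e → Span two M S e
      second e ¬c with sp (∈-resp-↭ (↭-sym (sortBy-↭ (λ _ → 0) _)) (∈-allFin e))
      ... | .one , here refl , c = ⊥-elim (¬c (Closure.cl-mono (proj₁ M) (proj₁ ∘ below⁻) c))
      ... | .two , there (here refl) , c = Closure.cl-mono (proj₂ M) (proj₁ ∘ below⁻) c

  record Continuation (S₀ : Subset n) : Set where
    field
      budget : ℕ
      program : Call (Maximal S₀) Max budget
      bounded : ∀ {q r} → q ≤ n * 2 + budget → ∣ S₀ ∣ ≤ r → QueryBound C₀ n r q

  continue : ∀ S₀ → Continuation S₀
  continue S₀ with ∣ S₀ ∣ ≟ 0
  -- An empty maximal set is already a maximum; its 2 n queries fit the first bound because `r` is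
  -- guarded by 1.
  ... | yes eq = record
    { budget = 0
    ; program = return S₀ λ M (ci , ub) → (ci , λ T ct → ≤-trans (ub T ct) (≤-trans (≤-reflexive (cong (2 *_) eq)) z≤n)) , z≤n
    ; bounded = λ {q} {r} q≤ _ → queryBound₁ {C₀} {n} {r} {q} {1} {1} 2 (≤-trans (^-monoˡ-≤ 6 2≤cₗ) C₀-left)
        (≤-trans q≤ (≤-reflexive (trans (+-identityʳ _) (cong (_* 2) (sym (*-identityʳ n))))))
        (^-monoˡ-≤ 5 (m≤n⊔m r 1)) (s≤s z≤n) }
  ... | no ne = record
    { budget = (n + y * 128 * (n + n)) + ((n * (κ * κ * k) + Costs.sweep-max n s k y * suc (3 * y)) + Costs.reach-max n s k y * suc (k * 128))
    ; program = Phases.solve s k y 1≤k 1≤s s≤n 1≤y k⁶≤s s≤64k⁶ few S₀ refl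
    ; bounded = Parameters.bounded ps }
    where
    s : ℕ
    s = ∣ S₀ ∣
    1≤s : 1 ≤ s
    1≤s = n≢0⇒n>0 ne
    s≤n : s ≤ n
    s≤n = ∣p∣≤n S₀
    ps : Parameters n s
    ps = parameters 1≤s s≤n
    open Parameters ps

  algorithm : Tree n (Subset n)
  algorithm = tree maximal >>= λ S₀ → tree (Continuation.program (continue S₀))

  correct : ∀ M → Max (result algorithm M) M × QueryBound C₀ n ∣ result algorithm M ∣ (queries algorithm M)
  correct M rewrite result->>= (tree maximal) (λ S₀ → tree (Continuation.program (continue S₀))) M
                  | queries->>= (tree maximal) (λ S₀ → tree (Continuation.program (continue S₀))) M =
    mx , Continuation.bounded (continue S₀) (+-mono-≤ (≤-trans (m≤m+n _ 0) (proj₂ p)) (≤-trans (m≤m+n _ 0) (proj₂ p′))) (proj₂ mx S₀ (proj₁ (proj₁ p)))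
    where
    S₀ = result (tree maximal) M
    p = ok maximal M tt
    p′ = ok (Continuation.program (continue S₀)) M (proj₁ p)
    mx = proj₁ p′

theorem4p7 : Σ ((n : ℕ) → Alg n) λ alg → Σ ℕ λ C →
    (n : ℕ) (M₁ M₂ : Matroid n) →
    MaxCommonIndep M₁ M₂ (proj₁ (run (alg n) M₁ M₂))
    × QueryBound C n ∣ proj₁ (run (alg n) M₁ M₂) ∣ (proj₂ (run (alg n) M₁ M₂))
theorem4p7 = (λ n → toAlg (Algorithm.algorithm n)) , C₀ , λ n M₁ M₂ →
  subst (λ p → MaxCommonIndep M₁ M₂ (proj₁ p) × QueryBound C₀ n ∣ proj₁ p ∣ (proj₂ p))
    (sym (run-toAlg (Algorithm.algorithm n) (M₁ , M₂))) (Algorithm.correct n (M₁ , M₂))
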